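{- The Wadge hierarchy of the class $\mathbf{r}\text{ - }\mathbf{PN}_\omega=\bigcup_{k\ge1}\mathbf{r}\text{ - }\mathbf{BCL}(k)_\omega$ of $\omega$-languages of real-time non-deterministic Petri nets is equal to the Wadge hierarchy of the class $\Sigma^1_1$ of effective analytic sets. Moreover, the Wadge hierarchy of the class $\mathbf{PN}_\omega$ of $\omega$-languages of (possibly non-real-time) non-deterministic Petri nets is also equal to the Wadge hierarchy of the class $\Sigma^1_1$ of effective analytic sets.
   Context: **Blind counter automata and Petri nets.** For $k\ge 1$, a real time $k$-blind-counter machine is $\mathcal M=(K,\Sigma,\Delta,q_0)$ with $K$ a finite set of states, $\Sigma$ a finite alphabet, $q_0\in K$, and $\Delta\subseteq K\times\Sigma\times\{0,1\}^k\times K\times\{0,1,-1\}^k$, such that if $(q,a,i_1,\dots,i_k,q',j_1,\dots,j_k)\in\Delta$ and $i_m=0$ then $j_m\in\{0,1\}$, and the tuple obtained by replacing $i_m=0$ by $i_m=1$ (all other entries unchanged) is also in $\Delta$. Configurations are tuples $(q,c_1,\dots,c_k)$ with $q\in K$, $c_i\in\mathbb N$. Write $a:(q,c_1,\dots,c_k)\mapsto_{\mathcal M}(q',c_1+j_1,\dots,c_k+j_k)$ if $(q,a,i_1,\dots,i_k,q',j_1,\dots,j_k)\in\Delta$ where $i_m=0$ if $c_m=0$ and $i_m=1$ if $c_m>0$. A run on $\sigma=a_1a_2\cdots\in\Sigma^\omega$ is an infinite sequence of configurations $(r_i)_{i\ge1}$ with $r_1=(q_0,0,\dots,0)$ and $a_i:r_i\mapsto_{\mathcal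 M}r_{i+1}$ for all $i\ge1$. A (non-deterministic) real time Büchi $k$-blind-counter automaton is such a machine together with a set $F\subseteq K$; it accepts the set of $\sigma\in\Sigma^\omega$ having a run in which some state of $F$ occurs infinitely often. $\mathbf{r}\text{ - }\mathbf{BCL}(k)_\omega$ is the class of $\omega$-languages, over finite alphabets, accepted by these automata. Petri nets are regarded as (partially) blind multicounter automata, so $\mathbf{r}\text{ - }\mathbf{PN}_\omega=\bigcup_{k\ge1}\mathbf{r}\text{ - }\mathbf{BCL}(k)_\omega$. The class $\mathbf{PN}_\omega$ is defined in the same way but with automata that may also have $\lambda$-transitions ($\lambda$ the empty word), i.e. $\Delta\subseteq K\times(\Sigma\cup\{\lambda\})\times\{0,1\}^k\times K\times\{0,1,-1\}^k$, where a run on $\sigma\in\Sigma^\omega$ is an infinite sequence of configurations from $(q_0,0,\dots,0)$ whose successive labels $b_1,b_2,\dots\in\Sigma\cup\{\lambda\}$ concatenate to $\sigma$. **Effective analytic sets.** For $\sigma\in\Sigma^\omega$, $\sigma[m]$ is its prefix of length $m$. $L\subseteq\Sigma^\omega$ is in (lightface) $\Sigma^1_1$ iff there is a recursive relation $R\subseteq\mathbb N\times\{0,1\}^\star\times\Sigma^\star$ such that $L=\{\sigma\in\Sigma^\omega\mid\exists\tau\in\{0,1\}^\omega\ \forall n\ \exists m\ (n,\tau[m],\sigma[m])\in R\}$. **Wadge reducibility.** $\Sigma^\omega$ carries the Cantor (product) topology. For $L\subseteq X^\omega$, $L'\subseteq Y^\omega$ ($X,Y$ finite alphabets), $L\le_W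 L'$ iff there is a continuous $f:X^\omega\to Y^\omega$ with $L=f^{ -1}(L')$; $L\equiv_W L'$ iff $L\le_W L'$ and $L'\le_W L$. The Wadge hierarchy of a class $\mathcal C$ of $\omega$-languages consists of the Borel sets in $\mathcal C$, up to $\equiv_W$ and ordered by $\le_W$; the Wadge hierarchies of $\mathcal C$ and $\mathcal D$ are equal if every Borel set in $\mathcal C$ is Wadge equivalent to a set in $\mathcal D$ and every Borel set in $\mathcal D$ is Wadge equivalent to a set in $\mathcal C$. -}

module Defs where

open import Data.Bool.Base using (Bool; T)
open import Data.Fin.Base using (Fin; zero; suc; toℕ)
open import Data.Fin.Patterns using (0F; 1F)
open import Data.Fin.Subset using (Subset) renaming (_∈_ to _∈ₛ_)
open import Data.Integer.Base as ℤ using (ℤ; +_; 0ℤ; 1ℤ; -1ℤ)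
open import Data.List.Base using (List; foldr; applyUpTo; catMaybes)
open import Data.Maybe.Base using (Maybe)
open import Data.Nat.Base using (ℕ; zero; suc; _+_; _*_; _≤_; _<_)
open import Data.Product.Base using (Σ-syntax; ∃; ∃-syntax; _×_; _,_)
open import Data.Sum.Base using (_⊎_)
open import Data.Vec.Base using (Vec; []; _∷_; lookup; map; replicate; _[_]≔_)
open import Function.Base using (_∘_)
open import Function.Bundles using (_⇔_)
open import Level using (Level; 0ℓ) renaming (suc to lsuc; _⊔_ to _⊔ˡ_)
open import Relation.Binary.PropositionalEquality.Core using (_≡_)
open import Relation.Nullary.Negation.Core using (¬_)
open import Relation.Unary using (Pred; _∈_; _≐_; ∁; ⋃)

private
  variable
    c d : Level

------------------------------------------------------------------------
-- ω-words and ω-languages over the alphabet Fin n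

ωWord : ℕ → Set
ωWord n = ℕ → Fin n

ωLang : ℕ → Set₁
ωLang n = Pred (ωWord n) 0ℓ

infix 8 _↾_

_↾_ : {A : Set} → (ℕ → A) → ℕ → List A
_↾_ = applyUpTo

-- A class of ω-languages over finite alphabets.
Class : (c : Level) → Set (lsuc c)
Class c = (n : ℕ) → Pred (ωLang n) c

------------------------------------------------------------------------
-- Blind counter machines

data Action : Set where
  hold inc dec : Action

value : Action → ℤ
value hold = 0ℤ
value inc  = 1ℤ
value dec  = -1ℤ

-- Transitions are labelled by elements of Lab: letters for real-time
-- machines, Maybe letters (nothing being the empty word λ) otherwise.
record Machine (k : ℕ) (Lab : Set) : Set where
  field
    states : ℕ
    q₀     : Fin states
    -- Characteristic function of the transition relation.
    Δ      : Fin states → Lab → Vec (Fin 2) k → Fin states → Vec Action k → Bool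
    blind  : ∀ q a i q′ j → T (Δ q a i q′ j) →
             ∀ m → lookup i m ≡ 0F →
             (lookup j m ≡ hold ⊎ lookup j m ≡ inc) ×
             T (Δ q a (i [ m ]≔ 1F) q′ j)

  Config : Set
  Config = Fin states × Vec ℕ k

  state : Config → Fin states
  state (q , _) = q

  test : ℕ → Fin 2
  test zero    = 0F
  test (suc _) = 1F

  _∶_↦_ : Lab → Config → Config → Set
  a ∶ (q , cs) ↦ (q′ , cs′) = ∃[ j ]
    T (Δ q a (map test cs) q′ j) ×
    (∀ m → + lookup cs′ m ≡ + lookup cs m ℤ.+ value (lookup j m))

  record Run (b : ℕ → Lab) : Set where
    field
      config  : ℕ → Config
      initial : config 0 ≡ (q₀ , replicate k 0)
      step    : ∀ t → b t ∶ config t ↦ config (suc t)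

record BüchiAutomaton (k : ℕ) (Lab : Set) : Set where
  field
    machine : Machine k Lab
  open Machine machine public
  field
    F : Subset states

  Accepting : ∀ {b} → Run b → Set
  Accepting r = ∃[ q ] q ∈ₛ F ×
    (∀ t → ∃[ t′ ] t ≤ t′ × state (Run.config r t′) ≡ q)

  AcceptsLabels : (ℕ → Lab) → Set
  AcceptsLabels b = Σ[ r ∈ Run b ] Accepting r

open BüchiAutomaton using (AcceptsLabels)

-- The labels b 0, b 1, … concatenate to σ.  The second conjunct rules
-- out label sequences that are λ from some point on.
ConcatenatesTo : ∀ {n} → (ℕ → Maybe (Fin n)) → ωWord n → Set
ConcatenatesTo b σ =
  (∀ t → ∃[ m ] catMaybes (b ↾ t) ≡ σ ↾ m) ×
  (∀ m → ∃[ t ] catMaybes (b ↾ t) ≡ σ ↾ m)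

realTimeLanguage : ∀ {k n} → BüchiAutomaton k (Fin n) → ωLang n
realTimeLanguage A σ = AcceptsLabels A σ

language : ∀ {k n} → BüchiAutomaton k (Maybe (Fin n)) → ωLang n
language A σ = ∃[ b ] ConcatenatesTo b σ × AcceptsLabels A b

r-BCLω : ℕ → Class 0ℓ
r-BCLω k n L = Σ[ A ∈ BüchiAutomaton k (Fin n) ] L ≐ realTimeLanguage A

BCLω : ℕ → Class 0ℓ
BCLω k n L = Σ[ A ∈ BüchiAutomaton k (Maybe (Fin n)) ] L ≐ language A

r-PNω : Class 0ℓ
r-PNω n L = ∃[ k ] 1 ≤ k × r-BCLω k n L

PNω : Class 0ℓ
PNω n L = ∃[ k ] 1 ≤ k × BCLω k n L

------------------------------------------------------------------------
-- Recursive relations, via partial recursive functions on ℕ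

data Rec : ℕ → Set where
  zeroᴿ : Rec 0
  sucᴿ  : Rec 1
  projᴿ : ∀ {n} → Fin n → Rec n
  compᴿ : ∀ {m n} → Rec m → Vec (Rec n) m → Rec n
  precᴿ : ∀ {n} → Rec n → Rec (2 + n) → Rec (1 + n)
  muᴿ   : ∀ {n} → Rec (1 + n) → Rec n

infix 4 _[_]↓_

-- f [ xs ]↓ y : the computation of f on xs halts with value y.
data _[_]↓_ : ∀ {n} → Rec n → Vec ℕ n → ℕ → Set where
  zero↓  : zeroᴿ [ [] ]↓ 0
  suc↓   : ∀ {x} → sucᴿ [ x ∷ [] ]↓ suc x
  proj↓  : ∀ {n} {xs : Vec ℕ n} i → projᴿ i [ xs ]↓ lookup xs i
  comp↓  : ∀ {m n} {f : Rec m} {gs : Vec (Rec n) m} {xs ys z} →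
           (∀ i → lookup gs i [ xs ]↓ lookup ys i) →
           f [ ys ]↓ z → compᴿ f gs [ xs ]↓ z
  prec↓0 : ∀ {n} {f : Rec n} {g xs y} →
           f [ xs ]↓ y → precᴿ f g [ 0 ∷ xs ]↓ y
  prec↓s : ∀ {n} {f : Rec n} {g x xs y z} →
           precᴿ f g [ x ∷ xs ]↓ y → g [ x ∷ y ∷ xs ]↓ z →
           precᴿ f g [ suc x ∷ xs ]↓ z
  mu↓    : ∀ {n} {f : Rec (1 + n)} {xs y} →
           (∀ x → x < y → ∃[ v ] f [ x ∷ xs ]↓ suc v) →
           f [ y ∷ xs ]↓ 0 → muᴿ f [ xs ]↓ y

-- Bijective base-n numeration (digits 1, …, n, least significant
-- first); in particular ⌜_⌝ is injective.
⌜_⌝ : ∀ {n} → List (Fin n) → ℕ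
⌜_⌝ {n} = foldr (λ a w → suc (toℕ a + n * w)) 0

-- The characteristic function of R is computable.
Recursive : ∀ {n} → (ℕ → List (Fin 2) → List (Fin n) → Set) → Set
Recursive R = Σ[ f ∈ Rec 3 ] ∀ i u v →
  (  R i u v × f [ i ∷ ⌜ u ⌝ ∷ ⌜ v ⌝ ∷ [] ]↓ 1) ⊎
  (¬ R i u v × f [ i ∷ ⌜ u ⌝ ∷ ⌜ v ⌝ ∷ [] ]↓ 0)

------------------------------------------------------------------------
-- Effective analytic sets

Σ¹₁ : Class (lsuc 0ℓ)
Σ¹₁ n L = Σ[ R ∈ (ℕ → List (Fin 2) → List (Fin n) → Set) ]
  Recursive R ×
  (∀ σ → σ ∈ L ⇔ (Σ[ τ ∈ ωWord 2 ] ∀ i → ∃[ m ] R i (τ ↾ m) (σ ↾ m)))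

------------------------------------------------------------------------
-- Topology and Wadge reducibility

-- Open for the product topology: a union of cylinders.
Open : ∀ {n} → ωLang n → Set
Open L = ∀ σ → σ ∈ L → ∃[ m ] (∀ σ′ → σ′ ↾ m ≡ σ ↾ m → σ′ ∈ L)

data Borel {n} : ωLang n → Set₁ where
  open-set   : ∀ {L} → Open L → Borel L
  complement : ∀ {L} → Borel L → Borel (∁ L)
  union      : ∀ {L : ℕ → ωLang n} → (∀ i → Borel (L i)) → Borel (⋃ ℕ L)
  resp       : ∀ {L L′} → L ≐ L′ → Borel L → Borel L′

Continuous : ∀ {m n} → (ωWord m → ωWord n) → Set₁
Continuous {n = n} f = (U : ωLang n) → Open U → Open (U ∘ f)

infix 4 _≤W_ _≡W_

_≤W_ : ∀ {m n} → ωLang m → ωLang n → Set₁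
L ≤W L′ = ∃[ f ] Continuous f × L ≐ (L′ ∘ f)

_≡W_ : ∀ {m n} → ωLang m → ωLang n → Set₁
L ≡W L′ = L ≤W L′ × L′ ≤W L

BorelDegreesOccurIn : Class c → Class d → Set (lsuc 0ℓ ⊔ˡ c ⊔ˡ d)
BorelDegreesOccurIn C D = ∀ {n} (L : ωLang n) → Borel L → C n L →
  ∃[ m ] Σ[ L′ ∈ ωLang m ] D m L′ × L ≡W L′

EqualWadgeHierarchies : Class c → Class d → Set (lsuc 0ℓ ⊔ˡ c ⊔ˡ d)
EqualWadgeHierarchies C D = BorelDegreesOccurIn C D × BorelDegreesOccurIn D C

{-# OPTIONS --safe #-}

-- Every ω-language of a net is effective analytic, because the transitions of a
-- run can be guessed as τ and checked recursively. Conversely let L be Σ¹₁.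
-- Call the number of times that membership in L can be announced and revoked,
-- against an adversary choosing the moments, the rank of L. If it is finite, L
-- is Wadge equivalent to a language of a finite automaton counting changes of a
-- verdict. Otherwise L is Wadge equivalent to L′ = h(L) ∪ V, for any continuous
-- coding h with closed range and any open V disjoint from that range: reducing
-- L′ to L, one decodes as long as the word is a prefix of a code and the rank is
-- infinite, and from then on only finitely many changes of mind are needed,
-- which a position of infinite rank leaves room for.
--
-- For a suitable h such an L′ is the language of a real-time net. L is accepted
-- by a counter program with zero tests, fed with the digits of the input. In h(σ)
-- the letters of σ are separated by unary passes of lengths 1, B, B², …, against
-- which a net can test counters for zero if it keeps complementary counters:
-- it cannot read a pass that is too long, and V consists of the words in which a
-- pass that is too short has been noticed.

module Submission where

open import Defs
open import Axiom.ExcludedMiddle using (ExcludedMiddle)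
open import Data.Bool.Base using (Bool; true; false; not; T; if_then_else_; _∧_)
import Data.Bool.Properties as Bool
open import Data.Empty using (⊥; ⊥-elim)
open import Data.Fin.Base using (Fin; zero; suc; toℕ; fromℕ<)
import Data.Fin.Base as Fin
open import Data.Fin.Patterns using (0F; 1F)
import Data.Fin.Properties as Fin
open import Data.Fin.Subset using () renaming (_∈_ to _∈ₛ_)
open import Data.Integer.Base as ℤ using () renaming (+_ to int)
import Data.Integer.Properties as ℤ
open import Data.List.Base using (List; []; _∷_; length; _++_; _∷ʳ_)
import Data.List.Base as List
open import Data.List.Membership.Propositional using (_∈_; find; lose)
import Data.List.Membership.Propositional.Properties as Mem
open import Data.List.Properties using (++-assoc; ++-identityʳ; catMaybes-++; length-++; ∷ʳ-injectiveʳ; length-applyUpTo; ∷-injectiveˡ; ∷-injectiveʳ; applyUpTo-∷ʳ)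
open import Data.List.Relation.Unary.Any as Any using (Any; here; there)
open import Data.List.Relation.Unary.Any.Properties using (lookup-index)
open import Data.Maybe.Base using (Maybe; just; nothing)
open import Data.Nat.Base using (ℕ; zero; suc; pred; _+_; _*_; _∸_; _^_; _≤_; _<_; z≤n; s≤s; _⊔_; _⊓_; >-nonZero)
open import Data.Nat.Divisibility using (divides)
open import Data.Nat.DivMod using (_/_; _%_; [m+kn]%n≡m%n; m<n⇒m%n≡m; m<n⇒m/n≡0; m*n/n≡m; +-distrib-/-∣ʳ)
import Data.Nat.Properties as ℕ
open import Data.Nat.Tactic.RingSolver using (solve-∀)
open import Data.Product.Base using (Σ; Σ-syntax; ∃; ∃-syntax; _×_; _,_; proj₁; proj₂)
open import Data.Sum.Base using (_⊎_; inj₁; inj₂)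
import Data.Sum.Base as Sum
open import Data.Unit.Base using (⊤; tt)
open import Data.Vec.Base as Vec using (Vec; []; _∷_; lookup; tabulate; replicate; _[_]≔_)
import Data.Vec.Properties as Vec
open import Function.Base using (_∘_; id; case_of_)
open import Function.Bundles using (_⇔_; mk⇔; Equivalence)
open import Level using (0ℓ)
open import Relation.Binary.Definitions using (DecidableEquality; tri<; tri≈; tri>)
open import Relation.Binary.PropositionalEquality
open import Relation.Nullary
open import Relation.Nullary.Decidable using (⌊_⌋; toWitness; fromWitness; _×-dec_; _→-dec_; ¬?; dec-true; dec-false)
open import Relation.Unary using (_≐_)

-- Prefixes, continuity and Wadge reductions

-- The ranks are Hausdorff's residues: finite rank means a finite Boolean combination of open sets.
-- Such degrees leave no room for `V`, which is why they get a construction of their own. `V` is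
-- forced by the weakness of nets. At the end of a short pass a net cannot require its counter to be
-- empty; it can only exploit that the counter is not, and all that a nondeterministic machine gains
-- from such evidence is acceptance. A word outside the range of `h` is still rejected if every run
-- is blocked before finding evidence. So leaving the range costs up to two further changes of
-- verdict: to rejection, then to acceptance once `V` has caught the word. The passes grow
-- geometrically because the bound to which counters are complemented must stay ahead of the
-- program, and because adding a digit times `B ^ t` to a buffer at stage `t` appends that digit to
-- a numeral in base `B`. The program thus finds the prefix of the input, paired with the guessed
-- bits, as a single number.

↾-cong : ∀ {A : Set} {x y : ℕ → A} m → (∀ s → s < m → x s ≡ y s) → x ↾ m ≡ y ↾ m
↾-cong zero    p = refl
↾-cong (suc m) p = cong₂ _∷_ (p 0 (s≤s z≤n)) (↾-cong m (λ s s<m → p (suc s) (s≤s s<m)))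

↾-at : ∀ {A : Set} (x y : ℕ → A) m → x ↾ m ≡ y ↾ m → ∀ {s} → s < m → x s ≡ y s
↾-at x y (suc m) p {zero}  _         = ∷-injectiveˡ p
↾-at x y (suc m) p {suc s} (s≤s s<m) = ↾-at (x ∘ suc) (y ∘ suc) m (∷-injectiveʳ p) s<m

↾-≤ : ∀ {A : Set} (x y : ℕ → A) {m m′} → m ≤ m′ → x ↾ m′ ≡ y ↾ m′ → x ↾ m ≡ y ↾ m
↾-≤ x y {m} {m′} m≤m′ p = ↾-cong m (λ s s<m → ↾-at x y m′ p (ℕ.≤-trans s<m m≤m′))

↾-suc : ∀ {A : Set} (x y : ℕ → A) m → x ↾ m ≡ y ↾ m → x m ≡ y m → x ↾ suc m ≡ y ↾ suc m
↾-suc x y m p q = ↾-cong (suc m) go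
  where
  go : ∀ s → s < suc m → x s ≡ y s
  go s s<1+m with ℕ.m<1+n⇒m<n∨m≡n s<1+m
  ... | inj₁ s<m  = ↾-at x y m p s<m
  ... | inj₂ refl = q

length-↾ : ∀ {A : Set} (x : ℕ → A) m → length (x ↾ m) ≡ m
length-↾ = length-applyUpTo

LocallyDetermined : ∀ {m n} → (ωWord m → ωWord n) → Set
LocallyDetermined f = ∀ x s → ∃[ k ] (∀ x′ → x′ ↾ k ≡ x ↾ k → f x′ s ≡ f x s)

locallyDetermined⇒continuous : ∀ {m n} {f : ωWord m → ωWord n} →
                               LocallyDetermined f → Continuous f
locallyDetermined⇒continuous {f = f} loc U U-open x fx∈U =
  let k , k-ok = U-open (f x) fx∈U
      l , l-ok = bound k
  in  l , λ x′ eq → k-ok (f x′) (↾-cong k (λ s s<k → l-ok x′ eq s s<k))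
  where
  bound : ∀ k → ∃[ l ] (∀ x′ → x′ ↾ l ≡ x ↾ l → ∀ s → s < k → f x′ s ≡ f x s)
  bound zero    = 0 , λ _ _ _ ()
  bound (suc k) with bound k | loc x k
  ... | l , l-ok | l′ , l′-ok = l ⊔ l′ , go
    where
    go : ∀ x′ → x′ ↾ (l ⊔ l′) ≡ x ↾ (l ⊔ l′) → ∀ s → s < suc k → f x′ s ≡ f x s
    go x′ eq s s<1+k with ℕ.m<1+n⇒m<n∨m≡n s<1+k
    ... | inj₁ s<k  = l-ok x′ (↾-≤ x′ x (ℕ.m≤m⊔n l l′) eq) s s<k
    ... | inj₂ refl = l′-ok x′ (↾-≤ x′ x (ℕ.m≤n⊔m l l′) eq)

≤W-refl : ∀ {n} {L : ωLang n} → L ≤W L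
≤W-refl = id , (λ U U-open → U-open) , id , id

≡W-refl : ∀ {n} {L : ωLang n} → L ≡W L
≡W-refl = ≤W-refl , ≤W-refl

-- Words are functions, and equality of functions is not extensional here; the words constructed
-- below agree with the intended ones only pointwise.
Extensional : ∀ {n} → ωLang n → Set
Extensional L = ∀ {x y} → (∀ s → x s ≡ y s) → L x → L y

-- Alternation ranks

module Alternation {n} (L : ωLang n) where

  Has : Bool → ωWord n → Set
  Has true  z = L z
  Has false z = ¬ L z

  -- Alternates r g u: starting from the prefix u one can announce membership
  -- (g = true) or non-membership (g = false) and afterwards revise the
  -- announcement up to r ∸ 1 times, at moments chosen by an adversary.
  Alternates : ℕ → Bool → List (Fin n) → Set
  Alternates zero    g u = ⊤
  Alternates (suc r) g u = Σ[ z ∈ ωWord n ]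
    z ↾ length u ≡ u × Has g z × (∀ m → Alternates r (not g) (z ↾ m))

  alternates-prefix : ∀ r g {x : ωWord n} {m m′} → m ≤ m′ →
                      Alternates r g (x ↾ m′) → Alternates r g (x ↾ m)
  alternates-prefix zero    g         m≤m′ _ = tt
  alternates-prefix (suc r) g {x} {m} {m′} m≤m′ (z , eq , has , next) =
    z , trans (cong (z ↾_) (length-↾ x m)) (↾-≤ z x m≤m′ eq′) , has , next
    where
    eq′ : z ↾ m′ ≡ x ↾ m′
    eq′ = subst (λ k → z ↾ k ≡ x ↾ m′) (length-↾ x m′) eq

  alternates-pred : ∀ r g {u} → Alternates (suc r) g u → Alternates r g u
  alternates-pred zero    g _ = tt
  alternates-pred (suc r) g (z , eq , has , next) =
    z , eq , has , λ m → alternates-pred r (not g) (next m)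

  alternates-≤ : ∀ {r r′} g {u} → r ≤ r′ → Alternates r′ g u → Alternates r g u
  alternates-≤ {r} {r′} g r≤r′ a with ℕ.m≤n⇒m<n∨m≡n r≤r′
  ... | inj₂ refl = a
  alternates-≤ {r} {suc r′} g _ a | inj₁ (s≤s r≤r′) =
    alternates-≤ g r≤r′ (alternates-pred r′ g a)

  -- The adversary may strike at once: at `m = length u` the prefix of `z` is `u` itself.
  alternates-not : ∀ r g {u} → Alternates (suc r) g u → Alternates r (not g) u
  alternates-not r g {u} (z , eq , has , next) =
    subst (Alternates r (not g)) eq (next (length u))

  has-ext : Extensional L → ∀ g {x y} → (∀ s → x s ≡ y s) → Has g x → Has g y
  has-ext ext true  p has = ext p has
  has-ext ext false p has = has ∘ ext (sym ∘ p)

  has-unique : ∀ {g x} → Has g x → (L x → g ≡ true) × (g ≡ true → L x)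
  has-unique {true}  has = (λ _ → refl) , (λ _ → has)
  has-unique {false} has = (λ l → ⊥-elim (has l)) , λ ()

-- Following a guessed verdict: the player outputs a word, first copying and
-- then heading for words inside or outside L according to the current guess.

data Observation (n : ℕ) : Set where
  copy  : Fin n → Observation n
  guess : Bool → ℕ → Observation n

module Follow (em : ExcludedMiddle 0ℓ) {n} (L : ωLang n) (default : ωWord n) where
  open Alternation L

  pick : List (Fin n) → Bool → ℕ → ωWord n
  pick u g r with em {Alternates (suc r) g u}
  ... | yes (z , _) = z
  ... | no _        = default

  pick-spec : ∀ u g r → Alternates (suc r) g u →
    pick u g r ↾ length u ≡ u × Has g (pick u g r) ×
    (∀ m → Alternates r (not g) (pick u g r ↾ m))
  pick-spec u g r a with em {Alternates (suc r) g u}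
  ... | yes (z , spec) = spec
  ... | no ¬a          = contradiction a ¬a

  -- The followed word is stored instead of being picked anew at every time: a limit of words with a
  -- given verdict need not have that verdict, so the output must coincide with one fixed word in
  -- the end.
  data State : Set where
    copying   : List (Fin n) → State
    following : ωWord n → Bool → State

  next : ℕ → State → Observation n → State
  next s (copying u)     (copy a)     = copying (u ∷ʳ a)
  next s (copying u)     (guess g r)  = following (pick u g r) g
  next s (following z g) (copy a)     = following z g
  next s (following z g) (guess g′ r) with g Bool.≟ g′
  ... | yes _ = following z g
  ... | no  _ = following (pick (z ↾ s) g′ r) g′

  emit : ℕ → State → Observation n → Fin n
  emit s (following z g) _           = z s
  emit s (copying u)     (copy a)    = a
  -- A filler: `play` consults the state reached after the observation, and after a guess that state
  -- is never `copying`.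
  emit s (copying u)     (guess _ _) = default s

  states : (ℕ → Observation n) → ℕ → State
  states o zero    = copying []
  states o (suc s) = next s (states o s) (o s)

  play : (ℕ → Observation n) → ωWord n
  play o s = emit s (states o (suc s)) (o s)

  states-cong : ∀ {o o′} s → (∀ t → t < s → o t ≡ o′ t) → states o s ≡ states o′ s
  states-cong zero    p = refl
  states-cong (suc s) p = cong₂ (next s)
    (states-cong s (λ t t<s → p t (ℕ.m≤n⇒m≤1+n t<s))) (p s ℕ.≤-refl)

  play-cong : ∀ {o o′} s → (∀ t → t ≤ s → o t ≡ o′ t) → play o s ≡ play o′ s
  play-cong s p = cong₂ (emit s) (states-cong (suc s) (λ { t (s≤s t≤s) → p t t≤s })) (p s ℕ.≤-refl)

  states-copying : ∀ {o} x s → (∀ t → t < s → o t ≡ copy (x t)) → states o s ≡ copying (x ↾ s)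
  states-copying x zero    p = refl
  states-copying {o} x (suc s) p
    rewrite states-copying {o} x s (λ t t<s → p t (ℕ.m≤n⇒m≤1+n t<s)) | p s ℕ.≤-refl
    = cong copying (applyUpTo-∷ʳ x s)

  play-copying : ∀ {o} x s → (∀ t → t ≤ s → o t ≡ copy (x t)) → play o s ≡ x s
  play-copying {o} x s p
    rewrite states-copying {o} x s (λ t t<s → p t (ℕ.<⇒≤ t<s)) | p s ℕ.≤-refl = refl

  module _ (ext : Extensional L) (o : ℕ → Observation n) (x : ωWord n) (s₀ : ℕ)
           (copies : ∀ t → t < s₀ → o t ≡ copy (x t))
           (g : ℕ → Bool) (r : ℕ → ℕ)
           (guesses : ∀ s → s₀ ≤ s → o s ≡ guess (g s) (r s))
           (r-mono : ∀ s → s₀ ≤ s → r (suc s) ≤ r s)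
           (r-drop : ∀ s → s₀ ≤ s → g s ≢ g (suc s) → r (suc s) < r s)
           (start : Alternates (suc (r s₀)) (g s₀) (x ↾ s₀)) where

    private
      -- From each of its prefixes, the word being followed still allows `r s` announcements
      -- beginning with the opposite verdict. A change of verdict spends one of them, and `r-drop`
      -- guarantees that the budget shrinks along with it.
      Invariant : ℕ → Set
      Invariant s = Σ[ z ∈ ωWord n ] states o (suc s) ≡ following z (g s) × Has (g s) z ×
        (∀ m → Alternates (r s) (not (g s)) (z ↾ m)) × play o ↾ suc s ≡ z ↾ suc s

      emits : ∀ s {z g} → states o (suc s) ≡ following z g → play o s ≡ z s
      emits s eq = cong (λ st → emit s st (o s)) eq

      invariant₀ : Invariant s₀
      invariant₀ = z , st-eq , proj₁ (proj₂ spec) , proj₂ (proj₂ spec) ,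
                   ↾-suc (play o) z s₀ (trans (↾-cong s₀ (λ s s<s₀ → play-copying x s
                       (λ t t≤s → copies t (ℕ.≤-<-trans t≤s s<s₀))))
                     (sym (subst (λ k → z ↾ k ≡ x ↾ s₀) (length-↾ x s₀) (proj₁ spec))))
                     (emits s₀ st-eq)
        where
        z = pick (x ↾ s₀) (g s₀) (r s₀)
        spec = pick-spec (x ↾ s₀) (g s₀) (r s₀) start
        st-eq : states o (suc s₀) ≡ following z (g s₀)
        st-eq rewrite states-copying {o} x s₀ copies | guesses s₀ ℕ.≤-refl = refl

      next-same : ∀ s z {g₁ g₂} r → g₁ ≡ g₂ → next s (following z g₁) (guess g₂ r) ≡ following z g₂
      next-same s z {g₁} {g₂} r refl with g₁ Bool.≟ g₁
      ... | yes _ = refl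
      ... | no ¬p = contradiction refl ¬p

      next-new : ∀ s z {g₁ g₂} r → g₁ ≢ g₂ →
                 next s (following z g₁) (guess g₂ r) ≡ following (pick (z ↾ s) g₂ r) g₂
      next-new s z {g₁} {g₂} r ne with g₁ Bool.≟ g₂
      ... | yes p = contradiction p ne
      ... | no _  = refl

      step-eq : ∀ s → s₀ ≤ s → ∀ {z} → states o (suc s) ≡ following z (g s) →
                states o (suc (suc s)) ≡ next (suc s) (following z (g s)) (guess (g (suc s)) (r (suc s)))
      step-eq s s₀≤s eq = cong₂ (next (suc s)) eq (guesses (suc s) (ℕ.m≤n⇒m≤1+n s₀≤s))

      invariant-step : ∀ s → s₀ ≤ s → Invariant s → Invariant (suc s)
      invariant-step s s₀≤s (z , eq , has , alt , pre) with g s Bool.≟ g (suc s)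
      ... | yes same = z , eq′ , subst (λ b → Has b z) same has ,
              (λ m → alternates-≤ (not (g (suc s))) (r-mono s s₀≤s)
                       (subst (λ b → Alternates (r s) (not b) (z ↾ m)) same (alt m))) ,
              ↾-suc (play o) z (suc s) pre (emits (suc s) eq′)
        where
        eq′ = trans (step-eq s s₀≤s eq) (next-same (suc s) z (r (suc s)) same)
      ... | no new = z′ , eq′ , proj₁ (proj₂ spec) , proj₂ (proj₂ spec) ,
              ↾-suc (play o) z′ (suc s) (trans pre (sym (subst (λ k → z′ ↾ k ≡ z ↾ suc s) (length-↾ z (suc s)) (proj₁ spec))))
                (emits (suc s) eq′)
        where
        z′ = pick (z ↾ suc s) (g (suc s)) (r (suc s))
        eq′ = trans (step-eq s s₀≤s eq) (next-new (suc s) z (r (suc s)) new)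
        spec = pick-spec (z ↾ suc s) (g (suc s)) (r (suc s))
          (subst (λ b → Alternates (suc (r (suc s))) b (z ↾ suc s)) (sym (Bool.¬-not (≢-sym new)))
            (alternates-≤ (not (g s)) (r-drop s s₀≤s new) (alt (suc s))))

      invariant : ∀ k → Invariant (k + s₀)
      invariant zero    = invariant₀
      invariant (suc k) = invariant-step (k + s₀) (ℕ.m≤n+m s₀ k) (invariant k)

    -- After `s₁` no new word is picked, so the output is the word followed at `s₁`; the part
    -- emitted earlier is a prefix of it by the invariant.
    play-follows : ∀ {g*} s₁ → s₀ ≤ s₁ → (∀ s → s₁ ≤ s → g s ≡ g*) → Has g* (play o)
    play-follows {g*} s₁ s₀≤s₁ const = has-ext ext g* (sym ∘ same) (subst (λ b → Has b z) (const s₁ ℕ.≤-refl) has)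
      where
      at-s₁ : Invariant s₁
      at-s₁ = subst Invariant (ℕ.m∸n+n≡m s₀≤s₁) (invariant (s₁ ∸ s₀))
      z   = proj₁ at-s₁
      has = proj₁ (proj₂ (proj₂ at-s₁))
      stays : ∀ k → states o (suc (k + s₁)) ≡ following z (g (k + s₁))
      stays zero    = proj₁ (proj₂ at-s₁)
      stays (suc k) = trans (step-eq (k + s₁) (ℕ.≤-trans s₀≤s₁ (ℕ.m≤n+m s₁ k)) (stays k))
        (next-same _ z _ (trans (const _ (ℕ.m≤n+m s₁ k)) (sym (const _ (ℕ.m≤n+m s₁ (suc k))))))
      same : ∀ s → play o s ≡ z s
      same s with ℕ.≤-total s₁ s
      ... | inj₁ s₁≤s = emits s (subst (λ t → states o (suc t) ≡ following z (g t)) (ℕ.m∸n+n≡m s₁≤s) (stays (s ∸ s₁)))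
      ... | inj₂ s≤s₁ = ↾-at (play o) z (suc s₁) (proj₂ (proj₂ (proj₂ (proj₂ at-s₁)))) (s≤s s≤s₁)

-- Least witnesses and ranks of prefixes

module Classical (em : ExcludedMiddle 0ℓ) where

  Least : (ℕ → Set) → ℕ → Set
  Least P m = P m × (∀ k → k < m → ¬ P k)

  least : (P : ℕ → Set) → ∃ P → ∃ (Least P)
  least P (m , p) = search 0 m (λ _ ()) (ℕ.≤-reflexive refl) p
    where
    search : ∀ k d → (∀ j → j < k → ¬ P j) → ∀ {m} → m ≤ k + d → P m → ∃ (Least P)
    search k zero none {m} m≤ p = m , p , λ j j<m →
      none j (ℕ.<-≤-trans j<m (subst (m ≤_) (ℕ.+-identityʳ k) m≤))
    search k (suc d) none {m} m≤ p with em {P k}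
    ... | yes pk = k , pk , none
    ... | no ¬pk = search (suc k) d none′ (subst (m ≤_) (ℕ.+-suc k d) m≤) p
      where
      none′ : ∀ j → j < suc k → ¬ P j
      none′ j j<1+k with ℕ.m<1+n⇒m<n∨m≡n j<1+k
      ... | inj₁ j<k  = none j j<k
      ... | inj₂ refl = ¬pk

  least-unique : ∀ {P m m′} → Least P m → Least P m′ → m ≡ m′
  least-unique {m = m} {m′} (p , none) (p′ , none′) with ℕ.<-cmp m m′
  ... | tri< m<m′ _ _ = contradiction p (none′ m m<m′)
  ... | tri≈ _ eq _   = eq
  ... | tri> _ _ m′<m = contradiction p′ (none m′ m′<m)

  stabilizes : (f : ℕ → ℕ) (m₀ : ℕ) → (∀ m m′ → m₀ ≤ m → m ≤ m′ → f m′ ≤ f m) →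
               ∃[ m₁ ] m₀ ≤ m₁ × (∀ m → m₁ ≤ m → f m ≡ f m₁)
  stabilizes f m₀ mono = go (f m₀) m₀ ℕ.≤-refl ℕ.≤-refl
    where
    go : ∀ b m → m₀ ≤ m → f m ≤ b → ∃[ m₁ ] m₀ ≤ m₁ × (∀ m → m₁ ≤ m → f m ≡ f m₁)
    go b m m₀≤m fm≤b with em {∃[ k ] m ≤ k × f k < f m}
    ... | no none = m , m₀≤m , λ k m≤k → ℕ.≤-antisym (mono m k m₀≤m m≤k)
                      (ℕ.≮⇒≥ λ lt → none (k , m≤k , lt))
    go zero    m m₀≤m fm≤b | yes (k , m≤k , lt) = contradiction (ℕ.<-≤-trans lt fm≤b) λ ()
    go (suc b) m m₀≤m fm≤b | yes (k , m≤k , lt) =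
      go b k (ℕ.≤-trans m₀≤m m≤k) (ℕ.≤-pred (ℕ.<-≤-trans lt fm≤b))

  module Ranks {n} (L : ωLang n) where
    open Alternation L

    -- Finiteness is asked of one side only, since by `alternates-not` the ranks of the two sides
    -- differ by at most one.
    Ranked : List (Fin n) → Set
    Ranked u = ∃[ N ] ¬ Alternates N true u

    rank : Bool → List (Fin n) → ℕ
    rank g u with em {∃[ r ] Alternates r g u × ¬ Alternates (suc r) g u}
    ... | yes (r , _) = r
    ... | no _        = 0

    ranked-both : ∀ {u} → Ranked u → ∀ g → ∃[ N ] ¬ Alternates N g u
    ranked-both (N , ¬a) true  = N , ¬a
    ranked-both (N , ¬a) false = suc N , ¬a ∘ alternates-not N false

    rank-spec : ∀ {u} → Ranked u → ∀ g →
                Alternates (rank g u) g u × ¬ Alternates (suc (rank g u)) g u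
    rank-spec {u} ranked g with em {∃[ r ] Alternates r g u × ¬ Alternates (suc r) g u}
    ... | yes (r , spec) = spec
    ... | no none        = ⊥-elim (proj₂ (ranked-both ranked g) (all (proj₁ (ranked-both ranked g))))
      where
      all : ∀ r → Alternates r g u
      all zero    = tt
      all (suc r) with em {Alternates (suc r) g u}
      ... | yes a = a
      ... | no ¬a = ⊥-elim (none (r , all r , ¬a))

    rank-max : ∀ {u} → Ranked u → ∀ g {r} → Alternates r g u → r ≤ rank g u
    rank-max {u} ranked g {r} a = ℕ.≮⇒≥ λ lt →
      proj₂ (rank-spec ranked g) (alternates-≤ g lt a)

    ranked-≤ : ∀ x {m m′} → m ≤ m′ → Ranked (x ↾ m) → Ranked (x ↾ m′)
    ranked-≤ x m≤m′ (N , ¬a) = N , ¬a ∘ alternates-prefix N true m≤m′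

    rank-≤ : ∀ x {m m′} → m ≤ m′ → Ranked (x ↾ m) → ∀ g → rank g (x ↾ m′) ≤ rank g (x ↾ m)
    rank-≤ x {m} {m′} m≤m′ ranked g = rank-max ranked g
      (alternates-prefix _ g m≤m′ (proj₁ (rank-spec (ranked-≤ x m≤m′ ranked) g)))

    -- The rank of the opposite verdict decreases along `x` to a final value `k`. From then on `x`
    -- itself can be announced with verdict `g`, and at every prefix `k` announcements starting with
    -- the opposite are left; so `g` has rank at least `k + 1`. Comparing the two ranks therefore
    -- finds the verdict in the limit.
    rank-limit : ∀ x {m₀} g → Ranked (x ↾ m₀) → Has g x →
      ∃[ m₁ ] m₀ ≤ m₁ × (∀ m → m₁ ≤ m → rank (not g) (x ↾ m) < rank g (x ↾ m))
    rank-limit x {m₀} g ranked has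
      with stabilizes (λ m → rank (not g) (x ↾ m)) m₀
             (λ m m′ m₀≤m m≤m′ → rank-≤ x m≤m′ (ranked-≤ x m₀≤m ranked) (not g))
    ... | m₁ , m₀≤m₁ , const = m₁ , m₀≤m₁ , λ m m₁≤m →
      subst (_< rank g (x ↾ m)) (sym (const m m₁≤m))
        (rank-max (ranked-≤ x (ℕ.≤-trans m₀≤m₁ m₁≤m) ranked) g
          (x , cong (x ↾_) (length-↾ x m) , has , alternates))
      where
      at-later : ∀ m → m₁ ≤ m → Alternates (rank (not g) (x ↾ m₁)) (not g) (x ↾ m)
      at-later m m₁≤m = subst (λ r → Alternates r (not g) (x ↾ m)) (const m m₁≤m)
        (proj₁ (rank-spec (ranked-≤ x (ℕ.≤-trans m₀≤m₁ m₁≤m) ranked) (not g)))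
      alternates : ∀ m → Alternates (rank (not g) (x ↾ m₁)) (not g) (x ↾ m)
      alternates m with ℕ.≤-total m₁ m
      ... | inj₁ m₁≤m = at-later m m₁≤m
      ... | inj₂ m≤m₁ = alternates-prefix _ (not g) m≤m₁ (at-later m₁ ℕ.≤-refl)

  -- Infinite rank: adding an open set outside the range of a coding

  module Saturation {n γ} (L : ωLang n) (ext : Extensional L) (L′ : ωLang γ)
    (pos : ℕ → ℕ) (decode : Fin γ → Fin n) (ok : ℕ → Fin γ → Bool)
    (h : ωWord n → ωWord γ) (h-local : LocallyDetermined h)
    (h-ok : ∀ x s → T (ok s (h x s)))
    (decode-h : ∀ x t → decode (h x (pos t)) ≡ x t)
    (inside : ∀ y → (∀ s → T (ok s (y s))) → L′ y ⇔ L (decode ∘ y ∘ pos))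
    (outside : ∀ y s → ¬ T (ok s (y s)) → L′ y → ∃[ m ] (∀ y′ → y′ ↾ m ≡ y ↾ m → L′ y′))
    (unranked : ∀ r → Alternation.Alternates L r true [])
    where
    open Alternation L
    open Ranks L

    D : ωWord γ → ωWord n
    D y = decode ∘ y ∘ pos

    D-local : ∀ y s → ∃[ k ] (∀ y′ → y′ ↾ k ≡ y ↾ k → D y′ ↾ s ≡ D y ↾ s)
    D-local y zero    = 0 , λ _ _ → refl
    D-local y (suc s) with D-local y s
    ... | k , k-ok = k ⊔ suc (pos s) , λ y′ eq →
      ↾-suc (D y′) (D y) s (k-ok y′ (↾-≤ y′ y (ℕ.m≤m⊔n k _) eq))
        (cong decode (↾-at y′ y _ eq (ℕ.m≤n⊔m k (suc (pos s)))))

    -- Both are properties of a finite prefix, phrased through all its extensions. For `Ok` any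
    -- single extension gives the same answer (`ok-intro`, `ok-elim`); for `Forced` the quantifier
    -- is the point, as it says that the cylinder lies in `L′`.
    Forced Ok : List (Fin γ) → Set
    Forced v = ∀ y → y ↾ length v ≡ v → L′ y
    Ok v     = ∀ y → y ↾ length v ≡ v → ∀ t → t < length v → T (ok t (y t))

    -- The number bounds the changes of verdict still to come: none in a cylinder contained in `L′`,
    -- one after a misfit, and before that the sum of the ranks with a reserve of two for a later
    -- misfit and a later forcing.
    verdict : List (Fin γ) → List (Fin n) → Bool × ℕ
    verdict v u with em {Forced v}
    ... | yes _ = true , 0
    ... | no  _ with em {Ok v}
    ... | no  _ = false , 1
    ... | yes _ = does (rank false u ℕ.<? rank true u) , 2 + (rank true u + rank false u)

    observe : List (Fin γ) → List (Fin n) → Fin n → Observation n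
    observe v u a with em {Ok v × ¬ Ranked u}
    ... | yes _ = copy a
    ... | no  _ = guess (proj₁ (verdict v u)) (proj₂ (verdict v u))

    -- The decoded prefix looks ahead of the letters tested for fitting. This is harmless: `decode`
    -- is total, and when copying ends all that matters is that the letters copied so far form a
    -- prefix of infinite rank, whether or not they come from a code.
    observation : ωWord γ → ℕ → Observation n
    observation y s = observe (y ↾ suc s) (D y ↾ suc s) (D y s)

    observation-local : ∀ y s → ∃[ k ] (∀ y′ → y′ ↾ k ≡ y ↾ k → ∀ t → t ≤ s → observation y′ t ≡ observation y t)
    observation-local y s with D-local y (suc s)
    ... | k , k-ok = k ⊔ suc s , λ y′ eq t t≤s →
      let D-eq = k-ok y′ (↾-≤ y′ y (ℕ.m≤m⊔n k (suc s)) eq)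
          y-eq = ↾-≤ y′ y (ℕ.m≤n⊔m k (suc s)) eq
      in  trans (cong₂ (λ v u → observe v u (D y′ t)) (↾-≤ y′ y (s≤s t≤s) y-eq) (↾-≤ (D y′) (D y) (s≤s t≤s) D-eq))
            (cong (observe (y ↾ suc t) (D y ↾ suc t)) (↾-at (D y′) (D y) (suc s) D-eq (s≤s t≤s)))

    -- The branches of `verdict` as a family, so that two successive times can be compared by
    -- matching.
    data Phase (y : ωWord γ) (s : ℕ) : Bool → ℕ → Set where
      forced : Forced (y ↾ s) → Phase y s true 0
      broken : ¬ Forced (y ↾ s) → ¬ Ok (y ↾ s) → Phase y s false 1
      ranked : ¬ Forced (y ↾ s) → Ok (y ↾ s) →
        Phase y s (does (rank false (D y ↾ s) ℕ.<? rank true (D y ↾ s))) (2 + (rank true (D y ↾ s) + rank false (D y ↾ s)))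

    phase : ∀ y s → Phase y s (proj₁ (verdict (y ↾ s) (D y ↾ s))) (proj₂ (verdict (y ↾ s) (D y ↾ s)))
    phase y s with em {Forced (y ↾ s)}
    ... | yes f = forced f
    ... | no ¬f with em {Ok (y ↾ s)}
    ... | no ¬o = broken ¬f ¬o
    ... | yes o = ranked ¬f o

    restrict : ∀ {y : ωWord γ} {y′ m m′} → m ≤ m′ → y′ ↾ length (y ↾ m′) ≡ y ↾ m′ → y′ ↾ length (y ↾ m) ≡ y ↾ m
    restrict {y} {y′} {m} {m′} m≤m′ eq = trans (cong (y′ ↾_) (length-↾ y m))
      (↾-≤ y′ y m≤m′ (trans (cong (y′ ↾_) (sym (length-↾ y m′))) eq))

    forced-≤ : ∀ {y s s′} → s ≤ s′ → Forced (y ↾ s) → Forced (y ↾ s′)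
    forced-≤ {y} s≤s′ f y′ eq = f y′ (restrict {y} {y′} s≤s′ eq)

    forced-self : ∀ {y s} → Forced (y ↾ s) → L′ y
    forced-self {y} {s} f = f y (cong (y ↾_) (length-↾ y s))

    ok-intro : ∀ y s → (∀ t → t < s → T (ok t (y t))) → Ok (y ↾ s)
    ok-intro y s p y′ eq t t<len = subst (T ∘ ok t) (sym (↾-at y′ y s eq′ t<s)) (p t t<s)
      where
      t<s = subst (t <_) (length-↾ y s) t<len
      eq′ = trans (cong (y′ ↾_) (sym (length-↾ y s))) eq

    ok-elim : ∀ y s → Ok (y ↾ s) → ∀ t → t < s → T (ok t (y t))
    ok-elim y s o t t<s = o y (cong (y ↾_) (length-↾ y s)) t (subst (t <_) (sym (length-↾ y s)) t<s)

    ok-≤ : ∀ {y s s′} → s ≤ s′ → Ok (y ↾ s′) → Ok (y ↾ s)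
    ok-≤ {y} {s} {s′} s≤s′ o = ok-intro y s (λ t t<s → ok-elim y s′ o t (ℕ.<-≤-trans t<s s≤s′))

    unranked-all : ∀ {u} → (∀ r → Alternates r true u) → ∀ r g → Alternates r g u
    unranked-all all r true  = all r
    unranked-all all r false = alternates-not r true (all (suc r))

    module _ (y : ωWord γ) where
      g : ℕ → Bool
      g s = proj₁ (verdict (y ↾ suc s) (D y ↾ suc s))
      r : ℕ → ℕ
      r s = proj₂ (verdict (y ↾ suc s) (D y ↾ suc s))

      Copying : ℕ → Set
      Copying s = Ok (y ↾ suc s) × ¬ Ranked (D y ↾ suc s)

      copies : ∀ {s} → Copying s → observation y s ≡ copy (D y s)
      copies {s} c with em {Copying s}
      ... | yes _ = refl
      ... | no ¬c = contradiction c ¬c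

      guesses : ∀ {s} → ¬ Copying s → observation y s ≡ guess (g s) (r s)
      guesses {s} ¬c with em {Copying s}
      ... | yes c = contradiction c ¬c
      ... | no _  = refl

      ¬copying-≤ : ∀ {s s′} → s ≤ s′ → ¬ Copying s → ¬ Copying s′
      ¬copying-≤ s≤s′ ¬c (o , ¬ranked) = ¬c (ok-≤ {y} (s≤s s≤s′) o , ¬ranked ∘ ranked-≤ (D y) (s≤s s≤s′))

      ok⇒ranked : ∀ {s} → ¬ Copying s → Ok (y ↾ suc s) → Ranked (D y ↾ suc s)
      ok⇒ranked {s} ¬c o with em {Ranked (D y ↾ suc s)}
      ... | yes rk = rk
      ... | no ¬rk = contradiction (o , ¬rk) ¬c

      -- While the word fits, the verdict depends only on two ranks that never increase, so it can
      -- change only when one of them drops. A misfit and a forcing each happen at most once and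
      -- draw on the reserve.
      step : ∀ {s g₁ r₁ g₂ r₂} → ¬ Copying s → Phase y (suc s) g₁ r₁ → Phase y (suc (suc s)) g₂ r₂ →
             r₂ ≤ r₁ × (g₁ ≢ g₂ → r₂ < r₁)
      step ¬c (forced f)    (forced f′)     = z≤n , contradiction refl
      step ¬c (forced f)    (broken ¬f _)   = contradiction (forced-≤ {y} (ℕ.n≤1+n _) f) ¬f
      step ¬c (forced f)    (ranked ¬f _)   = contradiction (forced-≤ {y} (ℕ.n≤1+n _) f) ¬f
      step ¬c (broken _ _)  (forced _)      = z≤n , λ _ → s≤s z≤n
      step ¬c (broken _ _)  (broken _ _)    = ℕ.≤-refl , contradiction refl
      step ¬c (broken _ ¬o) (ranked _ o)    = contradiction (ok-≤ {y} (ℕ.n≤1+n _) o) ¬o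
      step ¬c (ranked _ _)  (forced _)      = z≤n , λ _ → s≤s z≤n
      step ¬c (ranked _ _)  (broken _ _)    = s≤s z≤n , λ _ → s≤s (s≤s z≤n)
      step {s} ¬c (ranked _ o) (ranked _ _) = s≤s (s≤s (ℕ.+-mono-≤ (mono true) (mono false))) , strict
        where
        u  = D y ↾ suc s
        u′ = D y ↾ suc (suc s)
        mono : ∀ b → rank b u′ ≤ rank b u
        mono = rank-≤ (D y) (ℕ.n≤1+n _) (ok⇒ranked ¬c o)
        strict : does (rank false u ℕ.<? rank true u) ≢ does (rank false u′ ℕ.<? rank true u′) →
                 3 + (rank true u′ + rank false u′) ≤ 2 + (rank true u + rank false u)
        strict ne with ℕ.m≤n⇒m<n∨m≡n (mono true) | ℕ.m≤n⇒m<n∨m≡n (mono false)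
        ... | inj₁ lt | _       = s≤s (s≤s (ℕ.+-mono-<-≤ lt (mono false)))
        ... | inj₂ _  | inj₁ lt = s≤s (s≤s (ℕ.+-mono-≤-< (mono true) lt))
        ... | inj₂ p  | inj₂ q  = contradiction (cong₂ (λ a b → does (b ℕ.<? a)) (sym p) (sym q)) ne

      g-forced : ∀ {s g r} → Phase y s g r → Forced (y ↾ s) → g ≡ true
      g-forced (forced _)    _ = refl
      g-forced (broken ¬f _) f = contradiction f ¬f
      g-forced (ranked ¬f _) f = contradiction f ¬f

      g-broken : ∀ {s g r} → Phase y s g r → ¬ Forced (y ↾ s) → ¬ Ok (y ↾ s) → g ≡ false
      g-broken (forced f)   ¬f ¬o = contradiction f ¬f
      g-broken (broken _ _) ¬f ¬o = refl
      g-broken (ranked _ o) ¬f ¬o = contradiction o ¬o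

      g-ranked : ∀ {s g r} → Phase y s g r → ¬ Forced (y ↾ s) → Ok (y ↾ s) →
                 g ≡ does (rank false (D y ↾ s) ℕ.<? rank true (D y ↾ s))
      g-ranked (forced f)    ¬f o = contradiction f ¬f
      g-ranked (broken _ ¬o) ¬f o = contradiction o ¬o
      g-ranked (ranked _ _)  ¬f o = refl

    module Reduction (default : ωWord n) where
      open Follow em L default

      f : ωWord γ → ωWord n
      f y = play (observation y)

      f-local : LocallyDetermined f
      f-local y s with observation-local y s
      ... | k , k-ok = k , λ y′ eq → play-cong s (k-ok y′ eq)

      module _ (y : ωWord γ) where
        all-copied : (∀ s → Copying y s) → L′ y ⇔ L (f y)
        all-copied copied = mk⇔ (ext (sym ∘ same) ∘ Equivalence.to (inside y y-ok))
                                 (Equivalence.from (inside y y-ok) ∘ ext same)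
          where
          y-ok : ∀ s → T (ok s (y s))
          y-ok s = ok-elim y (suc s) (proj₁ (copied s)) s ℕ.≤-refl
          same : ∀ s → f y s ≡ D y s
          same s = play-copying (D y) s (λ t _ → copies y (copied t))

        module _ (s₀ : ℕ) (¬copying : ¬ Copying y s₀) (copied : ∀ s → s < s₀ → Copying y s) where
          late : ∀ {s} → s₀ ≤ s → ¬ Copying y s
          late s₀≤s = ¬copying-≤ y s₀≤s ¬copying

          -- What has been copied has infinite rank, by the last copying step or, if nothing was
          -- copied, by `unranked`. Hence any number of revisions is available, in particular the
          -- number that the first guess asks for. The equation `t ≡ s₀` lets the proof split on
          -- `s₀`.
          start : ∀ t → t ≡ s₀ → ∀ r → Alternates r true (D y ↾ t)
          start zero    _    r = unranked r
          start (suc t) refl r with em {Alternates r true (D y ↾ suc t)}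
          ... | yes a = a
          ... | no ¬a = ⊥-elim (proj₂ (copied t ℕ.≤-refl) (r , ¬a))

          follows : ∀ {g*} s₁ → s₀ ≤ s₁ → (∀ s → s₁ ≤ s → g y s ≡ g*) → Has g* (f y)
          follows = play-follows ext (observation y) (D y) s₀ (λ t t<s₀ → copies y (copied t t<s₀))
            (g y) (r y) (λ s s₀≤s → guesses y (late s₀≤s))
            (λ s s₀≤s → proj₁ (step y (late s₀≤s) (phase y _) (phase y _)))
            (λ s s₀≤s → proj₂ (step y (late s₀≤s) (phase y _) (phase y _)))
            (unranked-all (start s₀ refl) _ _)

          guessed : L′ y ⇔ L (f y)
          guessed with em {∃[ s ] Forced (y ↾ s)}
          ... | yes (s , fc) = mk⇔ (λ _ → follows {true} (s₀ ⊔ s) (ℕ.m≤m⊔n s₀ s) (λ t le →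
                    g-forced y (phase y (suc t)) (forced-≤ {y} (ℕ.m≤n⇒m≤1+n (ℕ.≤-trans (ℕ.m≤n⊔m s₀ s) le)) fc)))
                  (λ _ → forced-self {y} {s} fc)
          ... | no ¬f with em {∃[ s ] ¬ T (ok s (y s))}
          -- A misfitting member of `L′` would have a forced prefix by `outside`. There is none, so
          -- the word lies outside `L′`, in accordance with the final verdict `false`.
          ... | yes (s , ¬o) = mk⇔ (λ y∈L′ → let m , m-ok = outside y s ¬o y∈L′ in
                    ⊥-elim (¬f (m , λ y′ eq → m-ok y′ (trans (cong (y′ ↾_) (sym (length-↾ y m))) eq))))
                  (λ l → ⊥-elim (follows {false} (s₀ ⊔ s) (ℕ.m≤m⊔n s₀ s) (λ t le →
                    g-broken y (phase y (suc t)) (λ fc → ¬f (_ , fc))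
                      (λ o → ¬o (ok-elim y (suc t) o s (s≤s (ℕ.≤-trans (ℕ.m≤n⊔m s₀ s) le))))) l))
          ... | no all-ok = mk⇔ to from
            where
            y-ok : ∀ s → T (ok s (y s))
            y-ok s with ok s (y s) in eq
            ... | true  = tt
            ... | false = all-ok (s , subst T eq)
            oks : ∀ s → Ok (y ↾ s)
            oks s = ok-intro y s (λ t _ → y-ok t)
            rk : Ranked (D y ↾ suc s₀)
            rk = ok⇒ranked y ¬copying (oks _)
            decided : ∀ b → Has b (D y) → Has b (f y)
            decided b has with rank-limit (D y) b rk has
            ... | m₁ , s₀<m₁ , lim = follows m₁ (ℕ.<⇒≤ s₀<m₁) (λ s m₁≤s →
                    trans (g-ranked y (phase y (suc s)) (λ fc → ¬f (_ , fc)) (oks _))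
                          (sign b (lim (suc s) (ℕ.m≤n⇒m≤1+n m₁≤s))))
              where
              sign : ∀ b {s} → rank (not b) (D y ↾ s) < rank b (D y ↾ s) →
                     does (rank false (D y ↾ s) ℕ.<? rank true (D y ↾ s)) ≡ b
              sign true  lt = dec-true (_ ℕ.<? _) lt
              sign false lt = dec-false (_ ℕ.<? _) (ℕ.<-asym lt)
            to : L′ y → L (f y)
            to y∈L′ = decided true (Equivalence.to (inside y y-ok) y∈L′)
            from : L (f y) → L′ y
            from l with em {L (D y)}
            ... | yes d = Equivalence.from (inside y y-ok) d
            ... | no ¬d = ⊥-elim (decided false ¬d l)

        correct : L′ y ⇔ L (f y)
        correct with em {∃[ s ] ¬ Copying y s}
        ... | no none = all-copied λ s → case em {Copying y s} of λ
                { (yes c) → c ; (no ¬c) → ⊥-elim (none (s , ¬c)) }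
        ... | yes some with least (¬_ ∘ Copying y) some
        ... | s₀ , ¬c , before = guessed s₀ ¬c λ s s<s₀ → case em {Copying y s} of λ
                { (yes c) → c ; (no ¬c) → ⊥-elim (before s s<s₀ ¬c) }

      L≡WL′ : L ≡W L′
      L≡WL′ = (h , locallyDetermined⇒continuous h-local ,
                (λ {x} l → Equivalence.from (inside (h x) (h-ok x)) (ext (sym ∘ decode-h x) l)) ,
                (λ {x} l′ → ext (decode-h x) (Equivalence.to (inside (h x) (h-ok x)) l′))) ,
              (f , locallyDetermined⇒continuous f-local ,
                (λ {y} → Equivalence.to (correct y)) , (λ {y} → Equivalence.from (correct y)))

-- Degrees of finite rank

-- A word over Fin 2 is read as a sequence of verdicts. After a first verdict b,
-- only the first budget b ∸ 1 changes count; if budget b is 0, the first verdict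
-- is replaced by its opposite.

module Toggle where

  verdictOf : Fin 2 → Bool
  verdictOf zero    = false
  verdictOf (suc _) = true

  letterFor : Bool → Fin 2
  letterFor false = zero
  letterFor true  = suc zero

  verdictOf-letterFor : ∀ b → verdictOf (letterFor b) ≡ b
  verdictOf-letterFor true  = refl
  verdictOf-letterFor false = refl

  -- With ranks at the root as budgets, a zero budget means that no word at all has this verdict, so
  -- the opposite is the only possible announcement.
  first : (Bool → ℕ) → Bool → Bool × ℕ
  first budget c with budget c
  ... | suc r = c , r
  ... | zero  = not c , pred (budget (not c))

  revise : Bool × ℕ → Bool → Bool × ℕ
  revise (g , zero)  c = g , zero
  revise (g , suc r) c = if does (g Bool.≟ c) then (g , suc r) else (c , r)

  toggles : (Bool → ℕ) → ωWord 2 → ℕ → Bool × ℕ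
  toggles budget w zero    = first budget (verdictOf (w 0))
  toggles budget w (suc s) = revise (toggles budget w s) (verdictOf (w (suc s)))

  -- A Büchi condition in form; as the budget runs out the verdict settles (`toggles-settle`), and
  -- the condition says that the final verdict is `true`.
  Toggle : (Bool → ℕ) → ωLang 2
  Toggle budget w = ∀ s → ∃[ s′ ] s ≤ s′ × proj₁ (toggles budget w s′) ≡ true

  revise-≤ : ∀ st c → proj₂ (revise st c) ≤ proj₂ st
  revise-≤ (g , zero)  c = z≤n
  revise-≤ (g , suc r) c with does (g Bool.≟ c)
  ... | true  = ℕ.≤-refl
  ... | false = ℕ.n≤1+n r

  revise-< : ∀ st c → proj₁ st ≢ proj₁ (revise st c) → proj₂ (revise st c) < proj₂ st
  revise-< (g , zero)  c ne = contradiction refl ne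
  revise-< (g , suc r) c ne with does (g Bool.≟ c)
  ... | true  = contradiction refl ne
  ... | false = ℕ.≤-refl

  revise-same : ∀ g r → revise (g , r) g ≡ (g , r)
  revise-same g zero    = refl
  revise-same g (suc r) rewrite dec-true (g Bool.≟ g) refl = refl

  revise-new : ∀ g r → revise (g , suc r) (not g) ≡ (not g , r)
  revise-new true  r = refl
  revise-new false r = refl

  toggles-local : ∀ budget {w w′} s → w ↾ suc s ≡ w′ ↾ suc s → toggles budget w s ≡ toggles budget w′ s
  toggles-local budget {w} {w′} zero    eq = cong (first budget ∘ verdictOf) (↾-at w w′ 1 eq (s≤s z≤n))
  toggles-local budget {w} {w′} (suc s) eq = cong₂ revise
    (toggles-local budget {w} {w′} s (↾-≤ w w′ (ℕ.n≤1+n _) eq))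
    (cong verdictOf (↾-at w w′ _ eq ℕ.≤-refl))

  toggles-settle : ExcludedMiddle 0ℓ → ∀ budget w →
                   ∃[ s₁ ] (∀ s → s₁ ≤ s → toggles budget w s ≡ toggles budget w s₁)
  toggles-settle em budget w with Classical.stabilizes em r 0 (λ m m′ _ m≤m′ → r-mono m≤m′)
    where
    r : ℕ → ℕ
    r s = proj₂ (toggles budget w s)
    r-mono : ∀ {s s′} → s ≤ s′ → r s′ ≤ r s
    r-mono {s} {s′} s≤s′ with ℕ.m≤n⇒m<n∨m≡n s≤s′
    ... | inj₂ refl = ℕ.≤-refl
    r-mono {s} {suc s′} _ | inj₁ (s≤s s≤s′) = ℕ.≤-trans (revise-≤ (toggles budget w s′) _) (r-mono s≤s′)
  ... | s₁ , _ , const = s₁ , λ s s₁≤s → subst (λ t → st t ≡ st s₁) (ℕ.m∸n+n≡m s₁≤s) (same (s ∸ s₁))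
    where
    st : ℕ → Bool × ℕ
    st = toggles budget w
    same : ∀ k → st (k + s₁) ≡ st s₁
    same zero    = refl
    same (suc k) with proj₁ (st (k + s₁)) Bool.≟ proj₁ (st (suc k + s₁))
    ... | yes p = trans (sym (cong₂ _,_ p (trans (const _ (ℕ.m≤n+m s₁ k)) (sym (const _ (ℕ.m≤n+m s₁ (suc k))))))) (same k)
    ... | no ¬p = contradiction (revise-< (st (k + s₁)) _ ¬p)
            (ℕ.≤⇒≯ (ℕ.≤-reflexive (trans (const _ (ℕ.m≤n+m s₁ k)) (sym (const _ (ℕ.m≤n+m s₁ (suc k)))))))

module FiniteRankDegree (em : ExcludedMiddle 0ℓ) {n} (L : ωLang n) (ext : Extensional L)
  (default : ωWord n) (root : Classical.Ranks.Ranked em L []) where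
  open Classical em
  open Alternation L
  open Ranks L
  open Follow em L default
  open Toggle

  budget : Bool → ℕ
  budget g = rank g []

  ranked : ∀ x m → Ranked (x ↾ m)
  ranked x m = ranked-≤ x (z≤n {m}) root

  verdict-has : ∀ x → ∃[ g ] Has g x
  verdict-has x with em {L x}
  ... | yes l = true , l
  ... | no ¬l = false , ¬l

  -- The word `default` has one of the two verdicts, and so that verdict has rank at least one at
  -- the root.
  budget-positive : ∀ g → budget g ≡ 0 → ∃[ r ] budget (not g) ≡ suc r
  budget-positive g eq with verdict-has default
  ... | b , has with positive
    where
    positive : 1 ≤ budget b
    positive = rank-max root b (default , refl , has , λ _ → tt)
  budget-positive g eq | b , has | pos with g Bool.≟ b
  ... | yes refl = contradiction (subst (1 ≤_) eq pos) λ ()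
  ... | no  g≢b  = _ , sym (ℕ.suc-pred (budget (not g)) ⦃ >-nonZero (subst (λ c → 1 ≤ budget c) (Bool.¬-not (≢-sym g≢b)) pos) ⦄)

  first-start : ∀ c → let g , r = first budget c in Alternates (suc r) g []
  first-start c with budget c in eq
  ... | suc r = subst (λ k → Alternates k c []) eq (proj₁ (rank-spec root c))
  ... | zero with budget-positive c eq
  ... | r , eq′ rewrite eq′ = subst (λ k → Alternates k (not c) []) eq′ (proj₁ (rank-spec root (not c)))

  module _ (w : ωWord 2) where
    g : ℕ → Bool
    g s = proj₁ (toggles budget w s)
    r : ℕ → ℕ
    r s = proj₂ (toggles budget w s)

    settles : ∃[ s₁ ] (∀ s → s₁ ≤ s → g s ≡ g s₁)
    settles = let s₁ , const = toggles-settle em budget w in s₁ , λ s le → cong proj₁ (const s le)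

    toggle⇔ : ∀ {b} s₁ → (∀ s → s₁ ≤ s → g s ≡ b) → Toggle budget w ⇔ (b ≡ true)
    toggle⇔ {b} s₁ const = mk⇔ to from
      where
      to : Toggle budget w → b ≡ true
      to t with t s₁
      ... | s , s₁≤s , eq = trans (sym (const s s₁≤s)) eq
      from : b ≡ true → Toggle budget w
      from b≡ s = s₁ ⊔ s , ℕ.m≤n⊔m s₁ s , trans (const _ (ℕ.m≤m⊔n s₁ s)) b≡

    guessing : ℕ → Observation n
    guessing s = guess (g s) (r s)

    f : ωWord n
    f = play guessing

    f-correct : Toggle budget w ⇔ L f
    f-correct with settles
    ... | s₁ , const = mk⇔ (proj₂ (has-unique has) ∘ Equivalence.to (toggle⇔ s₁ const))
                           (Equivalence.from (toggle⇔ s₁ const) ∘ proj₁ (has-unique has))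
      where
      has : Has (g s₁) f
      has = play-follows ext guessing default 0 (λ _ ()) g r (λ _ _ → refl)
        (λ s _ → revise-≤ (toggles budget w s) _) (λ s _ → revise-< (toggles budget w s) _)
        (first-start (verdictOf (w 0))) s₁ z≤n const

  f-local : LocallyDetermined f
  f-local w s = suc s , λ w′ eq → play-cong s λ t t≤s →
    cong (λ { (g , r) → guess g r }) (toggles-local budget {w′} {w} t (↾-≤ w′ w (s≤s t≤s) eq))

  Uneven : List (Fin n) → Set
  Uneven u = rank false u ≢ rank true u

  sign : List (Fin n) → Bool
  sign u = does (rank false u ℕ.<? rank true u)

  sign-correct : ∀ {u} → Uneven u → rank (not (sign u)) u < rank (sign u) u
  sign-correct {u} uneven = split (rank false u ℕ.<? rank true u)
    where
    split : (d : Dec (rank false u < rank true u)) → rank (not (does d)) u < rank (does d) u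
    split (yes lt) = lt
    split (no ¬lt) = ℕ.≤∧≢⇒< (ℕ.≮⇒≥ ¬lt) (uneven ∘ sym)

  sign-unique : ∀ {u} g → rank (not g) u < rank g u → sign u ≡ g
  sign-unique true  lt = dec-true (_ ℕ.<? _) lt
  sign-unique false lt = dec-false (_ ℕ.<? _) (ℕ.<-asym lt)

  lt⇒uneven : ∀ {u} g → rank (not g) u < rank g u → Uneven u
  lt⇒uneven true  lt = ℕ.<⇒≢ lt
  lt⇒uneven false lt = ≢-sym (ℕ.<⇒≢ lt)

  -- Prefixes whose ranks tie are skipped, because the strict gap is what pays for a change of
  -- verdict in `tracks`. By `rank-limit` every word has prefixes with unequal ranks beyond any
  -- given time.
  Sample : ωWord n → ℕ → ℕ → Set
  Sample x t m = t ≤ m × Uneven (x ↾ m)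

  abstract
    sample : ∀ x t → ∃ (Least (Sample x t))
    sample x t with verdict-has x
    ... | g , has with rank-limit x {0} g (ranked x 0) has
    ... | m₁ , _ , lim = least (Sample x t) (m₁ ⊔ t , ℕ.m≤n⊔m m₁ t , lt⇒uneven g (lim _ (ℕ.m≤m⊔n m₁ t)))

  time : ωWord n → ℕ → ℕ
  time x t = proj₁ (sample x t)

  time-local : ∀ x x′ t → x′ ↾ time x t ≡ x ↾ time x t → time x′ t ≡ time x t
  time-local x x′ t eq = least-unique {P = Sample x′ t} (proj₂ (sample x′ t))
    ((proj₁ p , subst Uneven (sym eq) (proj₂ p)) ,
     λ k k<m (t≤k , uneven) → none k k<m (t≤k , subst Uneven (↾-≤ x′ x (ℕ.<⇒≤ k<m) eq) uneven))
    where
    p    = proj₁ (proj₂ (sample x t))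
    none = proj₂ (proj₂ (sample x t))

  signAt : ωWord n → ℕ → Bool
  signAt x t = sign (x ↾ time x t)

  h : ωWord n → ωWord 2
  h x t = letterFor (signAt x t)

  h-local : LocallyDetermined h
  h-local x t = time x t , λ x′ eq → cong (letterFor ∘ sign)
    (trans (cong (x′ ↾_) (time-local x x′ t eq)) eq)

  module _ (x : ωWord n) where
    rankAt : Bool → ℕ → ℕ
    rankAt g t = rank g (x ↾ time x t)

    t≤time : ∀ t → t ≤ time x t
    t≤time t = proj₁ (proj₁ (proj₂ (sample x t)))

    gap : ∀ t → rankAt (not (signAt x t)) t < rankAt (signAt x t) t
    gap t = sign-correct (proj₂ (proj₁ (proj₂ (sample x t))))

    time-mono : ∀ t → time x t ≤ time x (suc t)
    time-mono t = ℕ.≮⇒≥ λ lt → proj₂ (proj₂ (sample x t)) (time x (suc t)) lt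
      (ℕ.<⇒≤ (t≤time (suc t)) , proj₂ (proj₁ (proj₂ (sample x (suc t)))))

    -- The remaining budget covers the rank of the opposite verdict. When the sign changes from `g`,
    -- the new opposite is `g`, whose rank is now strictly below that of `not g`; this difference is
    -- the unit spent.
    Tracks : ℕ → Bool × ℕ → Set
    Tracks t (g , r) = g ≡ signAt x t × rankAt (not g) t ≤ r

    tracks-first : ∀ c → rank (not c) (x ↾ time x 0) < rank c (x ↾ time x 0) →
                   proj₁ (first budget c) ≡ c × rankAt (not c) 0 ≤ proj₂ (first budget c)
    tracks-first c lt with budget c in eq
    ... | suc k = refl , ℕ.≤-pred (ℕ.<-≤-trans lt (subst (rank c (x ↾ time x 0) ≤_) eq (rank-≤ x z≤n root c)))
    ... | zero  = contradiction (ℕ.<-≤-trans lt (subst (rank c (x ↾ time x 0) ≤_) eq (rank-≤ x z≤n root c))) λ ()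

    tracks : ∀ t → Tracks t (toggles budget (h x) t)
    tracks zero rewrite verdictOf-letterFor (signAt x 0) with tracks-first (signAt x 0) (gap 0)
    ... | p , q = p , subst (λ c → rankAt (not c) 0 ≤ proj₂ (first budget (signAt x 0))) (sym p) q
    tracks (suc t) rewrite verdictOf-letterFor (signAt x (suc t)) with toggles budget (h x) t | tracks t
    ... | g , r | g≡ , le with g Bool.≟ signAt x (suc t)
    ... | yes refl rewrite revise-same (signAt x (suc t)) r =
            refl , ℕ.≤-trans (rank-≤ x (time-mono t) (ranked x _) _) le
    ... | no g≢ = changed r le
      where
      new : signAt x (suc t) ≡ not g
      new = Bool.¬-not (≢-sym g≢)
      lt : rankAt (not (not g)) (suc t) < rankAt (not g) (suc t)
      lt = subst (λ c → rankAt (not c) (suc t) < rankAt c (suc t)) new (gap (suc t))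
      changed : ∀ r → rankAt (not g) t ≤ r → Tracks (suc t) (revise (g , r) (signAt x (suc t)))
      changed zero le = contradiction
        (ℕ.<-≤-trans lt (ℕ.≤-trans (rank-≤ x (time-mono t) (ranked x _) (not g)) le)) λ ()
      changed (suc r) le = subst (λ c → Tracks (suc t) (revise (g , suc r) c)) (sym new)
        (subst (Tracks (suc t)) (sym (revise-new g r))
          (sym new , ℕ.≤-pred (ℕ.<-≤-trans lt (ℕ.≤-trans (rank-≤ x (time-mono t) (ranked x _) (not g)) le))))

    h-correct : L x ⇔ Toggle budget (h x)
    h-correct with verdict-has x
    ... | b , has with rank-limit x {0} b (ranked x 0) has
    ... | m₁ , _ , lim = mk⇔ (Equivalence.from toggle ∘ proj₁ (has-unique has))
                             (proj₂ (has-unique has) ∘ Equivalence.to toggle)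
      where
      toggle : Toggle budget (h x) ⇔ (b ≡ true)
      toggle = toggle⇔ (h x) m₁ λ s m₁≤s →
        trans (proj₁ (tracks s)) (sign-unique b (lim _ (ℕ.≤-trans m₁≤s (t≤time s))))

  L≡WToggle : L ≡W Toggle budget
  L≡WToggle =
    (h , locallyDetermined⇒continuous h-local , (λ {x} → Equivalence.to (h-correct x)) , (λ {x} → Equivalence.from (h-correct x))) ,
    (f , locallyDetermined⇒continuous f-local , (λ {w} → Equivalence.to (f-correct w)) , (λ {w} → Equivalence.from (f-correct w)))

-- Petri nets over arbitrary finite sets of states and counters

record Finite (S : Set) : Set where
  field
    size          : ℕ
    encode        : S → Fin size
    decode        : Fin size → S
    decode-encode : ∀ s → decode (encode s) ≡ s

open Finite using (size)

finite-Fin : ∀ n → Finite (Fin n)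
finite-Fin n = record { size = n ; encode = id ; decode = id ; decode-encode = λ _ → refl }

finite-× : ∀ {A B} → Finite A → Finite B → Finite (A × B)
finite-× {A} {B} FA FB = record
  { size          = A.size * B.size
  ; encode        = λ (a , b) → Fin.combine (A.encode a) (B.encode b)
  ; decode        = λ i → let j , k = Fin.remQuot B.size i in A.decode j , B.decode k
  ; decode-encode = λ (a , b) → trans
      (cong (λ (j , k) → A.decode j , B.decode k) (Fin.remQuot-combine (A.encode a) (B.encode b)))
      (cong₂ _,_ (A.decode-encode a) (B.decode-encode b))
  }
  where
  module A = Finite FA
  module B = Finite FB

finite-⊎ : ∀ {A B} → Finite A → Finite B → Finite (A ⊎ B)
finite-⊎ {A} {B} FA FB = record
  { size          = A.size + B.size
  ; encode        = λ s → Fin.join A.size B.size (Sum.map A.encode B.encode s)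
  ; decode        = λ i → Sum.map A.decode B.decode (Fin.splitAt A.size i)
  ; decode-encode = λ s → trans (cong (Sum.map A.decode B.decode) (Fin.splitAt-join A.size B.size (Sum.map A.encode B.encode s))) (inverse s)
  }
  where
  module A = Finite FA
  module B = Finite FB
  inverse : ∀ s → Sum.map A.decode B.decode (Sum.map A.encode B.encode s) ≡ s
  inverse (inj₁ a) = cong inj₁ (A.decode-encode a)
  inverse (inj₂ b) = cong inj₂ (B.decode-encode b)

finite-retract : ∀ {A B} → Finite B → (f : A → B) (g : B → A) → (∀ a → g (f a) ≡ a) → Finite A
finite-retract FB f g gf = record
  { size          = size FB
  ; encode        = Finite.encode FB ∘ f
  ; decode        = g ∘ Finite.decode FB
  ; decode-encode = λ a → trans (cong g (Finite.decode-encode FB (f a))) (gf a)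
  }

finite-Bool : Finite Bool
finite-Bool = finite-retract (finite-Fin 2) (λ { false → 0F ; true → 1F }) (λ { 0F → false ; 1F → true })
  λ { false → refl ; true → refl }

Applies : Action → ℕ → ℕ → Set
Applies hold v v′ = v′ ≡ v
Applies inc  v v′ = v′ ≡ suc v
Applies dec  v v′ = suc v′ ≡ v

record Net (n : ℕ) : Set₁ where
  field
    State         : Set
    Counter       : Set
    finiteState   : Finite State
    finiteCounter : Finite Counter
    start         : State
    transitions   : State → Fin n → List (State × (Counter → Action))
    accepting     : State → Bool

  record NetRun (w : ωWord n) : Set where
    field
      state       : ℕ → State
      counter     : ℕ → Counter → ℕ
      state-start : state 0 ≡ start
      counter-start : ∀ c → counter 0 c ≡ 0
      net-step : ∀ t → Σ[ act ∈ (Counter → Action) ]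
        (state (suc t) , act) ∈ transitions (state t) (w t) ×
        (∀ c → Applies (act c) (counter t c) (counter (suc t) c))

  NetLanguage : ωLang n
  NetLanguage w = Σ[ ρ ∈ NetRun w ] ∃[ q ] T (accepting q) ×
    (∀ t → ∃[ t′ ] t ≤ t′ × NetRun.state ρ t′ ≡ q)

_≟ᴬ_ : DecidableEquality Action
hold ≟ᴬ hold = yes refl
hold ≟ᴬ inc  = no λ ()
hold ≟ᴬ dec  = no λ ()
inc  ≟ᴬ hold = no λ ()
inc  ≟ᴬ inc  = yes refl
inc  ≟ᴬ dec  = no λ ()
dec  ≟ᴬ hold = no λ ()
dec  ≟ᴬ inc  = no λ ()
dec  ≟ᴬ dec  = yes refl

applies⇒ℤ : ∀ a {v v′} → Applies a v v′ → int v′ ≡ int v ℤ.+ value a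
applies⇒ℤ hold {v} refl = cong int (sym (ℕ.+-identityʳ v))
applies⇒ℤ inc  {v} refl = cong int (sym (ℕ.+-comm v 1))
applies⇒ℤ dec  refl = refl

ℤ⇒applies : ∀ a {v v′} → int v′ ≡ int v ℤ.+ value a → Applies a v v′
ℤ⇒applies hold {v}     eq = trans (ℤ.+-injective eq) (ℕ.+-identityʳ v)
ℤ⇒applies inc  {v}     eq = trans (ℤ.+-injective eq) (ℕ.+-comm v 1)
ℤ⇒applies dec  {suc v} eq = cong suc (ℤ.+-injective eq)

tabulate-zero : ∀ {m} (f : Fin m → ℕ) → (∀ i → f i ≡ 0) → tabulate f ≡ replicate m 0
tabulate-zero {zero}  f p = refl
tabulate-zero {suc m} f p = cong₂ _∷_ (p 0F) (tabulate-zero (f ∘ suc) (p ∘ suc))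

module NetAutomaton {n} (N : Net n) where
  open Net N
  private
    module S = Finite finiteState
    module C = Finite finiteCounter

  k : ℕ
  k = C.size

  actions : (Counter → Action) → Vec Action k
  actions act = tabulate (act ∘ C.decode)

  -- The tests enter only through the ban on decrementing a counter that is zero, and replacing a 0
  -- by a 1 merely lifts a ban; hence blindness.
  Enabled : Fin S.size → Fin n → Vec (Fin 2) k → Fin S.size → Vec Action k → Set
  Enabled q a i q′ j =
    Any (λ (s , act) → S.encode s ≡ q′ × actions act ≡ j) (transitions (S.decode q) a) ×
    (∀ m → lookup i m ≡ 0F → lookup j m ≢ dec)

  enabled? : ∀ q a i q′ j → Dec (Enabled q a i q′ j)
  enabled? q a i q′ j =
    Any.any? (λ (s , act) → (S.encode s Fin.≟ q′) ×-dec Vec.≡-dec _≟ᴬ_ (actions act) j) _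
    ×-dec Fin.all? (λ m → (lookup i m Fin.≟ 0F) →-dec ¬? (lookup j m ≟ᴬ dec))

  automatonMachine : Machine k (Fin n)
  automatonMachine = record
    { states = S.size
    ; q₀     = S.encode start
    ; Δ      = λ q a i q′ j → ⌊ enabled? q a i q′ j ⌋
    ; blind  = λ q a i q′ j t m im≡0 →
        let any , allowed = toWitness t
        in  not-dec (lookup j m) (allowed m im≡0) ,
            fromWitness (any , λ m′ eq → allowed m′ (still-zero i m m′ eq))
    }
    where
    not-dec : ∀ a → a ≢ dec → a ≡ hold ⊎ a ≡ inc
    not-dec hold _ = inj₁ refl
    not-dec inc  _ = inj₂ refl
    not-dec dec  p = contradiction refl p
    still-zero : ∀ (i : Vec (Fin 2) k) m m′ → lookup (i [ m ]≔ 1F) m′ ≡ 0F → lookup i m′ ≡ 0F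
    still-zero i m m′ eq with m′ Fin.≟ m
    ... | yes refl = contradiction (trans (sym (Vec.lookup∘update m i 1F)) eq) λ ()
    ... | no m′≢m  = trans (sym (Vec.lookup∘update′ m′≢m i 1F)) eq

  automaton : BüchiAutomaton k (Fin n)
  automaton = record { machine = automatonMachine ; F = tabulate (accepting ∘ S.decode) }

  open BüchiAutomaton automaton using (Run; module Run; test; _∶_↦_) renaming (state to control)

  private
    test-zero : ∀ v → test v ≡ 0F → v ≡ 0
    test-zero zero _ = refl

    not-dec-at-zero : ∀ {a v v′} → Applies a v v′ → v ≡ 0 → a ≢ dec
    not-dec-at-zero () refl refl

  net⇒automaton : ∀ {w} → NetLanguage w → realTimeLanguage automaton w
  net⇒automaton {w} (ρ , q , acc , often) = run , S.encode q ,
    Vec.lookup⇒[]= (S.encode q) _ (trans (Vec.lookup∘tabulate _ (S.encode q))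
      (trans (cong accepting (S.decode-encode q)) (Equivalence.to Bool.T-≡ acc))) ,
    λ t → let t′ , t≤t′ , eq = often t in t′ , t≤t′ , cong S.encode eq
    where
    open NetRun ρ
    values : ℕ → Vec ℕ k
    values t = tabulate (counter t ∘ C.decode)
    run : Run w
    run = record
      { config  = λ t → S.encode (state t) , values t
      ; initial = cong₂ _,_ (cong S.encode state-start) (tabulate-zero _ (λ i → counter-start (C.decode i)))
      ; step    = step
      }
      where
      step : ∀ t → w t ∶ (S.encode (state t) , values t) ↦ (S.encode (state (suc t)) , values (suc t))
      step t with net-step t
      ... | act , mem , app = actions act ,
        fromWitness (lose (subst (λ s → (state (suc t) , act) ∈ transitions s (w t)) (sym (S.decode-encode (state t))) mem)
                       (refl , refl) , allowed) ,
        equation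
        where
        allowed : ∀ m → lookup (Vec.map test (values t)) m ≡ 0F → lookup (actions act) m ≢ dec
        allowed m eq = subst (_≢ dec) (sym (Vec.lookup∘tabulate _ m))
          (not-dec-at-zero (app (C.decode m)) (trans (sym (Vec.lookup∘tabulate _ m))
            (test-zero _ (trans (sym (Vec.lookup-map m test (values t))) eq))))
        equation : ∀ m → int (lookup (values (suc t)) m) ≡ int (lookup (values t) m) ℤ.+ value (lookup (actions act) m)
        equation m rewrite Vec.lookup∘tabulate (counter (suc t) ∘ C.decode) m
                         | Vec.lookup∘tabulate (counter t ∘ C.decode) m
                         | Vec.lookup∘tabulate (act ∘ C.decode) m = applies⇒ℤ (act (C.decode m)) (app (C.decode m))

  automaton⇒net : ∀ {w} → realTimeLanguage automaton w → NetLanguage w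
  automaton⇒net {w} (run , q , q∈F , often) = record
    { state         = λ t → S.decode (control (config t))
    ; counter       = λ t c → lookup (proj₂ (config t)) (C.encode c)
    ; state-start   = trans (cong (S.decode ∘ proj₁) initial) (S.decode-encode start)
    ; counter-start = λ c → trans (cong (λ cf → lookup (proj₂ cf) (C.encode c)) initial) (Vec.lookup-replicate (C.encode c) 0)
    ; net-step      = step′
    } , S.decode q ,
    subst T (trans (sym (Vec.[]=⇒lookup q∈F)) (Vec.lookup∘tabulate _ q)) tt ,
    λ t → let t′ , t≤t′ , eq = often t in t′ , t≤t′ , cong S.decode eq
    where
    open Run run
    step′ : ∀ t → Σ[ act ∈ (Counter → Action) ]
      (S.decode (control (config (suc t))) , act) ∈ transitions (S.decode (control (config t))) (w t) ×
      (∀ c → Applies (act c) (lookup (proj₂ (config t)) (C.encode c)) (lookup (proj₂ (config (suc t))) (C.encode c)))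
    step′ t with step t
    ... | j , tr , eqs with find (proj₁ (toWitness tr))
    ... | (s , act) , mem , s≡ , refl = act ,
      subst (λ s′ → (s′ , act) ∈ transitions (S.decode (control (config t))) (w t))
        (trans (sym (S.decode-encode s)) (cong S.decode s≡)) mem ,
      λ c → ℤ⇒applies (act c) (subst (λ a → int (lookup (proj₂ (config (suc t))) (C.encode c)) ≡ int (lookup (proj₂ (config t)) (C.encode c)) ℤ.+ value a)
        (trans (Vec.lookup∘tabulate (act ∘ C.decode) (C.encode c)) (cong act (C.decode-encode c))) (eqs (C.encode c)))

  netLanguage∈r-PNω : 1 ≤ k → r-PNω n NetLanguage
  netLanguage∈r-PNω 1≤k = k , 1≤k , automaton , net⇒automaton , automaton⇒net

-- Finite automata for the degrees of finite rank

module ToggleNet (em : ExcludedMiddle 0ℓ) (budget : Bool → ℕ) where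
  open Toggle

  M : ℕ
  M = budget true ⊔ budget false

  clamp : ℕ → Fin (suc M)
  clamp r = fromℕ< (s≤s (ℕ.m⊓n≤n r M))

  toℕ-clamp : ∀ {r} → r ≤ M → toℕ (clamp r) ≡ r
  toℕ-clamp {r} r≤M = trans (Fin.toℕ-fromℕ< _) (ℕ.m≤n⇒m⊓n≡m r≤M)

  pack : Bool × ℕ → Bool × Fin (suc M)
  pack (g , r) = g , clamp r

  unpack : Bool × Fin (suc M) → Bool × ℕ
  unpack (g , r) = g , toℕ r

  unpack-pack : ∀ {st} → proj₂ st ≤ M → unpack (pack st) ≡ st
  unpack-pack {g , r} r≤M = cong (g ,_) (toℕ-clamp r≤M)

  budget≤M : ∀ g → budget g ≤ M
  budget≤M true  = ℕ.m≤m⊔n _ _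
  budget≤M false = ℕ.m≤n⊔m (budget true) _

  toggles≤M : ∀ w s → proj₂ (toggles budget w s) ≤ M
  toggles≤M w zero = bound (verdictOf (w 0))
    where
    bound : ∀ c → proj₂ (first budget c) ≤ M
    bound c with budget c in eq
    ... | suc r = ℕ.≤-trans (ℕ.n≤1+n r) (subst (_≤ M) eq (budget≤M c))
    ... | zero  = ℕ.≤-trans ℕ.pred[n]≤n (budget≤M (not c))
  toggles≤M w (suc s) = ℕ.≤-trans (revise-≤ (toggles budget w s) _) (toggles≤M w s)

  successor : ⊤ ⊎ (Bool × Fin (suc M)) → Fin 2 → Bool × Fin (suc M)
  successor (inj₁ _)  a = pack (first budget (verdictOf a))
  successor (inj₂ st) a = pack (revise (unpack st) (verdictOf a))

  net : Net 2
  net = record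
    { State         = ⊤ ⊎ (Bool × Fin (suc M))
    -- An idle counter, since the class asks for at least one.
    ; Counter       = Fin 1
    ; finiteState   = finite-⊎ (finite-retract (finite-Fin 1) (λ _ → 0F) _ (λ _ → refl)) (finite-× finite-Bool (finite-Fin _))
    ; finiteCounter = finite-Fin 1
    ; start         = inj₁ tt
    ; transitions   = λ q a → (inj₂ (successor q a) , λ _ → hold) ∷ []
    ; accepting     = λ { (inj₁ _) → false ; (inj₂ (g , _)) → g }
    }
  open Net net

  stateAt : ωWord 2 → ℕ → State
  stateAt w zero    = inj₁ tt
  stateAt w (suc s) = inj₂ (pack (toggles budget w s))

  stateAt-step : ∀ w s → inj₂ (successor (stateAt w s) (w s)) ≡ stateAt w (suc s)
  stateAt-step w zero    = refl
  stateAt-step w (suc s) = cong (λ st → inj₂ (pack (revise st (verdictOf (w (suc s))))))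
    (unpack-pack (toggles≤M w s))

  run-deterministic : ∀ {w} (ρ : NetRun w) s → NetRun.state ρ s ≡ stateAt w s
  run-deterministic {w} ρ zero    = NetRun.state-start ρ
  run-deterministic {w} ρ (suc s) with NetRun.net-step ρ s
  ... | _ , here eq , _ = trans (cong proj₁ eq) (trans (cong (λ q → inj₂ (successor q (w s))) (run-deterministic ρ s)) (stateAt-step w s))

  toggle⇒net : ∀ {w} → Toggle budget w → NetLanguage w
  toggle⇒net {w} t with toggles-settle em budget w
  ... | s₁ , const = record
    { state         = stateAt w
    ; counter       = λ _ _ → 0
    ; state-start   = refl
    ; counter-start = λ _ → refl
    ; net-step      = λ s → (λ _ → hold) , here (cong (_, (λ _ → hold)) (sym (stateAt-step w s))) , λ _ → refl
    } , stateAt w (suc s₁) , accepts , λ s → suc (s₁ ⊔ s) , ℕ.m≤n⇒m≤1+n (ℕ.m≤n⊔m s₁ s) ,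
        cong (inj₂ ∘ pack) (const _ (ℕ.m≤m⊔n s₁ s))
    where
    accepts : T (proj₁ (toggles budget w s₁))
    accepts with t s₁
    ... | s , s₁≤s , eq = subst T (sym (trans (sym (cong proj₁ (const s s₁≤s))) eq)) tt

  net⇒toggle : ∀ {w} → NetLanguage w → Toggle budget w
  net⇒toggle {w} (ρ , inj₂ (true , r) , acc , often) s with often (suc s)
  ... | suc s′ , s≤s s≤s′ , eq = s′ , s≤s′ , verdict (trans (sym (run-deterministic ρ (suc s′))) eq)
    where
    verdict : ∀ {g k} → inj₂ {A = ⊤} (g , k) ≡ inj₂ (true , r) → g ≡ true
    verdict refl = refl

  toggle∈r-PNω : r-PNω 2 (Toggle budget)
  toggle∈r-PNω with NetAutomaton.netLanguage∈r-PNω net (s≤s z≤n)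
  ... | k , 1≤k , A , to , from = k , 1≤k , A , to ∘ toggle⇒net , net⇒toggle ∘ from

-- Nondeterministic counter programs fed by a stream of digits

-- A digit reaches the buffer at every step, whatever the program is doing. `SNAP`, which empties
-- the buffer into register 0, is its only access to the input, at a moment of its own choice.
data Op (K : ℕ) : Set where
  INC DEC ZERO : Fin (suc K) → Op K
  SNAP         : Op K

record Program (K : ℕ) : Set where
  field
    locations : ℕ
    entry     : Fin locations
    goal      : Fin locations
    edges     : Fin locations → List (Op K × Fin locations)

OpEnabled : ∀ {K} → Op K → (Fin (suc K) → ℕ) → Set
OpEnabled (INC i)  ρ = ⊤
OpEnabled (DEC i)  ρ = ρ i ≢ 0
OpEnabled (ZERO i) ρ = ρ i ≡ 0
OpEnabled SNAP     ρ = ⊤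

regAfter : ∀ {K} → Op K → (Fin (suc K) → ℕ) → ℕ → Fin (suc K) → ℕ
regAfter (INC i)  ρ β j = if does (i Fin.≟ j) then suc (ρ j) else ρ j
regAfter (DEC i)  ρ β j = if does (i Fin.≟ j) then pred (ρ j) else ρ j
regAfter (ZERO i) ρ β j = ρ j
regAfter SNAP     ρ β j = if does (0F Fin.≟ j) then ρ j + β else ρ j

bufAfter : ∀ {K} → Op K → ℕ → ℕ
bufAfter SNAP β = 0
bufAfter _    β = β

-- Counting ticks and passes

indicator : Bool → ℕ
indicator true  = 1
indicator false = 0

inside : ℕ → ℕ → ℕ → Bool
inside lo hi p = does (lo ℕ.≤? p) ∧ does (p ℕ.<? hi)

inside-true : ∀ {lo hi p} → lo ≤ p → p < hi → inside lo hi p ≡ true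
inside-true {lo} {hi} {p} lo≤p p<hi = cong₂ _∧_ (dec-true (lo ℕ.≤? p) lo≤p) (dec-true (p ℕ.<? hi) p<hi)

inside-below : ∀ {lo hi p} → p < lo → inside lo hi p ≡ false
inside-below {lo} {hi} {p} p<lo = cong (_∧ does (p ℕ.<? hi)) (dec-false (lo ℕ.≤? p) (ℕ.<⇒≱ p<lo))

inside-above : ∀ {lo hi p} → hi ≤ p → inside lo hi p ≡ false
inside-above {lo} {hi} {p} hi≤p = trans (cong (does (lo ℕ.≤? p) ∧_) (dec-false (p ℕ.<? hi) (ℕ.≤⇒≯ hi≤p)))
  (Bool.∧-zeroʳ _)

module Gain (N : ℕ) where

  -- The number of those among the first k ticks that belong to one of the
  -- passes lo, …, hi ∸ 1, when every pass consists of N ticks.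
  gain : ℕ → ℕ → ℕ → ℕ
  gain lo hi k = k ⊓ (hi * N) ∸ lo * N

  gain-before : ∀ lo hi {k} → k ≤ lo * N → gain lo hi k ≡ 0
  gain-before lo hi {k} k≤ = ℕ.m≤n⇒m∸n≡0 (ℕ.≤-trans (ℕ.m⊓n≤m k (hi * N)) k≤)

  gain-during : ∀ lo hi {k} → lo * N ≤ k → k ≤ hi * N → gain lo hi k + lo * N ≡ k
  gain-during lo hi {k} lo≤ ≤hi rewrite ℕ.m≤n⇒m⊓n≡m ≤hi = ℕ.m∸n+n≡m lo≤

  gain-after : ∀ lo hi {k} → lo ≤ hi → hi * N ≤ k → gain lo hi k + lo * N ≡ hi * N
  gain-after lo hi {k} lo≤hi hi≤ rewrite ℕ.m≥n⇒m⊓n≡n hi≤ = ℕ.m∸n+n≡m (ℕ.*-monoˡ-≤ N lo≤hi)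

  gain-tick : ∀ lo hi p {k} → p * N ≤ k → k < suc p * N →
              gain lo hi (suc k) ≡ gain lo hi k + indicator (inside lo hi p)
  gain-tick lo hi p {k} p≤k k<p with lo ℕ.≤? p | p ℕ.<? hi
  ... | no lo≰p | _ rewrite inside-below {lo} {hi} {p} (ℕ.≰⇒> lo≰p) =
      trans (gain-before lo hi (ℕ.≤-trans k<p up))
      (sym (trans (ℕ.+-identityʳ _) (gain-before lo hi (ℕ.≤-trans (ℕ.<⇒≤ k<p) up))))
    where
    up : suc p * N ≤ lo * N
    up = ℕ.*-monoˡ-≤ N (ℕ.≰⇒> lo≰p)
  ... | yes lo≤p | yes p<hi rewrite inside-true lo≤p p<hi
                                  | ℕ.m≤n⇒m⊓n≡m (ℕ.≤-trans k<p (ℕ.*-monoˡ-≤ N p<hi))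
                                  | ℕ.m≤n⇒m⊓n≡m (ℕ.≤-trans (ℕ.<⇒≤ k<p) (ℕ.*-monoˡ-≤ N p<hi)) =
      trans (ℕ.+-∸-assoc 1 (ℕ.≤-trans (ℕ.*-monoˡ-≤ N lo≤p) p≤k)) (ℕ.+-comm 1 _)
  ... | yes lo≤p | no p≮hi rewrite inside-above {lo} {hi} {p} (ℕ.≮⇒≥ p≮hi)
                                 | ℕ.m≥n⇒m⊓n≡n (ℕ.m≤n⇒m≤1+n (ℕ.≤-trans (ℕ.*-monoˡ-≤ N (ℕ.≮⇒≥ p≮hi)) p≤k))
                                 | ℕ.m≥n⇒m⊓n≡n (ℕ.≤-trans (ℕ.*-monoˡ-≤ N (ℕ.≮⇒≥ p≮hi)) p≤k) =
      sym (ℕ.+-identityʳ _)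

-- An action that both decrements and increments does nothing.
action : Bool → Bool → Action
action true  true  = hold
action true  false = dec
action false true  = inc
action false false = hold

applies-action : ∀ x y {v v′} → Applies (action x y) v v′ → v′ + indicator x ≡ v + indicator y
applies-action true  true  refl = refl
applies-action true  false {v′ = v′} refl = trans (ℕ.+-comm v′ 1) (sym (ℕ.+-identityʳ _))
applies-action false true  {v} refl = trans (ℕ.+-identityʳ _) (ℕ.+-comm 1 v)
applies-action false false refl = refl

perform : Action → ℕ → ℕ
perform hold v = v
perform inc  v = suc v
perform dec  v = pred v

applies-perform : ∀ a {v} → (a ≡ dec → v ≢ 0) → Applies a v (perform a v)
applies-perform hold p = refl
applies-perform inc  p = refl
applies-perform dec {zero}  p = contradiction refl (p refl)
applies-perform dec {suc v} p = refl

-- The units in `yard p` are the ticks that pass `p` may still take. Each tick moves one on to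
-- `yard (p + 1)`, if there is one, so that every pass measures out the next; the ticks of passes 1
-- to `B` are also collected in yard 0, for the following stage.
data Ctr (B K : ℕ) : Set where
  yard      : Fin (suc B) → Ctr B K
  reg coreg : Fin (suc K) → Ctr B K
  buf cobuf : Ctr B K

-- One stage consists of B + 1 passes of N ticks each, during which the contents
-- of yard 0 grows from N to B * N and the digit D times N is added to buf.
-- Throughout, coreg j and cobuf complement reg j and buf to N. Hence in pass 0
-- ZERO i can afford N decrements of coreg i only if reg i is 0. For SNAP, each
-- tick of pass 0 moves a unit from buf to reg 0 or decrements cobuf; as
-- buf + cobuf = N, this is possible only if both are exhausted.

module Stage (B K : ℕ) where

  -- Each complemented sum has to grow from `N` to `B * N`, which takes `B ∸ 1` passes of refilling.
  -- A zero test burns `N` units of its `coreg` in pass 0, and `SNAP` burns all of `cobuf` and `buf`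
  -- together, so there one pass more is needed. Passes 1 to `D` fill `buf`, and the others fill
  -- `cobuf`.
  coregEnd : Op K → Fin (suc K) → ℕ
  coregEnd (ZERO i) j = if does (i Fin.≟ j) then suc B else B
  coregEnd _        j = B

  cobufEnd : Op K → ℕ
  cobufEnd SNAP = suc B
  cobufEnd _    = B

  onlyZero : Fin (suc K) → ℕ → ℕ
  onlyZero j a = if does (0F Fin.≟ j) then a else 0

  incᴾ decᴾ : Op K → ℕ → ℕ → Bool → Ctr B K → Bool
  decᴾ op       D p ch (yard q)  = inside (toℕ q) (suc (toℕ q)) p
  decᴾ op       D p ch (reg j)   = false
  decᴾ (ZERO i) D p ch (coreg j) = does (i Fin.≟ j) ∧ inside 0 1 p
  decᴾ SNAP     D p ch (coreg j) = does (0F Fin.≟ j) ∧ (inside 0 1 p ∧ ch)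
  decᴾ _        D p ch (coreg j) = false
  decᴾ SNAP     D p ch buf       = inside 0 1 p ∧ ch
  decᴾ _        D p ch buf       = false
  decᴾ SNAP     D p ch cobuf     = inside 0 1 p ∧ not ch
  decᴾ _        D p ch cobuf     = false

  incᴾ op   D p ch (yard zero)    = inside 1 (suc B) p
  incᴾ op   D p ch (yard (suc q)) = inside (toℕ q) (suc (toℕ q)) p
  incᴾ SNAP D p ch (reg j)        = does (0F Fin.≟ j) ∧ (inside 0 1 p ∧ ch)
  incᴾ _    D p ch (reg j)        = false
  incᴾ op   D p ch (coreg j)      = inside 1 (coregEnd op j) p
  incᴾ op   D p ch buf            = inside 1 (suc D) p
  incᴾ op   D p ch cobuf          = inside (suc D) (cobufEnd op) p

  passAction : Op K → ℕ → ℕ → Bool → Ctr B K → Action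
  passAction op D p ch c = action (decᴾ op D p ch c) (incᴾ op D p ch c)

  incᴱ decᴱ : Op K → Ctr B K → Bool
  decᴱ (INC i) (coreg j) = does (i Fin.≟ j)
  decᴱ (DEC i) (reg j)   = does (i Fin.≟ j)
  decᴱ _       _         = false
  incᴱ (INC i) (reg j)   = does (i Fin.≟ j)
  incᴱ (DEC i) (coreg j) = does (i Fin.≟ j)
  incᴱ _       _         = false

  endAction : Op K → Ctr B K → Action
  endAction op c = action (decᴱ op c) (incᴱ op c)

  module Balance (N : ℕ) where
    open Gain N

    -- a and b count the ticks of pass 0 at which the first and the second
    -- alternative was chosen; only SNAP distinguishes them.
    debit credit : Op K → ℕ → ℕ → ℕ → ℕ → Ctr B K → ℕ
    debit op       D k a b (yard q)  = gain (toℕ q) (suc (toℕ q)) k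
    debit op       D k a b (reg j)   = 0
    debit (ZERO i) D k a b (coreg j) = if does (i Fin.≟ j) then gain 0 1 k else 0
    debit SNAP     D k a b (coreg j) = onlyZero j a
    debit _        D k a b (coreg j) = 0
    debit SNAP     D k a b buf       = a
    debit _        D k a b buf       = 0
    debit SNAP     D k a b cobuf     = b
    debit _        D k a b cobuf     = 0

    credit op   D k a b (yard zero)    = gain 1 (suc B) k
    credit op   D k a b (yard (suc q)) = gain (toℕ q) (suc (toℕ q)) k
    credit SNAP D k a b (reg j)        = onlyZero j a
    credit _    D k a b (reg j)        = 0
    credit op   D k a b (coreg j)      = gain 1 (coregEnd op j) k
    credit op   D k a b buf            = gain 1 (suc D) k
    credit op   D k a b cobuf          = gain (suc D) (cobufEnd op) k

    if-tick : ∀ x {m m′ y} → m′ ≡ m + indicator y →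
              (if x then m′ else 0) ≡ (if x then m else 0) + indicator (x ∧ y)
    if-tick true  eq = eq
    if-tick false eq = refl

    chosen⁺ : ℕ → Bool → ℕ → ℕ
    chosen⁺ p ch a = a + indicator (inside 0 1 p ∧ ch)

    module _ (p : ℕ) {k : ℕ} (p≤k : p * N ≤ k) (k<p : k < suc p * N) (ch : Bool) (a b : ℕ) where

      debit-tick : ∀ op D c → debit op D (suc k) (chosen⁺ p ch a) (chosen⁺ p (not ch) b) c ≡ debit op D k a b c + indicator (decᴾ op D p ch c)
      debit-tick op       D (yard q)  = gain-tick (toℕ q) (suc (toℕ q)) p p≤k k<p
      debit-tick op       D (reg j)   = refl
      debit-tick (INC _)  D (coreg j) = refl
      debit-tick (DEC _)  D (coreg j) = refl
      debit-tick (ZERO i) D (coreg j) = if-tick (does (i Fin.≟ j)) (gain-tick 0 1 p p≤k k<p)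
      debit-tick SNAP     D (coreg j) = if-tick (does (0F Fin.≟ j)) refl
      debit-tick (INC _)  D buf       = refl
      debit-tick (DEC _)  D buf       = refl
      debit-tick (ZERO _) D buf       = refl
      debit-tick SNAP     D buf       = refl
      debit-tick (INC _)  D cobuf     = refl
      debit-tick (DEC _)  D cobuf     = refl
      debit-tick (ZERO _) D cobuf     = refl
      debit-tick SNAP     D cobuf     = refl

      credit-tick : ∀ op D c → credit op D (suc k) (chosen⁺ p ch a) (chosen⁺ p (not ch) b) c ≡ credit op D k a b c + indicator (incᴾ op D p ch c)
      credit-tick op       D (yard zero)    = gain-tick 1 (suc B) p p≤k k<p
      credit-tick op       D (yard (suc q)) = gain-tick (toℕ q) (suc (toℕ q)) p p≤k k<p
      credit-tick (INC _)  D (reg j)        = refl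
      credit-tick (DEC _)  D (reg j)        = refl
      credit-tick (ZERO _) D (reg j)        = refl
      credit-tick SNAP     D (reg j)        = if-tick (does (0F Fin.≟ j)) refl
      credit-tick op       D (coreg j)      = gain-tick 1 (coregEnd op j) p p≤k k<p
      credit-tick op       D buf            = gain-tick 1 (suc D) p p≤k k<p
      credit-tick op       D cobuf          = gain-tick (suc D) (cobufEnd op) p p≤k k<p

      sum-tick : a + b ≡ gain 0 1 k → chosen⁺ p ch a + chosen⁺ p (not ch) b ≡ gain 0 1 (suc k)
      sum-tick eq = trans (split (inside 0 1 p) ch)
        (trans (cong (_+ indicator (inside 0 1 p)) eq) (sym (gain-tick 0 1 p p≤k k<p)))
        where
        split : ∀ x y → (a + indicator (x ∧ y)) + (b + indicator (x ∧ not y)) ≡ (a + b) + indicator x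
        split true  true  = lemma a b where
          lemma : ∀ a b → (a + 1) + (b + 0) ≡ (a + b) + 1
          lemma = solve-∀
        split true  false = lemma a b where
          lemma : ∀ a b → (a + 0) + (b + 1) ≡ (a + b) + 1
          lemma = solve-∀
        split false y     = lemma a b where
          lemma : ∀ a b → (a + 0) + (b + 0) ≡ (a + b) + 0
          lemma = solve-∀

    -- Debits and credits stand on opposite sides, which keeps the account free of truncated
    -- subtraction.
    Balanced : Op K → ℕ → (Ctr B K → ℕ) → ℕ → ℕ → ℕ → (Ctr B K → ℕ) → Set
    Balanced op D v₀ k a b v = ∀ c → v c + debit op D k a b c ≡ v₀ c + credit op D k a b c

    balanced-tick : ∀ {op D} p {k} (p≤k : p * N ≤ k) (k<p : k < suc p * N) ch a b {v₀ v v′} →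
      Balanced op D v₀ k a b v →
      (∀ c → Applies (passAction op D p ch c) (v c) (v′ c)) →
      Balanced op D v₀ (suc k) (chosen⁺ p ch a) (chosen⁺ p (not ch) b) v′
    balanced-tick {op} {D} p {k} p≤k k<p ch a b {v₀} {v} {v′} bal app c = begin
      v′ c + debit op D (suc k) a⁺ b⁺ c   ≡⟨ cong (v′ c +_) (debit-tick p p≤k k<p ch a b op D c) ⟩
      v′ c + (debit₀ + y)               ≡⟨ swap (v′ c) debit₀ y ⟩
      (v′ c + y) + debit₀               ≡⟨ cong (_+ debit₀) (applies-action (decᴾ op D p ch c) (incᴾ op D p ch c) (app c)) ⟩
      (v c + z) + debit₀                ≡⟨ sym (swap (v c) debit₀ z) ⟩
      v c + (debit₀ + z)                ≡⟨ sym (ℕ.+-assoc (v c) debit₀ z) ⟩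
      (v c + debit₀) + z                ≡⟨ cong (_+ z) (bal c) ⟩
      (v₀ c + credit₀) + z              ≡⟨ ℕ.+-assoc (v₀ c) credit₀ z ⟩
      v₀ c + (credit₀ + z)              ≡⟨ cong (v₀ c +_) (sym (credit-tick p p≤k k<p ch a b op D c)) ⟩
      v₀ c + credit op D (suc k) a⁺ b⁺ c  ∎
      where
      open ≡-Reasoning
      a⁺ = chosen⁺ p ch a
      b⁺ = chosen⁺ p (not ch) b
      debit₀  = debit op D k a b c
      credit₀ = credit op D k a b c
      y = indicator (decᴾ op D p ch c)
      z = indicator (incᴾ op D p ch c)
      swap : ∀ x y z → x + (y + z) ≡ (x + z) + y
      swap = solve-∀

T-∧ : ∀ {x y} → x ∧ y ≡ true → x ≡ true × y ≡ true
T-∧ {true} {true} _ = refl , refl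

does⇒ : ∀ {P : Set} (d : Dec P) → does d ≡ true → P
does⇒ (yes p) _ = p

inside⇒ : ∀ {lo hi p} → inside lo hi p ≡ true → lo ≤ p × p < hi
inside⇒ {lo} {hi} {p} eq with T-∧ {does (lo ℕ.≤? p)} eq
... | x , y = does⇒ (lo ℕ.≤? p) x , does⇒ (p ℕ.<? hi) y

inside-unit : ∀ {q p} → inside q (suc q) p ≡ true → q ≡ p
inside-unit {q} {p} eq with inside⇒ {q} {suc q} eq
... | q≤p , s≤s p≤q = ℕ.≤-antisym q≤p p≤q

action-dec : ∀ {x y} → action x y ≡ dec → x ≡ true
action-dec {true}  {false} _ = refl
action-dec {false} {true}  ()
action-dec {false} {false} ()

solve-left : ∀ {v x y} → v + x ≡ y → ∀ {r} → r + x ≡ y → v ≡ r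
solve-left {v} {x} p {r} q = ℕ.+-cancelʳ-≡ x v r (trans p (sym q))

-- The shape of the counters between stages: yard 0 stores the length `M` of the coming passes,
-- which is also the bound of the complements.
record Settled {B K} (M : ℕ) (v : Ctr B K → ℕ) : Set where
  field
    yard-zero : v (yard zero) ≡ M
    yard-suc  : ∀ q → v (yard (suc q)) ≡ 0
    coreg-sum : ∀ j → v (coreg j) + v (reg j) ≡ M
    cobuf-sum : v cobuf + v buf ≡ M

-- Counter values during one stage

module StageFacts (B K N D : ℕ) (1≤N : 1 ≤ N) (D+2≤B : 2 + D ≤ B) where
  open Gain N
  open Stage B K
  open Balance N

  private
    1≤B : 1 ≤ B
    1≤B = ℕ.≤-trans (s≤s z≤n) D+2≤B

  -- What surviving pass 0 proves: that the tested register was zero, or that `SNAP` has moved the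
  -- whole buffer.
  Checked : Op K → (Ctr B K → ℕ) → ℕ → Set
  Checked (INC _)  v₀ a = ⊤
  Checked (DEC _)  v₀ a = ⊤
  Checked (ZERO i) v₀ a = v₀ (reg i) ≡ 0
  Checked SNAP     v₀ a = a ≡ v₀ buf

  -- Time within a pass is measured by the `r` ticks still due, as this is what the yard contains.
  -- Zero ticks due in one pass and `N` due in the next are the same moment (`tick-next`).
  tick : ℕ → ℕ → ℕ
  tick p r = p * N + (N ∸ r)

  tick-≥ : ∀ p r → p * N ≤ tick p r
  tick-≥ p r = ℕ.m≤m+n (p * N) _

  tick-≤ : ∀ p r → tick p r ≤ suc p * N
  tick-≤ p r = ℕ.≤-trans (ℕ.+-monoʳ-≤ (p * N) (ℕ.m∸n≤m N r)) (ℕ.≤-reflexive (ℕ.+-comm (p * N) N))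

  tick-< : ∀ p {r} → suc r ≤ N → tick p (suc r) < suc p * N
  tick-< p {r} r<N = ℕ.<-≤-trans (ℕ.+-monoʳ-< (p * N) (ℕ.∸-monoʳ-< {N} (s≤s z≤n) r<N))
    (ℕ.≤-reflexive (ℕ.+-comm (p * N) N))

  tick-suc : ∀ p {r} → suc r ≤ N → tick p r ≡ suc (tick p (suc r))
  tick-suc p {r} r<N = trans (cong (p * N +_) (ℕ.+-∸-assoc 1 r<N)) (ℕ.+-suc (p * N) _)

  tick-next : ∀ p → tick (suc p) N ≡ tick p 0
  tick-next p = trans (cong (suc p * N +_) (ℕ.n∸n≡0 N)) (trans (ℕ.+-identityʳ _) (ℕ.+-comm N (p * N)))

  tick01 : ∀ {k} → k ≤ N → gain 0 1 k ≡ k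
  tick01 {k} k≤N = trans (sym (ℕ.+-identityʳ _)) (gain-during 0 1 z≤n (subst (k ≤_) (sym (ℕ.+-identityʳ N)) k≤N))

  before1 : ∀ hi {k} → k ≤ N → gain 1 hi k ≡ 0
  before1 hi {k} k≤N = gain-before 1 hi (subst (k ≤_) (sym (ℕ.+-identityʳ N)) k≤N)

  +0 : ∀ {x y z} → x ≡ y + z → z ≡ 0 → x ≡ y
  +0 {y = y} eq refl = trans eq (ℕ.+-identityʳ y)

  squeeze : ∀ {a b x y} → a ≤ x → b ≤ y → a + b ≡ y + x → a ≡ x
  squeeze {a} {b} {x} {y} a≤x b≤y eq = ℕ.≤-antisym a≤x (ℕ.≮⇒≥ λ a<x →
    ℕ.<-irrefl (trans eq (ℕ.+-comm y x)) (ℕ.+-mono-<-≤ a<x b≤y))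

  balanced-start : ∀ op {v₀ v} → (∀ c → v c ≡ v₀ c) → Balanced op D v₀ (tick 0 N) 0 0 v
  balanced-start op {v₀} same c rewrite ℕ.n∸n≡0 N = cong₂ _+_ (same c) (trans (no-debit op c) (sym (no-credit op c)))
    where
    gain0 : ∀ lo hi → gain lo hi 0 ≡ 0
    gain0 lo hi = gain-before lo hi z≤n
    if0 : ∀ b {x} → x ≡ 0 → (if b then x else 0) ≡ 0
    if0 true  eq = eq
    if0 false eq = refl
    no-debit : ∀ op c → debit op D 0 0 0 c ≡ 0
    no-debit op       (yard q)  = gain0 (toℕ q) (suc (toℕ q))
    no-debit op       (reg j)   = refl
    no-debit (INC _)  (coreg j) = refl
    no-debit (DEC _)  (coreg j) = refl
    no-debit (ZERO i) (coreg j) = if0 (does (i Fin.≟ j)) (gain0 0 1)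
    no-debit SNAP     (coreg j) = if0 (does (0F Fin.≟ j)) refl
    no-debit (INC _)  buf       = refl
    no-debit (DEC _)  buf       = refl
    no-debit (ZERO _) buf       = refl
    no-debit SNAP     buf       = refl
    no-debit (INC _)  cobuf     = refl
    no-debit (DEC _)  cobuf     = refl
    no-debit (ZERO _) cobuf     = refl
    no-debit SNAP     cobuf     = refl
    no-credit : ∀ op c → credit op D 0 0 0 c ≡ 0
    no-credit op       (yard zero)    = gain0 1 (suc B)
    no-credit op       (yard (suc q)) = gain0 (toℕ q) (suc (toℕ q))
    no-credit (INC _)  (reg j)        = refl
    no-credit (DEC _)  (reg j)        = refl
    no-credit (ZERO _) (reg j)        = refl
    no-credit SNAP     (reg j)        = if0 (does (0F Fin.≟ j)) refl
    no-credit op       (coreg j)      = gain0 1 (coregEnd op j)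
    no-credit op       buf            = gain0 1 (suc D)
    no-credit op       cobuf          = gain0 (suc D) (cobufEnd op)

  sum-start : 0 + 0 ≡ gain 0 1 (tick 0 N)
  sum-start rewrite ℕ.n∸n≡0 N = refl

  module _ {op : Op K} {v₀ v : Ctr B K → ℕ} (settled : Settled N v₀) where
    open Settled settled

    -- The measuring device for passes. Yard 0 begins with `N` units; any other yard has received
    -- exactly `N` during the preceding pass and loses them in its own.
    yard-left : ∀ (p : Fin (suc B)) {r a b} → r ≤ N →
                Balanced op D v₀ (tick (toℕ p) r) a b v → v (yard p) ≡ r
    yard-left zero {r} r≤N bal = solve-left
      (subst₂ (λ x y → v (yard zero) + x ≡ y)
        (trans (sym (ℕ.+-identityʳ _)) (gain-during 0 1 z≤n (tick-≤ 0 r)))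
        (trans (cong₂ _+_ yard-zero (gain-before 1 (suc B) (tick-≤ 0 r))) (ℕ.+-identityʳ N))
        (bal (yard zero)))
      (ℕ.m+[n∸m]≡n r≤N)
    yard-left (suc q) {r} r≤N bal = solve-left
      (subst₂ (λ x y → v (yard (suc q)) + x ≡ y)
        (ℕ.+-cancelʳ-≡ (suc p * N) _ _ (trans (gain-during (suc p) (2 + p) (tick-≥ (suc p) r) (tick-≤ (suc p) r))
          (ℕ.+-comm (suc p * N) (N ∸ r))))
        (trans (cong₂ _+_ (yard-suc q) (ℕ.+-cancelʳ-≡ (p * N) _ _ (gain-after p (suc p) (ℕ.n≤1+n p) (tick-≥ (suc p) r)))) refl)
        (bal (yard (suc q))))
      (ℕ.m+[n∸m]≡n r≤N)
      where p = toℕ q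

  if-true : ∀ {A : Set} {b} {x y : A} → b ≡ true → (if b then x else y) ≡ x
  if-true refl = refl

  i≟i : ∀ {m} (i : Fin m) → does (i Fin.≟ i) ≡ true
  i≟i i = dec-true (i Fin.≟ i) refl

  module _ {v₀ v : Ctr B K → ℕ} (settled : Settled N v₀) where
    open Settled settled

    pass₀-coreg : ∀ op {k a b} j → k ≤ N → Balanced op D v₀ k a b v →
                  v (coreg j) + debit op D k a b (coreg j) ≡ v₀ (coreg j)
    pass₀-coreg op j k≤N bal = +0 (bal (coreg j)) (before1 (coregEnd op j) k≤N)

    pass₀-buf : ∀ op {k a b} → k ≤ N → Balanced op D v₀ k a b v → v buf + debit op D k a b buf ≡ v₀ buf
    pass₀-buf op k≤N bal = +0 (bal buf) (before1 (suc D) k≤N)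

    pass₀-cobuf : ∀ op {k a b} → k ≤ N → Balanced op D v₀ k a b v → v cobuf + debit op D k a b cobuf ≡ v₀ cobuf
    pass₀-cobuf op {k} k≤N bal = +0 (bal cobuf)
      (gain-before (suc D) (cobufEnd op) (ℕ.≤-trans k≤N (ℕ.m≤m+n N (D * N))))

    -- For `ZERO i`, pass 0 takes `N` units from `coreg i`, and as `coreg i + reg i = N` nothing is
    -- left for `reg i`. For `SNAP`, at most `buf` ticks take the first alternative and at most
    -- `cobuf` the second; since `buf + cobuf = N` both bounds are attained.
    check : ∀ op {k a b} → k ≡ N → a + b ≡ gain 0 1 k → Balanced op D v₀ k a b v → Checked op v₀ a
    check (INC _)  _ _ _ = tt
    check (DEC _)  _ _ _ = tt
    check (ZERO i) {k} {a} {b} refl sum bal = ℕ.n≤0⇒n≡0 (ℕ.+-cancelˡ-≤ N _ _ (subst (N + v₀ (reg i) ≤_) (sym (ℕ.+-identityʳ N))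
        (subst (N + v₀ (reg i) ≤_) (coreg-sum i) (ℕ.+-monoˡ-≤ (v₀ (reg i)) N≤coreg))))
      where
      N≤coreg : N ≤ v₀ (coreg i)
      N≤coreg = subst (N ≤_) (pass₀-coreg (ZERO i) i ℕ.≤-refl bal)
        (subst (_≤ v (coreg i) + debit (ZERO i) D k a b (coreg i)) (trans (if-true {x = gain 0 1 k} {0} (i≟i i)) (tick01 ℕ.≤-refl)) (ℕ.m≤n+m _ (v (coreg i))))
    check SNAP refl sum bal = squeeze
      (subst (_ ≤_) (pass₀-buf SNAP ℕ.≤-refl bal) (ℕ.m≤n+m _ (v buf)))
      (subst (_ ≤_) (pass₀-cobuf SNAP ℕ.≤-refl bal) (ℕ.m≤n+m _ (v cobuf)))
      (trans sum (trans (tick01 ℕ.≤-refl) (sym cobuf-sum)))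

  module Complete {v₀ : Ctr B K → ℕ} (settled : Settled N v₀) where
    open Settled settled

    end : ℕ
    end = suc B * N

    gain-end : ∀ lo hi {g} → lo ≤ hi → hi ≤ suc B → g + lo * N ≡ hi * N → gain lo hi end ≡ g
    gain-end lo hi {g} lo≤hi hi≤ eq = ℕ.+-cancelʳ-≡ (lo * N) _ g
      (trans (gain-after lo hi lo≤hi (ℕ.*-monoˡ-≤ N hi≤)) (sym eq))

    first-end : gain 0 1 end ≡ N
    first-end = gain-end 0 1 z≤n (s≤s z≤n) refl

    middle-end : gain 1 B end + N ≡ B * N
    middle-end = subst (λ x → gain 1 B end + x ≡ B * N) (ℕ.+-identityʳ N)
      (gain-after 1 B 1≤B (ℕ.*-monoˡ-≤ N (ℕ.n≤1+n B)))

    unit-end : ∀ (q : Fin (suc B)) → gain (toℕ q) (suc (toℕ q)) end ≡ N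
    unit-end q = gain-end (toℕ q) _ (ℕ.n≤1+n _) (Fin.toℕ<n q) refl

    tail-end : gain 1 (suc B) end ≡ B * N
    tail-end = gain-end 1 (suc B) (s≤s z≤n) ℕ.≤-refl (trans (cong (B * N +_) (ℕ.+-identityʳ N)) (ℕ.+-comm (B * N) N))

    buf-end : gain 1 (suc D) end ≡ D * N
    buf-end = gain-end 1 (suc D) (s≤s z≤n) (s≤s (ℕ.≤-trans (ℕ.m≤n+m D 2) D+2≤B))
      (trans (cong (D * N +_) (ℕ.+-identityʳ N)) (ℕ.+-comm (D * N) N))

    rearrange : ∀ {w r w₀ r₀ g} → w ≡ w₀ + g → r ≡ r₀ → w₀ + r₀ ≡ N → g + N ≡ B * N → w + r ≡ B * N
    rearrange {w₀ = w₀} {r₀} {g} refl refl p q = trans (lemma w₀ r₀ g) (trans (cong (g +_) p) q)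
      where
      lemma : ∀ x y z → x + z + y ≡ z + (x + y)
      lemma = solve-∀

    rearrange-zero : ∀ {w r w₀ r₀} → w + N ≡ w₀ + B * N → r ≡ r₀ → w₀ + r₀ ≡ N → w + r ≡ B * N
    rearrange-zero {w} {r} {w₀} p refl q = ℕ.+-cancelʳ-≡ N _ _ (trans (lemma₁ w r N)
        (trans (cong (_+ r) p) (trans (lemma₂ w₀ r (B * N)) (trans (cong (B * N +_) q) refl))))
      where
      lemma₁ : ∀ x y z → x + y + z ≡ x + z + y
      lemma₁ = solve-∀
      lemma₂ : ∀ x y z → x + z + y ≡ z + (x + y)
      lemma₂ = solve-∀

    rearrange-snap : ∀ {w r w₀ r₀ a g} → w + a ≡ w₀ + g → r ≡ r₀ + a → w₀ + r₀ ≡ N → g + N ≡ B * N → w + r ≡ B * N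
    rearrange-snap {w} {w₀ = w₀} {r₀} {a} {g} p refl q g≡ = trans (lemma₁ w r₀ a)
        (trans (cong (_+ r₀) p) (trans (lemma₂ w₀ r₀ g) (trans (cong (g +_) q) g≡)))
      where
      lemma₁ : ∀ x y z → x + (y + z) ≡ x + z + y
      lemma₁ = solve-∀
      lemma₂ : ∀ x y z → x + z + y ≡ z + (x + y)
      lemma₂ = solve-∀

    drop0 : ∀ {x y} → x + 0 ≡ y → x ≡ y
    drop0 {x} eq = trans (sym (ℕ.+-identityʳ x)) eq

    -- The registers between the last tick and the end of the stage: `INC` and `DEC` change them
    -- only by the final letter of the last pass, whereas `SNAP` has already acted in pass 0.
    regMid : Op K → Fin (suc K) → ℕ
    regMid SNAP     j = regAfter SNAP (v₀ ∘ reg) (v₀ buf) j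
    regMid (INC _)  j = v₀ (reg j)
    regMid (DEC _)  j = v₀ (reg j)
    regMid (ZERO _) j = v₀ (reg j)

    module _ (op : Op K) {a b : ℕ} {w : Ctr B K → ℕ} (bal : Balanced op D v₀ end a b w) where

      reg-mid : Checked op v₀ a → ∀ j → w (reg j) ≡ regMid op j
      reg-mid = go op bal
        where
        go : ∀ op → Balanced op D v₀ end a b w → Checked op v₀ a → ∀ j → w (reg j) ≡ regMid op j
        go (INC _)  bal _ j = trans (drop0 (bal (reg j))) (ℕ.+-identityʳ _)
        go (DEC _)  bal _ j = trans (drop0 (bal (reg j))) (ℕ.+-identityʳ _)
        go (ZERO _) bal _ j = trans (drop0 (bal (reg j))) (ℕ.+-identityʳ _)
        go SNAP     bal a≡ j with does (0F Fin.≟ j) | drop0 (bal (reg j))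
        ... | true  | eq = trans eq (cong (v₀ (reg j) +_) a≡)
        ... | false | eq = trans eq (ℕ.+-identityʳ _)

      coreg-mid : ∀ j → w (coreg j) + w (reg j) ≡ B * N
      coreg-mid j = go op (bal (coreg j)) (bal (reg j))
        where
        plain : ∀ {x} → w (coreg j) + 0 ≡ v₀ (coreg j) + x → w (reg j) + 0 ≡ v₀ (reg j) + 0 → x + N ≡ B * N →
                w (coreg j) + w (reg j) ≡ B * N
        plain p q r = rearrange (drop0 p) (trans (drop0 q) (ℕ.+-identityʳ _)) (coreg-sum j) r
        go : ∀ op → w (coreg j) + debit op D end a b (coreg j) ≡ v₀ (coreg j) + credit op D end a b (coreg j) →
             w (reg j) + 0 ≡ v₀ (reg j) + credit op D end a b (reg j) → w (coreg j) + w (reg j) ≡ B * N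
        go (INC _)  p q = plain p q middle-end
        go (DEC _)  p q = plain p q middle-end
        go (ZERO i) p q with does (i Fin.≟ j)
        ... | true  = rearrange-zero (subst₂ (λ x y → w (coreg j) + x ≡ v₀ (coreg j) + y) first-end tail-end p)
                        (trans (drop0 q) (ℕ.+-identityʳ _)) (coreg-sum j)
        ... | false = plain p q middle-end
        go SNAP     p q with does (0F Fin.≟ j)
        ... | true  = rearrange-snap p (drop0 q) (coreg-sum j) middle-end
        ... | false = plain p q middle-end

      buf-mid : Checked op v₀ a → w buf ≡ bufAfter op (v₀ buf) + D * N
      buf-mid ok = go op ok (subst (λ x → w buf + debit op D end a b buf ≡ v₀ buf + x) buf-end (bal buf))
        where
        go : ∀ op → Checked op v₀ a → w buf + debit op D end a b buf ≡ v₀ buf + D * N → w buf ≡ bufAfter op (v₀ buf) + D * N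
        go (INC _)  _ eq = drop0 eq
        go (DEC _)  _ eq = drop0 eq
        go (ZERO _) _ eq = drop0 eq
        go SNAP     refl eq = ℕ.+-cancelʳ-≡ (v₀ buf) _ _ (trans eq (ℕ.+-comm (v₀ buf) _))

      cobuf-mid : Checked op v₀ a → a + b ≡ gain 0 1 end → w cobuf + w buf ≡ B * N
      cobuf-mid ok sum = go op ok (bal cobuf) (buf-mid ok)
        where
        plain : w cobuf + 0 ≡ v₀ cobuf + gain (suc D) B end → w buf ≡ v₀ buf + D * N → w cobuf + w buf ≡ B * N
        plain p q = trans (cong₂ _+_ (drop0 p) q) (trans (lemma (v₀ cobuf) _ (v₀ buf) (D * N))
          (trans (cong (λ x → gain (suc D) B end + (x + D * N)) cobuf-sum)
            (gain-after (suc D) B (ℕ.≤-trans (ℕ.n≤1+n _) D+2≤B) (ℕ.*-monoˡ-≤ N (ℕ.n≤1+n B)))))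
          where
          lemma : ∀ x g y d → x + g + (y + d) ≡ g + (x + y + d)
          lemma = solve-∀
        go : ∀ op → Checked op v₀ a → w cobuf + debit op D end a b cobuf ≡ v₀ cobuf + credit op D end a b cobuf →
             w buf ≡ bufAfter op (v₀ buf) + D * N → w cobuf + w buf ≡ B * N
        go (INC _)  _ p q = plain p q
        go (DEC _)  _ p q = plain p q
        go (ZERO _) _ p q = plain p q
        go SNAP refl p q = ℕ.+-cancelʳ-≡ N _ _ (trans (cong (_+ N) (cong₂ _+_ w≡ q))
            (trans (lemma (gain (suc D) (suc B) end) (D * N) N)
              (trans (gain-after (suc D) (suc B) (s≤s (ℕ.≤-trans (ℕ.m≤n+m D 2) D+2≤B)) ℕ.≤-refl) (ℕ.+-comm N (B * N)))))
          where
          b≡ : b ≡ v₀ cobuf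
          b≡ = ℕ.+-cancelˡ-≡ (v₀ buf) _ _ (trans sum (trans first-end (trans (sym cobuf-sum) (ℕ.+-comm (v₀ cobuf) _))))
          w≡ : w cobuf ≡ gain (suc D) (suc B) end
          w≡ = ℕ.+-cancelʳ-≡ b _ _ (trans p (trans (cong (_+ gain (suc D) (suc B) end) (sym b≡)) (ℕ.+-comm b _)))
          lemma : ∀ g d m → g + d + m ≡ g + (m + d)
          lemma = solve-∀

      settled-mid : Checked op v₀ a → a + b ≡ gain 0 1 end → Settled (B * N) w
      settled-mid ok sum = record
        { yard-zero = solve-left (subst₂ (λ x y → w (yard zero) + x ≡ y) first-end
                        (cong₂ _+_ yard-zero tail-end) (bal (yard zero))) (ℕ.+-comm (B * N) N)
        ; yard-suc  = λ q → solve-left (subst₂ (λ x y → w (yard (suc q)) + x ≡ y) (unit-end (suc q))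
                        (cong₂ _+_ (yard-suc q) (trans (cong (λ p → gain p (suc p) end) (sym (Fin.toℕ-inject₁ q))) (unit-end (Fin.inject₁ q))))
                        (bal (yard (suc q)))) refl
        ; coreg-sum = coreg-mid
        ; cobuf-sum = cobuf-mid ok sum
        }

-- Outcome and feasibility of one stage

module StageStep (B K N D : ℕ) (1≤N : 1 ≤ N) (D+2≤B : 2 + D ≤ B) where
  open Gain N
  open Stage B K
  open Balance N
  open StageFacts B K N D 1≤N D+2≤B

  record Finished (op : Op K) (v₀ v : Ctr B K → ℕ) : Set where
    field
      enabled  : OpEnabled op (v₀ ∘ reg)
      settled⁺ : Settled (B * N) v
      reg⁺     : ∀ j → v (reg j) ≡ regAfter op (v₀ ∘ reg) (v₀ buf) j
      buf⁺     : v buf ≡ bufAfter op (v₀ buf) + D * N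

  module _ {w v : Ctr B K → ℕ} where

    end-static : ∀ op → (∀ c → Applies (endAction op c) (w c) (v c)) →
                 (∀ q → v (yard q) ≡ w (yard q)) × v buf ≡ w buf × v cobuf ≡ w cobuf
    end-static (INC _)  app = app ∘ yard , app buf , app cobuf
    end-static (DEC _)  app = app ∘ yard , app buf , app cobuf
    end-static (ZERO _) app = app ∘ yard , app buf , app cobuf
    end-static SNAP     app = app ∘ yard , app buf , app cobuf

    end-total : ∀ op → (∀ c → Applies (endAction op c) (w c) (v c)) →
                ∀ j → v (coreg j) + v (reg j) ≡ w (coreg j) + w (reg j)
    end-total (INC i) app j with does (i Fin.≟ j) | app (coreg j) | app (reg j)
    ... | true  | p | q rewrite q | sym p = ℕ.+-suc _ _
    ... | false | p | q = cong₂ _+_ p q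
    end-total (DEC i) app j with does (i Fin.≟ j) | app (coreg j) | app (reg j)
    ... | true  | p | q rewrite p | sym q = sym (ℕ.+-suc _ _)
    ... | false | p | q = cong₂ _+_ p q
    end-total (ZERO i) app j = cong₂ _+_ (app (coreg j)) (app (reg j))
    end-total SNAP     app j = cong₂ _+_ (app (coreg j)) (app (reg j))

    end-settled : ∀ op {M} → (∀ c → Applies (endAction op c) (w c) (v c)) → Settled M w → Settled M v
    end-settled op app st with end-static op app
    ... | y , b , cb = record
      { yard-zero = trans (y zero) yard-zero
      ; yard-suc  = λ q → trans (y (suc q)) (yard-suc q)
      ; coreg-sum = λ j → trans (end-total op app j) (coreg-sum j)
      ; cobuf-sum = trans (cong₂ _+_ cb b) cobuf-sum
      }
      where open Settled st

  module _ {v₀ : Ctr B K → ℕ} (settled : Settled N v₀) where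
    open Settled settled
    open Complete settled

    finish : ∀ op {a b w v} → Checked op v₀ a → a + b ≡ gain 0 1 end → Balanced op D v₀ end a b w →
             (∀ c → Applies (endAction op c) (w c) (v c)) → Finished op v₀ v
    finish op {a} {b} {w} {v} ok sum bal app = record
      { enabled  = enabled op {a} ok (reg-mid op {a} {b} bal ok) app
      ; settled⁺ = end-settled op app (settled-mid op {a} {b} bal ok sum)
      ; reg⁺     = regs op (reg-mid op {a} {b} bal ok) app
      ; buf⁺     = trans (proj₁ (proj₂ (end-static op app))) (buf-mid op {a} {b} bal ok)
      }
      where
      enabled : ∀ op {a} → Checked op v₀ a → (∀ j → w (reg j) ≡ regMid op j) →
                (∀ c → Applies (endAction op c) (w c) (v c)) → OpEnabled op (v₀ ∘ reg)
      enabled (INC i)  ok mid app = tt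
      enabled (DEC i)  ok mid app z with does (i Fin.≟ i) | i≟i i | app (reg i)
      ... | true | _ | q = contradiction (trans q (trans (mid i) z)) λ ()
      enabled (ZERO i) ok mid app = ok
      enabled SNAP     ok mid app = tt
      regs : ∀ op → (∀ j → w (reg j) ≡ regMid op j) →
             (∀ c → Applies (endAction op c) (w c) (v c)) → ∀ j → v (reg j) ≡ regAfter op (v₀ ∘ reg) (v₀ buf) j
      regs (INC i)  mid app j with does (i Fin.≟ j) | app (reg j)
      ... | true  | q = trans q (cong suc (mid j))
      ... | false | q = trans q (mid j)
      regs (DEC i)  mid app j with does (i Fin.≟ j) | app (reg j)
      ... | true  | q = cong pred (trans q (mid j))
      ... | false | q = trans q (mid j)
      regs (ZERO i) mid app j = trans (app (reg j)) (mid j)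
      regs SNAP     mid app j = trans (app (reg j)) (mid j)

    -- The sum is bounded, and not just its parts, because `SNAP` adds the buffer to register 0 and
    -- takes as much from `coreg 0`.
    Bounded : Set
    Bounded = ∀ j → v₀ (reg j) + v₀ buf ≤ N

    positive : ∀ {v x y} → v + x ≡ y → x < y → v ≢ 0
    positive refl x<x refl = ℕ.<-irrefl refl x<x

    -- The strategy for `SNAP`: first empty `buf`, then spend the remaining ticks on `cobuf`.
    choose : ℕ → Bool
    choose a = does (a ℕ.<? v₀ buf)

    chosen-≤ : ∀ p a → a ≤ v₀ buf → chosen⁺ p (choose a) a ≤ v₀ buf
    chosen-≤ p a a≤ with choose a in eq
    ... | true  = ℕ.≤-trans (ℕ.+-monoʳ-≤ a (ind≤1 (inside 0 1 p ∧ true)))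
                    (subst (_≤ v₀ buf) (ℕ.+-comm 1 a) (does⇒ (a ℕ.<? v₀ buf) eq))
      where
      ind≤1 : ∀ b → indicator b ≤ 1
      ind≤1 true  = ℕ.≤-refl
      ind≤1 false = z≤n
    ... | false = subst (_≤ v₀ buf) (sym (trans (cong (λ b → a + indicator b) (Bool.∧-zeroʳ (inside 0 1 p))) (ℕ.+-identityʳ a))) a≤

    feasible : ∀ op (p : Fin (suc B)) {r a b v} → suc r ≤ N → Bounded → OpEnabled op (v₀ ∘ reg) → a ≤ v₀ buf →
               a + b ≡ gain 0 1 (tick (toℕ p) (suc r)) →
               Balanced op D v₀ (tick (toℕ p) (suc r)) a b v →
               ∀ c → passAction op D (toℕ p) (choose a) c ≡ dec → v c ≢ 0
    feasible op p {r} {a} {b} {v} r<N bounded enabled a≤ sum bal c isdec =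
      go op c (action-dec {decᴾ op D (toℕ p) (choose a) c} isdec) enabled bal
      where
      k = tick (toℕ p) (suc r)
      in-pass₀ : inside 0 1 (toℕ p) ≡ true → toℕ p ≡ 0
      in-pass₀ eq = sym (inside-unit eq)
      k<N : toℕ p ≡ 0 → k < N
      k<N eq = subst (λ q → tick q (suc r) < N) (sym eq) (subst (tick 0 (suc r) <_) (ℕ.+-identityʳ N) (tick-< 0 r<N))
      coreg≥ : ∀ j → v₀ buf ≤ v₀ (coreg j)
      coreg≥ j = ℕ.+-cancelʳ-≤ (v₀ (reg j)) _ _
        (subst₂ _≤_ (ℕ.+-comm (v₀ (reg j)) _) (sym (coreg-sum j)) (bounded j))
      go : ∀ op c → decᴾ op D (toℕ p) (choose a) c ≡ true → OpEnabled op (v₀ ∘ reg) →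
           Balanced op D v₀ k a b v → v c ≢ 0
      go op (yard q) eq en bal z = contradiction
          (trans (sym (yard-left {op} settled p r<N bal)) (trans (cong (v ∘ yard) (sym (Fin.toℕ-injective (inside-unit eq)))) z)) λ ()
      go (ZERO i) (coreg j) eq en bal with T-∧ {does (i Fin.≟ j)} eq
      ... | i≡j , in₀ with does⇒ (i Fin.≟ j) i≡j
      ... | refl = positive (pass₀-coreg settled (ZERO i) i (ℕ.<⇒≤ (k<N (in-pass₀ in₀))) bal)
        (subst₂ _<_ (sym (trans (if-true {x = gain 0 1 k} {0} (i≟i i)) (tick01 (ℕ.<⇒≤ (k<N (in-pass₀ in₀))))))
          (trans (sym (coreg-sum i)) (trans (cong (v₀ (coreg i) +_) en) (ℕ.+-identityʳ _))) (k<N (in-pass₀ in₀)))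
      go SNAP (coreg j) eq en bal with T-∧ {does (0F Fin.≟ j)} eq
      ... | 0≡j , eq′ with T-∧ {inside 0 1 (toℕ p)} eq′
      ... | in₀ , a< = positive (pass₀-coreg settled SNAP j (ℕ.<⇒≤ (k<N (in-pass₀ in₀))) bal)
        (subst (_< v₀ (coreg j)) (sym (if-true {x = a} {0} 0≡j)) (ℕ.<-≤-trans (does⇒ (a ℕ.<? v₀ buf) a<) (coreg≥ j)))
      go SNAP buf eq en bal with T-∧ {inside 0 1 (toℕ p)} eq
      ... | in₀ , a< = positive (pass₀-buf settled SNAP (ℕ.<⇒≤ (k<N (in-pass₀ in₀))) bal) (does⇒ (a ℕ.<? v₀ buf) a<)
      go SNAP cobuf eq en bal with T-∧ {inside 0 1 (toℕ p)} eq
      ... | in₀ , ¬a< = positive (pass₀-cobuf settled SNAP (ℕ.<⇒≤ (k<N (in-pass₀ in₀))) bal) b<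
        where
        a≡ : a ≡ v₀ buf
        a≡ = ℕ.≤-antisym a≤ (ℕ.≮⇒≥ λ lt → contradiction
          (trans (sym ¬a<) (cong not (dec-true (a ℕ.<? v₀ buf) lt))) λ ())
        b< : b < v₀ cobuf
        b< = ℕ.+-cancelˡ-< (v₀ buf) b (v₀ cobuf) (subst₂ _<_
          (trans (sym (trans sum (tick01 (ℕ.<⇒≤ (k<N (in-pass₀ in₀)))))) (cong (_+ b) a≡))
          (trans (sym cobuf-sum) (ℕ.+-comm (v₀ cobuf) _)) (k<N (in-pass₀ in₀)))

    end-feasible : ∀ op {a b w} → Bounded → OpEnabled op (v₀ ∘ reg) → Checked op v₀ a →
                   Balanced op D v₀ end a b w → ∀ c → endAction op c ≡ dec → w c ≢ 0
    end-feasible op {a} {b} {w} bounded en ok bal c isdec = go op c (action-dec {decᴱ op c} isdec) en (coreg-mid op {a} {b} bal) (reg-mid op {a} {b} bal ok)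
      where
      go : ∀ op c → decᴱ op c ≡ true → OpEnabled op (v₀ ∘ reg) → (∀ j → w (coreg j) + w (reg j) ≡ B * N) →
           (∀ j → w (reg j) ≡ regMid op j) → w c ≢ 0
      -- By now the bound has grown to `B * N`, at least twice `N`, while the register is at most
      -- `N`; so its complement has a unit to give.
      go (INC i) (coreg j) _ en total mid = positive (total j)
        (subst (_< B * N) (sym (mid j)) (ℕ.≤-<-trans (ℕ.≤-trans (ℕ.m≤m+n _ (v₀ buf)) (bounded j))
          (ℕ.<-≤-trans (ℕ.m<m+n N {N + 0} (subst (1 ≤_) (sym (ℕ.+-identityʳ N)) 1≤N))
            (ℕ.*-monoˡ-≤ N (ℕ.≤-trans (s≤s (s≤s z≤n)) D+2≤B)))))
      go (DEC i) (reg j) eq en total mid z with does⇒ (i Fin.≟ j) eq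
      ... | refl = en (trans (sym (mid i)) z)

    -- This dictates the size of `B`: an operation adds at most 1 and the digit adds `D * N`, and
    -- `N + 1 + D * N` is at most `(2 + D) * N` because `N` is positive.
    bounded⁺ : ∀ op → Bounded → ∀ j →
               regAfter op (v₀ ∘ reg) (v₀ buf) j + (bufAfter op (v₀ buf) + D * N) ≤ B * N
    bounded⁺ op bounded j = ℕ.≤-trans (go op) (ℕ.≤-trans grow (ℕ.*-monoˡ-≤ N D+2≤B))
      where
      grow : suc N + D * N ≤ (2 + D) * N
      grow = subst (suc N + D * N ≤_) (ℕ.+-assoc N N (D * N)) (ℕ.+-monoˡ-≤ (D * N) (ℕ.+-monoˡ-≤ N 1≤N))
      weaken : ∀ x y → x + y ≤ N → x + (y + D * N) ≤ suc N + D * N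
      weaken x y le = subst (_≤ suc N + D * N) (ℕ.+-assoc x y _) (ℕ.+-monoˡ-≤ (D * N) (ℕ.m≤n⇒m≤1+n le))
      go : ∀ op → regAfter op (v₀ ∘ reg) (v₀ buf) j + (bufAfter op (v₀ buf) + D * N) ≤ suc N + D * N
      go (INC i) with does (i Fin.≟ j)
      ... | true  = s≤s (subst (_≤ N + D * N) (ℕ.+-assoc (v₀ (reg j)) (v₀ buf) (D * N)) (ℕ.+-monoˡ-≤ (D * N) (bounded j)))
      ... | false = weaken (v₀ (reg j)) (v₀ buf) (bounded j)
      go (DEC i) with does (i Fin.≟ j)
      ... | true  = weaken (pred (v₀ (reg j))) (v₀ buf)
                      (ℕ.≤-trans (ℕ.+-monoˡ-≤ (v₀ buf) (ℕ.pred[n]≤n {v₀ (reg j)})) (bounded j))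
      ... | false = weaken (v₀ (reg j)) (v₀ buf) (bounded j)
      go (ZERO i) = weaken (v₀ (reg j)) (v₀ buf) (bounded j)
      go SNAP with does (0F Fin.≟ j)
      ... | true  = weaken (v₀ (reg j) + v₀ buf) 0 (subst (_≤ N) (sym (ℕ.+-identityʳ _)) (bounded j))
      ... | false = weaken (v₀ (reg j)) 0
                      (subst (_≤ N) (sym (ℕ.+-identityʳ _)) (ℕ.≤-trans (ℕ.m≤m+n _ (v₀ buf)) (bounded j)))

-- Coding a counter program in a net

-- In the alphabet of the coding, 0F is the tick, 1F ends a pass, and suc (suc a)
-- is the letter a. The coded words are
--   1F x₀ (0F^N₀ 1F)^(B+1) x₁ (0F^N₁ 1F)^(B+1) …   where N_t = B ^ t.

module Coding (n′ K : ℕ) (P : Program K) where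
  open Program P

  n γ B : ℕ
  n = suc n′
  γ = 2 + n
  -- A digit is a letter paired with a guessed bit, hence at most `n * 2`, and a stage needs a base
  -- exceeding its digit by two.
  B = n * 2 + 2

  open Stage B K

  B^ : ℕ → ℕ
  B^ t = B ^ t

  1≤B^ : ∀ t → 1 ≤ B^ t
  1≤B^ t = ℕ.m^n>0 B t

  record ProgramRun (d : ℕ → Fin (n * 2)) : Set where
    field
      location       : ℕ → Fin locations
      register       : ℕ → Fin (suc K) → ℕ
      buffer         : ℕ → ℕ
      location-start : location 0 ≡ entry
      register-start : ∀ j → register 0 j ≡ 0
      buffer-start   : buffer 0 ≡ 0
      operation      : ℕ → Op K
      edge           : ∀ t → (operation t , location (suc t)) ∈ edges (location t)
      enabled        : ∀ t → OpEnabled (operation t) (register t)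
      register-step  : ∀ t j → register (suc t) j ≡ regAfter (operation t) (register t) (buffer t) j
      buffer-step    : ∀ t → buffer (suc t) ≡ bufAfter (operation t) (buffer t) + suc (toℕ (d t)) * B^ t

  digits : ωWord n → ωWord 2 → ℕ → Fin (n * 2)
  digits σ τ t = Fin.combine (σ t) (τ t)

  ProgramLanguage : ωLang n
  ProgramLanguage σ = Σ[ τ ∈ ωWord 2 ] Σ[ R ∈ ProgramRun (digits σ τ) ]
    (∀ t → ∃[ t′ ] t ≤ t′ × ProgramRun.location R t′ ≡ goal)

  next-pass : ∀ {b} → Fin (suc b) → Maybe (Fin (suc b))
  next-pass {b} p with suc (toℕ p) ℕ.<? suc b
  ... | yes lt = just (fromℕ< lt)
  ... | no  _  = nothing

  next-pass-just : ∀ {b} (p : Fin (suc b)) {p′} → next-pass p ≡ just p′ → toℕ p′ ≡ suc (toℕ p)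
  next-pass-just {b} p eq with suc (toℕ p) ℕ.<? suc b
  next-pass-just {b} p refl | yes lt = Fin.toℕ-fromℕ< lt

  next-pass-nothing : ∀ {b} (p : Fin (suc b)) → next-pass p ≡ nothing → toℕ p ≡ b
  next-pass-nothing {b} p eq with suc (toℕ p) ℕ.<? suc b
  ... | no ≮ = ℕ.≤-antisym (ℕ.≤-pred (Fin.toℕ<n p)) (ℕ.≤-pred (ℕ.≮⇒≥ ≮))

  data Position : Set where
    begin  : Position
    letter : ℕ → Position
    body   : ℕ → Fin (suc B) → ℕ → Position

  end-pass : ℕ → Maybe (Fin (suc B)) → Position
  end-pass t (just p) = body t p (B^ t)
  end-pass t nothing  = letter (suc t)

  advance : Position → Position
  advance begin            = letter 0
  advance (letter t)       = body t 0F (B^ t)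
  advance (body t p (suc r)) = body t p r
  advance (body t p zero)  = end-pass t (next-pass p)

  -- The layout of a code depends on the time alone and not on the coded word. Fitting is thus a
  -- condition on single letters, and the range of the coding is closed.
  position : ℕ → Position
  position zero    = begin
  position (suc s) = advance (position s)

  fits : Position → Fin γ → Bool
  fits begin              1F            = true
  fits (letter t)         (suc (suc a)) = true
  fits (body t p (suc r)) 0F            = true
  fits (body t p zero)    1F            = true
  fits _                  _             = false

  expected : ωWord n → Position → Fin γ
  expected x begin              = 1F
  expected x (letter t)         = suc (suc (x t))
  expected x (body t p (suc r)) = 0F
  expected x (body t p zero)    = 1F

  decode : Fin γ → Fin n
  decode (suc (suc a)) = a
  decode _             = 0F

  code : ωWord n → ωWord γ
  code x s = expected x (position s)

  code-fits : ∀ x s → T (fits (position s) (code x s))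
  code-fits x s with position s
  ... | begin            = tt
  ... | letter t         = tt
  ... | body t p (suc r) = tt
  ... | body t p zero    = tt

  code-local : LocallyDetermined code
  code-local x s with position s
  ... | begin            = 0 , λ _ _ → refl
  ... | letter t         = suc t , λ x′ eq → cong (λ a → suc (suc a)) (↾-at x′ x (suc t) eq ℕ.≤-refl)
  ... | body t p (suc r) = 0 , λ _ _ → refl
  ... | body t p zero    = 0 , λ _ _ → refl

  private
    finish-ticks : ∀ r s {t p} → position s ≡ body t p r → ∃[ s′ ] position s′ ≡ body t p 0
    finish-ticks zero    s eq = s , eq
    finish-ticks (suc r) s eq = finish-ticks r (suc s) (cong advance eq)

    finish-passes : ∀ fuel s {t p r} → B ≤ fuel + toℕ p → position s ≡ body t p r → ∃[ s′ ] position s′ ≡ letter (suc t)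
    finish-passes fuel s {t} {p} {r} B≤ eq with finish-ticks r s eq
    ... | s₁ , eq₁ with next-pass p in np
    ... | nothing = suc s₁ , trans (cong advance eq₁) (cong (end-pass t) np)
    finish-passes zero s {p = p} B≤ eq | s₁ , eq₁ | just p′ =
      contradiction (ℕ.≤-trans (ℕ.≤-pred (subst (_< suc B) (next-pass-just p np) (Fin.toℕ<n p′))) B≤) (ℕ.<-irrefl refl)
    finish-passes (suc fuel) s {t} {p} B≤ eq | s₁ , eq₁ | just p′ =
      finish-passes fuel (suc s₁) (subst (B ≤_) (trans (sym (ℕ.+-suc fuel _)) (cong (fuel +_) (sym (next-pass-just p np)))) B≤)
        (trans (cong advance eq₁) (cong (end-pass t) np))

    letter-at : ∀ t → ∃[ s ] position s ≡ letter t
    letter-at zero    = 1 , refl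
    letter-at (suc t) with letter-at t
    ... | s , eq = finish-passes B (suc s) (ℕ.m≤m+n B _) (cong advance eq)

  abstract
    pos : ℕ → ℕ
    pos t = proj₁ (letter-at t)

    position-pos : ∀ t → position (pos t) ≡ letter t
    position-pos t = proj₂ (letter-at t)

  -- Monotone along `position` and raised just after a letter, so every letter has only one place
  -- (`pos-unique`).
  stage : Position → ℕ
  stage begin        = 0
  stage (letter t)   = t
  stage (body t _ _) = suc t

  stage-≤ : ∀ {s s′} → s ≤ s′ → stage (position s) ≤ stage (position s′)
  stage-≤ {s} {s′} s≤s′ with ℕ.m≤n⇒m<n∨m≡n s≤s′
  ... | inj₂ refl = ℕ.≤-refl
  stage-≤ {s} {suc s′} _ | inj₁ (s≤s s≤s′) = ℕ.≤-trans (stage-≤ s≤s′) (step (position s′))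
    where
    step : ∀ π → stage π ≤ stage (advance π)
    step begin            = z≤n
    step (letter t)       = ℕ.n≤1+n t
    step (body t p (suc r)) = ℕ.≤-refl
    step (body t p zero) with next-pass p
    ... | just _  = ℕ.≤-refl
    ... | nothing = ℕ.≤-refl

  letter-before : ∀ s s′ {t t′} → position s ≡ letter t → position s′ ≡ letter t′ → s < s′ → t < t′
  letter-before s s′ eq eq′ s<s′ =
    subst₂ _≤_ (cong (stage ∘ advance) eq) (cong stage eq′) (stage-≤ s<s′)

  pos-unique : ∀ s {t} → position s ≡ letter t → s ≡ pos t
  pos-unique s {t} eq with ℕ.<-cmp s (pos t)
  ... | tri< lt _ _ = contradiction (letter-before s (pos t) eq (position-pos t) lt) (ℕ.<-irrefl refl)
  ... | tri≈ _ eq′ _ = eq′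
  ... | tri> _ _ gt = contradiction (letter-before (pos t) s (position-pos t) eq gt) (ℕ.<-irrefl refl)

  decode-code : ∀ x t → decode (code x (pos t)) ≡ x t
  decode-code x t rewrite position-pos t = refl

  data Control : Set where
    init : Control
    at   : Fin locations → Control
    pass : Op K → Fin locations → Fin (n * 2) → Fin (suc B) → Control
    sink : Control

  Counters : Set
  Counters = Ctr B K

  -- Turns the empty counters into settled ones for passes of length `B ^ 0 = 1`.
  initAction : Counters → Action
  initAction (yard zero)    = inc
  initAction (yard (suc _)) = hold
  initAction (reg _)        = hold
  initAction (coreg _)      = inc
  initAction buf            = hold
  initAction cobuf          = inc

  sinkAction : Fin (suc B) → Counters → Action
  sinkAction p (yard q) = if does (q Fin.≟ p) then dec else hold
  sinkAction p _        = hold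

  rest : Counters → Action
  rest _ = hold

  digit : Fin (n * 2) → ℕ
  digit d = suc (toℕ d)

  branches : Fin n → Op K × Fin locations → List (Control × (Counters → Action))
  branches a (op , q) = (pass op q (Fin.combine a 0F) 0F , rest) ∷ (pass op q (Fin.combine a 1F) 0F , rest) ∷ []

  leave : Op K → Fin locations → Fin (n * 2) → Maybe (Fin (suc B)) → Control × (Counters → Action)
  leave op q d (just p) = pass op q d p , rest
  leave op q d nothing  = at q , endAction op

  -- A pass of N_t ticks drains the counter yard p, so a pass that is too long
  -- blocks the run, and one that is too short leaves yard p positive, which
  -- permits a move to the accepting sink.
  moves : Control → Fin γ → List (Control × (Counters → Action))
  moves init            1F            = (at entry , initAction) ∷ []
  moves init            _             = []
  moves (at q)          (suc (suc a)) = List.concatMap (branches a) (edges q)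
  moves (at q)          _             = []
  moves (pass op q d p) 0F            = (pass op q d p , passAction op (digit d) (toℕ p) true)
                                      ∷ (pass op q d p , passAction op (digit d) (toℕ p) false) ∷ []
  moves (pass op q d p) 1F            = leave op q d (next-pass p) ∷ (sink , sinkAction p) ∷ []
  moves (pass op q d p) (suc (suc _)) = []
  moves sink            _             = (sink , rest) ∷ []

  private
    finite-⊤ : Finite ⊤
    finite-⊤ = finite-retract (finite-Fin 1) (λ _ → 0F) _ (λ _ → refl)

    finite-Op : Finite (Op K)
    finite-Op = finite-retract (finite-⊎ (finite-Fin (suc K)) (finite-⊎ (finite-Fin (suc K)) (finite-⊎ (finite-Fin (suc K)) finite-⊤)))
      (λ { (INC i) → inj₁ i ; (DEC i) → inj₂ (inj₁ i) ; (ZERO i) → inj₂ (inj₂ (inj₁ i)) ; SNAP → inj₂ (inj₂ (inj₂ tt)) })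
      (λ { (inj₁ i) → INC i ; (inj₂ (inj₁ i)) → DEC i ; (inj₂ (inj₂ (inj₁ i))) → ZERO i ; (inj₂ (inj₂ (inj₂ _))) → SNAP })
      (λ { (INC i) → refl ; (DEC i) → refl ; (ZERO i) → refl ; SNAP → refl })

    finite-Control : Finite Control
    finite-Control = finite-retract
      (finite-⊎ finite-⊤ (finite-⊎ (finite-Fin locations)
        (finite-⊎ (finite-× finite-Op (finite-× (finite-Fin locations) (finite-× (finite-Fin (n * 2)) (finite-Fin (suc B))))) finite-⊤)))
      (λ { init → inj₁ tt ; (at q) → inj₂ (inj₁ q) ; (pass op q d p) → inj₂ (inj₂ (inj₁ (op , q , d , p))) ; sink → inj₂ (inj₂ (inj₂ tt)) })
      (λ { (inj₁ _) → init ; (inj₂ (inj₁ q)) → at q ; (inj₂ (inj₂ (inj₁ (op , q , d , p)))) → pass op q d p ; (inj₂ (inj₂ (inj₂ _))) → sink })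
      (λ { init → refl ; (at q) → refl ; (pass op q d p) → refl ; sink → refl })

    finite-Ctr : Finite Counters
    finite-Ctr = finite-retract
      (finite-⊎ (finite-Fin (suc B)) (finite-⊎ (finite-Fin (suc K)) (finite-⊎ (finite-Fin (suc K)) finite-Bool)))
      (λ { (yard q) → inj₁ q ; (reg j) → inj₂ (inj₁ j) ; (coreg j) → inj₂ (inj₂ (inj₁ j)) ; buf → inj₂ (inj₂ (inj₂ true)) ; cobuf → inj₂ (inj₂ (inj₂ false)) })
      (λ { (inj₁ q) → yard q ; (inj₂ (inj₁ j)) → reg j ; (inj₂ (inj₂ (inj₁ j))) → coreg j ; (inj₂ (inj₂ (inj₂ true))) → buf ; (inj₂ (inj₂ (inj₂ false))) → cobuf })
      (λ { (yard q) → refl ; (reg j) → refl ; (coreg j) → refl ; buf → refl ; cobuf → refl })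

  accepts : Control → Bool
  accepts sink   = true
  accepts (at q) = does (q Fin.≟ goal)
  accepts _      = false

  net : Net γ
  net = record
    { State         = Control
    ; Counter       = Counters
    ; finiteState   = finite-Control
    ; finiteCounter = finite-Ctr
    ; start         = init
    ; transitions   = moves
    ; accepting     = accepts
    }

-- The net inside a stage, tick by tick

module CodingRuns (n′ K : ℕ) (P : Program K) where
  open Program P
  open Coding n′ K P
  open Net net using (NetRun; NetLanguage)
  open Stage B K
  open Settled

  digit≤ : ∀ d → 2 + digit d ≤ B
  digit≤ d = subst (2 + digit d ≤_) (ℕ.+-comm 2 (n * 2)) (ℕ.+-monoʳ-≤ 2 (Fin.toℕ<n d))

  module Facts (t : ℕ) (d : Fin (n * 2)) where
    open Gain (B^ t) public
    open Balance (B^ t) public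
    open StageFacts B K (B^ t) (digit d) (1≤B^ t) (digit≤ d) public
    open StageStep B K (B^ t) (digit d) (1≤B^ t) (digit≤ d) public

  -- v₀ are the counters at the beginning of stage t, and r ticks of pass p are left.
  record InPass (op : Op K) (t : ℕ) (d : Fin (n * 2)) (p : Fin (suc B)) (r : ℕ) (v₀ v : Counters → ℕ) : Set where
    open Facts t d
    field
      left      : r ≤ B^ t
      a b       : ℕ
      chosen    : a + b ≡ gain 0 1 (tick (toℕ p) r)
      balanced  : Balanced op (digit d) v₀ (tick (toℕ p) r) a b v
      checked   : 1 ≤ toℕ p → Checked op v₀ a

  module _ {op : Op K} {t : ℕ} {d : Fin (n * 2)} {v₀ : Counters → ℕ} where
    open Facts t d

    in-pass-start : ∀ {v} → (∀ c → v c ≡ v₀ c) → InPass op t d 0F (B^ t) v₀ v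
    in-pass-start same = record
      { left = ℕ.≤-refl ; a = 0 ; b = 0 ; chosen = sum-start
      ; balanced = balanced-start op same ; checked = λ () }

    in-pass-tick : ∀ {p r v v′} ch → (∀ c → Applies (passAction op (digit d) (toℕ p) ch c) (v c) (v′ c)) →
                   (I : InPass op t d p (suc r) v₀ v) →
                   Σ[ I′ ∈ InPass op t d p r v₀ v′ ] InPass.a I′ ≡ chosen⁺ (toℕ p) ch (InPass.a I)
    in-pass-tick {p} {r} {v} {v′} ch app I = record
      { left     = ℕ.≤-trans (ℕ.n≤1+n r) left
      ; a        = chosen⁺ (toℕ p) ch a
      ; b        = chosen⁺ (toℕ p) (not ch) b
      ; chosen   = subst (λ k → chosen⁺ (toℕ p) ch a + chosen⁺ (toℕ p) (not ch) b ≡ gain 0 1 k) (sym (tick-suc (toℕ p) left))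
                     (sum-tick (toℕ p) (tick-≥ (toℕ p) (suc r)) (tick-< (toℕ p) left) ch a b chosen)
      ; balanced = subst (λ k → Balanced op (digit d) v₀ k (chosen⁺ (toℕ p) ch a) (chosen⁺ (toℕ p) (not ch) b) v′)
                     (sym (tick-suc (toℕ p) left))
                     (balanced-tick {op} {digit d} (toℕ p) (tick-≥ (toℕ p) (suc r)) (tick-< (toℕ p) left) ch a b balanced app)
      ; checked  = λ 1≤p → subst (Checked op v₀) (sym (unchanged 1≤p)) (checked 1≤p)
      } , refl
      where
      open InPass I
      unchanged : 1 ≤ toℕ p → chosen⁺ (toℕ p) ch a ≡ a
      unchanged 1≤p = trans (cong (λ x → a + indicator (x ∧ ch)) (inside-above {0} {1} 1≤p)) (ℕ.+-identityʳ a)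

    -- The check becomes available when pass 0 ends; later passes only carry it along, as `SNAP`
    -- makes its choices in pass 0.
    in-pass-check : ∀ {p v} → Settled (B^ t) v₀ → (I : InPass op t d p 0 v₀ v) → Checked op v₀ (InPass.a I)
    in-pass-check {zero}  st I = check st op {b = InPass.b I} refl (InPass.chosen I) (InPass.balanced I)
    in-pass-check {suc p} st I = InPass.checked I (s≤s z≤n)

    in-pass-next : ∀ {p p′ v v′} → Settled (B^ t) v₀ → toℕ p′ ≡ suc (toℕ p) → (∀ c → v′ c ≡ v c) →
                   (I : InPass op t d p 0 v₀ v) →
                   Σ[ I′ ∈ InPass op t d p′ (B^ t) v₀ v′ ] InPass.a I′ ≡ InPass.a I
    in-pass-next {p} {p′} {v} {v′} st p′≡ same I = record
      { left     = ℕ.≤-refl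
      ; a        = a
      ; b        = b
      ; chosen   = subst (λ k → a + b ≡ gain 0 1 k) (sym tick≡) chosen
      ; balanced = λ c → subst (λ k → v′ c + debit op (digit d) k a b c ≡ v₀ c + credit op (digit d) k a b c) (sym tick≡)
                     (trans (cong (_+ debit op (digit d) (tick (toℕ p) 0) a b c) (same c)) (balanced c))
      ; checked  = λ _ → in-pass-check st I
      } , refl
      where
      open InPass I
      tick≡ : tick (toℕ p′) (B^ t) ≡ tick (toℕ p) 0
      tick≡ = trans (cong (λ q → tick q (B^ t)) p′≡) (tick-next (toℕ p))

    module _ {p : Fin (suc B)} {v : Counters → ℕ} (p≡B : toℕ p ≡ B) (st : Settled (B^ t) v₀) (I : InPass op t d p 0 v₀ v) where
      open InPass I
      open Complete st

      private
        tick≡ : tick (toℕ p) 0 ≡ end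
        tick≡ = trans (cong (λ q → q * B^ t + B^ t) p≡B) (ℕ.+-comm (B * B^ t) (B^ t))

      balanced-end : Balanced op (digit d) v₀ end a b v
      balanced-end = subst (λ k → Balanced op (digit d) v₀ k a b v) tick≡ balanced

      in-pass-finish : ∀ {v′} → (∀ c → Applies (endAction op c) (v c) (v′ c)) → Finished op v₀ v′
      in-pass-finish app = finish st op {a} {b} (in-pass-check st I)
        (subst (λ k → a + b ≡ gain 0 1 k) tick≡ chosen) balanced-end app

      in-pass-end-feasible : Bounded st → OpEnabled op (v₀ ∘ reg) → ∀ c → endAction op c ≡ dec → v c ≢ 0
      in-pass-end-feasible bounded en = end-feasible st op {a} {b} bounded en (in-pass-check st I) balanced-end

    in-pass-yard : ∀ {p r v} → Settled (B^ t) v₀ → InPass op t d p r v₀ v → v (yard p) ≡ r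
    in-pass-yard {p} st I = yard-left {op} st p left balanced
      where open InPass I

    in-pass-feasible : ∀ {p r v} (st : Settled (B^ t) v₀) → (I : InPass op t d p (suc r) v₀ v) → Bounded st → OpEnabled op (v₀ ∘ reg) →
                       InPass.a I ≤ v₀ buf → ∀ c → passAction op (digit d) (toℕ p) (choose st (InPass.a I)) c ≡ dec → v c ≢ 0
    in-pass-feasible {p} st I bounded en a≤ = feasible st op p {a = a} {b} left bounded en a≤ chosen balanced
      where open InPass I

  passAction-yard : ∀ op D p ch → passAction op D (toℕ p) ch (yard p) ≡ dec
  passAction-yard op D zero    ch = refl
  passAction-yard op D (suc p) ch = cong₂ action
    (inside-true {suc (toℕ p)} {2 + toℕ p} ℕ.≤-refl ℕ.≤-refl)
    (inside-above {toℕ p} {suc (toℕ p)} ℕ.≤-refl)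

-- From runs of the net to runs of the program

module CodingBackward (n′ K : ℕ) (P : Program K) where
  open Program P
  open Coding n′ K P
  open CodingRuns n′ K P
  open Net net using (NetRun; NetLanguage)
  open Stage B K
  open Settled

  module OfRun (y : ωWord γ) (ρ : NetRun y) where
    open NetRun ρ

    record Chosen (t : ℕ) : Set where
      field
        op      : Op K
        from to : Fin locations
        bit     : Fin 2
        at-from : state (pos t) ≡ at from
        edge    : (op , to) ∈ edges from
        settled : Settled (B^ t) (counter (pos t))

      d : Fin (n * 2)
      d = Fin.combine (decode (y (pos t))) bit

    -- One stage of memory is enough: the invariant at letter `t + 1` yields the choices of stage
    -- `t`, and the program run is assembled from these for all `t`.
    History : ℕ → Fin locations → (Counters → ℕ) → Set
    History zero    q v = q ≡ entry × (∀ j → v (reg j) ≡ 0) × v buf ≡ 0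
    History (suc t) q v = Σ[ C ∈ Chosen t ] let open Chosen C in
      q ≡ to × Facts.Finished t d op (counter (pos t)) v

    data Invariant (s : ℕ) : Position → Set where
      inv-begin  : state s ≡ init → (∀ c → counter s c ≡ 0) → Invariant s begin
      inv-letter : ∀ {t} q → state s ≡ at q → Settled (B^ t) (counter s) → History t q (counter s) → Invariant s (letter t)
      inv-body   : ∀ {t p r} (C : Chosen t) → let open Chosen C in
                   state s ≡ pass op to d p → InPass op t d p r (counter (pos t)) (counter s) → Invariant s (body t p r)

    step-from : ∀ s {x a} → state s ≡ x → y s ≡ a → Σ[ act ∈ (Counters → Action) ]
      (state (suc s) , act) ∈ moves x a × (∀ c → Applies (act c) (counter s c) (counter (suc s) c))
    step-from s st ya with net-step s
    ... | act , mem , app = act , subst₂ (λ x a → (state (suc s) , act) ∈ moves x a) st ya mem , app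

    no-sink : ∀ s p → counter s (yard p) ≡ 0 → ¬ (∀ c → Applies (sinkAction p c) (counter s c) (counter (suc s) c))
    no-sink s p z app with does (p Fin.≟ p) | dec-true (p Fin.≟ p) refl | app (yard p)
    ... | true | _ | eq = contradiction (trans eq z) λ ()

    invariant-step : ∀ s π a → position s ≡ π → y s ≡ a → Invariant s π → T (fits π a) → Invariant (suc s) (advance π)
    invariant-step s begin 1F _ ya (inv-begin st zeros) _ with step-from s st ya
    ... | act , here eq , app with cong proj₁ eq | cong proj₂ eq
    ... | st′ | refl = inv-letter entry st′
      (record
        { yard-zero = trans (app (yard zero)) (cong suc (zeros _))
        ; yard-suc  = λ q → trans (app (yard (suc q))) (zeros _)
        ; coreg-sum = λ j → cong₂ _+_ (trans (app (coreg j)) (cong suc (zeros _))) (trans (app (reg j)) (zeros _))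
        ; cobuf-sum = cong₂ _+_ (trans (app cobuf) (cong suc (zeros _))) (trans (app buf) (zeros _))
        })
      (refl , (λ j → trans (app (reg j)) (zeros _)) , trans (app buf) (zeros _))
    invariant-step s (letter t) (suc (suc a)) eq ya (inv-letter q st settled _) _ with step-from s st ya
    ... | act , mem , app with find (Mem.∈-concatMap⁻ (branches a) {xs = edges q} mem)
    ... | (op , q′) , e , mem′ = entered mem′
      where
      s≡ : s ≡ pos t
      s≡ = pos-unique s eq
      enter : ∀ bit → (state (suc s) , act) ≡ (pass op q′ (Fin.combine a bit) 0F , rest) → Invariant (suc s) (body t 0F (B^ t))
      enter bit eq′ with cong proj₁ eq′ | cong proj₂ eq′
      ... | st′ | refl = inv-body C (trans st′ (cong (λ a → pass op q′ (Fin.combine a bit) 0F) a≡))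
              (in-pass-start (λ c → trans (app c) (cong (λ s → counter s c) s≡)))
        where
        a≡ : a ≡ decode (y (pos t))
        a≡ = trans (cong decode (sym ya)) (cong (decode ∘ y) s≡)
        C : Chosen t
        C = record { op = op ; from = q ; to = q′ ; bit = bit ; at-from = trans (cong state (sym s≡)) st ; edge = e
                   ; settled = subst (λ s → Settled (B^ t) (counter s)) s≡ settled }
      entered : (state (suc s) , act) ∈ branches a (op , q′) → Invariant (suc s) (body t 0F (B^ t))
      entered (here eq′)         = enter 0F eq′
      entered (there (here eq′)) = enter 1F eq′
    invariant-step s (body t p (suc r)) 0F _ ya (inv-body C st I) _ with step-from s st ya
    ... | act , here eq , app with cong proj₁ eq | cong proj₂ eq
    ... | st′ | refl = inv-body C st′ (proj₁ (in-pass-tick true app I))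
    invariant-step s (body t p (suc r)) 0F _ ya (inv-body C st I) _ | act , there (here eq) , app with cong proj₁ eq | cong proj₂ eq
    ... | st′ | refl = inv-body C st′ (proj₁ (in-pass-tick false app I))
    invariant-step s (body t p zero) 1F _ ya (inv-body C st I) _ with step-from s st ya
    ... | act , there (here eq) , app =
      ⊥-elim (no-sink s p (in-pass-yard (Chosen.settled C) I) (subst (λ act → ∀ c → Applies (act c) _ _) (cong proj₂ eq) app))
    ... | act , here eq , app = left (next-pass p) refl eq
      where
      open Chosen C
      left : ∀ m → next-pass p ≡ m → (state (suc s) , act) ≡ leave op to d m → Invariant (suc s) (end-pass t m)
      left (just p′) np eq with cong proj₁ eq | cong proj₂ eq
      ... | st′ | refl = inv-body C st′ (proj₁ (in-pass-next settled (next-pass-just p np) app I))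
      left nothing np eq with cong proj₁ eq | cong proj₂ eq
      ... | st′ | refl = inv-letter to st′ (Facts.Finished.settled⁺ {t} {d} fin) (C , refl , fin)
        where
        fin : Facts.Finished t d op (counter (pos t)) (counter (suc s))
        fin = in-pass-finish (next-pass-nothing p np) settled I app

    module Fitting (s₁ : ℕ) (fitting : ∀ s → s < s₁ → T (fits (position s) (y s))) where
      invariant : ∀ s → s ≤ s₁ → Invariant s (position s)
      invariant zero    _    = inv-begin state-start counter-start
      invariant (suc s) s<s₁ = invariant-step s (position s) (y s) refl refl (invariant s (ℕ.<⇒≤ s<s₁)) (fitting s s<s₁)

    -- The given run is cut at `s` and continued in the sink, which reads anything; so it accepts
    -- the whole cylinder of words that agree up to the early end of the pass.
    sinking : ∀ s p {op q d} → state s ≡ pass op q d p → y s ≡ 1F → counter s (yard p) ≢ 0 →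
              ∀ y′ → y′ ↾ suc s ≡ y ↾ suc s → NetLanguage y′
    sinking s p {op} {q} {d} st ya yard≢0 y′ agree = record
      { state         = state′
      ; counter       = counter′
      ; state-start   = trans (early-state {0} z≤n) state-start
      ; counter-start = λ c → trans (early-counter {0} z≤n c) (counter-start c)
      ; net-step      = step
      } , sink , tt , λ t → suc s + t , ℕ.m≤n+m t (suc s) , late-state (ℕ.m≤m+n (suc s) t)
      where
      state′ : ℕ → Control
      state′ t = if does (t ℕ.≤? s) then state t else sink
      last : Counters → ℕ
      last c = perform (sinkAction p c) (counter s c)
      counter′ : ℕ → Counters → ℕ
      counter′ t c = if does (t ℕ.≤? s) then counter t c else last c
      early-state : ∀ {t} → t ≤ s → state′ t ≡ state t
      early-state {t} le rewrite dec-true (t ℕ.≤? s) le = refl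
      late-state : ∀ {t} → s < t → state′ t ≡ sink
      late-state {t} lt rewrite dec-false (t ℕ.≤? s) (ℕ.<⇒≱ lt) = refl
      early-counter : ∀ {t} → t ≤ s → ∀ c → counter′ t c ≡ counter t c
      early-counter {t} le c rewrite dec-true (t ℕ.≤? s) le = refl
      late-counter : ∀ {t} → s < t → ∀ c → counter′ t c ≡ last c
      late-counter {t} lt c rewrite dec-false (t ℕ.≤? s) (ℕ.<⇒≱ lt) = refl
      nonempty : ∀ c → sinkAction p c ≡ dec → counter s c ≢ 0
      nonempty (yard q) eq with q Fin.≟ p
      ... | yes refl = yard≢0
      step : ∀ t → Σ[ act ∈ (Counters → Action) ] (state′ (suc t) , act) ∈ moves (state′ t) (y′ t) ×
                   (∀ c → Applies (act c) (counter′ t c) (counter′ (suc t) c))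
      step t with ℕ.<-cmp t s
      ... | tri< lt _ _ rewrite early-state (ℕ.<⇒≤ lt) | early-state lt | ↾-at y′ y (suc s) agree {t} (ℕ.m≤n⇒m≤1+n lt) with net-step t
      ...   | act , mem , app = act , mem , λ c →
                subst₂ (Applies (act c)) (sym (early-counter (ℕ.<⇒≤ lt) c)) (sym (early-counter lt c)) (app c)
      step t | tri≈ _ refl _ rewrite early-state (ℕ.≤-refl {s}) | late-state (ℕ.n<1+n s) | ↾-at y′ y (suc s) agree {s} ℕ.≤-refl
                                   | st | ya =
                sinkAction p , there (here refl) , λ c →
                subst₂ (Applies (sinkAction p c)) (sym (early-counter (ℕ.≤-refl {s}) c)) (sym (late-counter (ℕ.n<1+n s) c))
                  (applies-perform (sinkAction p c) (nonempty c))
      step t | tri> _ _ gt rewrite late-state gt | late-state (ℕ.m≤n⇒m≤1+n gt) =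
                rest , here refl , λ c → trans (late-counter (ℕ.m≤n⇒m≤1+n gt) c) (sym (late-counter gt c))

    -- Among the misfits only the early end of a pass leaves the net a move. A tick too many would
    -- have to decrement the empty yard of the pass, and for any other wrong letter there is no
    -- transition; both contradict the given run.
    misfit : ∀ s π a → y s ≡ a → Invariant s π → ¬ T (fits π a) →
             ∀ y′ → y′ ↾ suc s ≡ y ↾ suc s → NetLanguage y′
    misfit s begin 0F            ya (inv-begin st _) bad with step-from s st ya
    ... | _ , () , _
    misfit s begin 1F            ya I bad = contradiction tt bad
    misfit s begin (suc (suc a)) ya (inv-begin st _) bad with step-from s st ya
    ... | _ , () , _
    misfit s (letter t) 0F       ya (inv-letter q st _ _) bad with step-from s st ya
    ... | _ , () , _
    misfit s (letter t) 1F       ya (inv-letter q st _ _) bad with step-from s st ya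
    ... | _ , () , _
    misfit s (letter t) (suc (suc a)) ya I bad = contradiction tt bad
    misfit s (body t p (suc r)) 0F ya I bad = contradiction tt bad
    misfit s (body t p (suc r)) 1F ya (inv-body C st I) bad = sinking s p st ya
      λ z → contradiction (trans (sym (in-pass-yard (Chosen.settled C) I)) z) λ ()
    misfit s (body t p (suc r)) (suc (suc a)) ya (inv-body C st I) bad with step-from s st ya
    ... | _ , () , _
    misfit s (body t p zero) 0F ya (inv-body C st I) bad with step-from s st ya
    ... | act , mem , app = ⊥-elim (blocked mem)
      where
      open Chosen C
      dead : ∀ ch → act ≡ passAction op (digit d) (toℕ p) ch → ⊥
      dead ch refl = contradiction (trans (subst (λ a → Applies a (counter s (yard p)) (counter (suc s) (yard p)))
        (passAction-yard op (digit d) p ch) (app (yard p))) (in-pass-yard settled I)) λ ()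
      blocked : (state (suc s) , act) ∈ moves (pass op to d p) 0F → ⊥
      blocked (here eq)         = dead true (cong proj₂ eq)
      blocked (there (here eq)) = dead false (cong proj₂ eq)
    misfit s (body t p zero) 1F ya I bad = contradiction tt bad
    misfit s (body t p zero) (suc (suc a)) ya (inv-body C st I) bad with step-from s st ya
    ... | _ , () , _

    module FittingAll (fitting : ∀ s → T (fits (position s) (y s))) where
      invariant : ∀ s → Invariant s (position s)
      invariant s = Fitting.invariant s (λ s _ → fitting s) s ℕ.≤-refl

      at-letter : ∀ t → Σ[ q ∈ Fin locations ] state (pos t) ≡ at q × History t q (counter (pos t))
      at-letter t = go (position (pos t)) (position-pos t) (invariant (pos t))
        where
        go : ∀ π → π ≡ letter t → Invariant (pos t) π → Σ[ q ∈ Fin locations ] state (pos t) ≡ at q × History t q (counter (pos t))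
        go _ refl (inv-letter q st _ h) = q , st , h

      location : ℕ → Fin locations
      location t = proj₁ (at-letter t)

      chosenAt : ∀ t → Chosen t
      chosenAt t = proj₁ (proj₂ (proj₂ (at-letter (suc t))))

      finishedAt : ∀ t → let open Chosen (chosenAt t) in Facts.Finished t d op (counter (pos t)) (counter (pos (suc t)))
      finishedAt t = proj₂ (proj₂ (proj₂ (proj₂ (at-letter (suc t)))))

      to≡ : ∀ t → location (suc t) ≡ Chosen.to (chosenAt t)
      to≡ t = proj₁ (proj₂ (proj₂ (proj₂ (at-letter (suc t)))))

      at-injective : ∀ {q q′} → at q ≡ at q′ → q ≡ q′
      at-injective refl = refl

      from≡ : ∀ t → location t ≡ Chosen.from (chosenAt t)
      from≡ t = at-injective (trans (sym (proj₁ (proj₂ (at-letter t)))) (Chosen.at-from (chosenAt t)))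

      programRun : ProgramRun (digits (decode ∘ y ∘ pos) (λ t → Chosen.bit (chosenAt t)))
      programRun = record
        { location       = location
        ; register       = λ t j → counter (pos t) (reg j)
        ; buffer         = λ t → counter (pos t) buf
        ; location-start = proj₁ (proj₂ (proj₂ (at-letter 0)))
        ; register-start = proj₁ (proj₂ (proj₂ (proj₂ (at-letter 0))))
        ; buffer-start   = proj₂ (proj₂ (proj₂ (proj₂ (at-letter 0))))
        ; operation      = λ t → Chosen.op (chosenAt t)
        ; edge           = λ t → subst₂ (λ q q′ → (Chosen.op (chosenAt t) , q′) ∈ edges q) (sym (from≡ t)) (sym (to≡ t)) (Chosen.edge (chosenAt t))
        ; enabled        = λ t → Facts.Finished.enabled {t} {Chosen.d (chosenAt t)} (finishedAt t)
        ; register-step  = λ t → Facts.Finished.reg⁺ {t} {Chosen.d (chosenAt t)} (finishedAt t)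
        ; buffer-step    = λ t → Facts.Finished.buf⁺ {t} {Chosen.d (chosenAt t)} (finishedAt t)
        }

      -- On a fitting word the run never enters the sink, so the accepting state that recurs is
      -- `at goal`, and it is occupied only at letters.
      goal-often : ∀ {q} → T (accepts q) → (∀ t → ∃[ t′ ] t ≤ t′ × state t′ ≡ q) →
                   ∀ t → ∃[ t′ ] t ≤ t′ × location t′ ≡ goal
      goal-often {q} acc often t with often (pos t)
      ... | s , pos≤s , st≡ = go (position s) refl (invariant s)
        where
        go : ∀ π → position s ≡ π → Invariant s π → ∃[ t′ ] t ≤ t′ × location t′ ≡ goal
        go begin eq (inv-begin st _) = ⊥-elim (subst (T ∘ accepts) (trans (sym st≡) st) acc)
        go (body t p r) eq (inv-body C st I) = ⊥-elim (subst (T ∘ accepts) (trans (sym st≡) st) acc)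
        go (letter t′) eq (inv-letter q′ st _ _) = t′ ,
          subst₂ _≤_ (cong stage (position-pos t)) (cong stage eq) (stage-≤ pos≤s) ,
          trans (at-injective (trans (sym (proj₁ (proj₂ (at-letter t′)))) (trans (cong state (sym (pos-unique s eq))) st)))
            (does⇒ (q′ Fin.≟ goal) (Equivalence.to Bool.T-≡ (subst (T ∘ accepts) (trans (sym st≡) st) acc)))

  inside⇒program : ∀ y → (∀ s → T (fits (position s) (y s))) → NetLanguage y → ProgramLanguage (decode ∘ y ∘ pos)
  inside⇒program y fitting (ρ , q , acc , often) = _ , programRun , goal-often acc often
    where
    open OfRun y ρ
    open FittingAll fitting

  outside-open : ∀ y s → ¬ T (fits (position s) (y s)) → NetLanguage y →
                 ∃[ m ] (∀ y′ → y′ ↾ m ≡ y ↾ m → NetLanguage y′)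
  outside-open y s bad (ρ , _) = search 0 s refl (λ _ ())
    where
    open OfRun y ρ
    Fits : ℕ → Bool
    Fits s = fits (position s) (y s)
    search : ∀ k fuel → k + fuel ≡ s → (∀ t → t < k → T (Fits t)) → ∃[ m ] (∀ y′ → y′ ↾ m ≡ y ↾ m → NetLanguage y′)
    search k fuel eq before with Fits k in fk
    ... | false = suc k , misfit k (position k) (y k) refl (Fitting.invariant k before k ℕ.≤-refl) (subst T fk)
    search k zero eq before | true = contradiction (subst (T ∘ Fits) (trans (sym (ℕ.+-identityʳ k)) eq) (subst T (sym fk) tt)) bad
    search k (suc fuel) eq before | true = search (suc k) fuel (trans (sym (ℕ.+-suc k fuel)) eq) before′
      where
      before′ : ∀ t → t < suc k → T (Fits t)
      before′ t t<1+k with ℕ.m<1+n⇒m<n∨m≡n t<1+k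
      ... | inj₁ t<k  = before t t<k
      ... | inj₂ refl = subst T (sym fk) tt

opEnabled-cong : ∀ {K} (op : Op K) {ρ ρ′} → (∀ j → ρ j ≡ ρ′ j) → OpEnabled op ρ → OpEnabled op ρ′
opEnabled-cong (INC i)  eq en = tt
opEnabled-cong (DEC i)  eq en = en ∘ trans (eq i)
opEnabled-cong (ZERO i) eq en = trans (sym (eq i)) en
opEnabled-cong SNAP     eq en = tt

regAfter-cong : ∀ {K} (op : Op K) {ρ ρ′ β β′} → (∀ j → ρ j ≡ ρ′ j) → β ≡ β′ → ∀ j → regAfter op ρ β j ≡ regAfter op ρ′ β′ j
regAfter-cong (INC i)  eq refl j = cong (λ v → if does (i Fin.≟ j) then suc v else v) (eq j)
regAfter-cong (DEC i)  eq refl j = cong (λ v → if does (i Fin.≟ j) then pred v else v) (eq j)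
regAfter-cong (ZERO i) eq refl j = eq j
regAfter-cong SNAP {β = β} eq refl j = cong (λ v → if does (0F Fin.≟ j) then v + β else v) (eq j)

-- From runs of the program to runs of the net

module CodingForward (n′ K : ℕ) (P : Program K) where
  open Program P
  open Coding n′ K P
  open CodingRuns n′ K P
  open Net net using (NetRun; NetLanguage)
  open Stage B K
  open Settled

  module OfProgramRun (y : ωWord γ) (fitting : ∀ s → T (fits (position s) (y s))) (τ : ωWord 2)
    (R : ProgramRun (digits (decode ∘ y ∘ pos) τ)) where
    open ProgramRun R

    d : ℕ → Fin (n * 2)
    d = digits (decode ∘ y ∘ pos) τ

    record Represents (t : ℕ) (v : Counters → ℕ) : Set where
      field
        settled   : Settled (B^ t) v
        registers : ∀ j → v (reg j) ≡ register t j
        buffered  : v buf ≡ buffer t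
        bounded   : ∀ j → v (reg j) + v buf ≤ B^ t

    -- The bound `a ≤ v₀ buf` is preserved by the strategy `choose`; it ensures that `cobuf` lasts
    -- for the remaining ticks of pass 0.
    data Live : Position → Control → (Counters → ℕ) → Set where
      live-begin  : ∀ {st v} → st ≡ init → (∀ c → v c ≡ 0) → Live begin st v
      live-letter : ∀ {t st v} → st ≡ at (location t) → Represents t v → Live (letter t) st v
      live-body   : ∀ {t p r st v v₀} → Represents t v₀ →
                    st ≡ pass (operation t) (location (suc t)) (d t) p →
                    (I : InPass (operation t) t (d t) p r v₀ v) → InPass.a I ≤ v₀ buf → Live (body t p r) st v

    Step : Position → Control → Fin γ → (Counters → ℕ) → Set
    Step π st a v = Σ[ st′ ∈ Control ] Σ[ v′ ∈ (Counters → ℕ) ] Σ[ act ∈ (Counters → Action) ]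
      (st′ , act) ∈ moves st a × (∀ c → Applies (act c) (v c) (v′ c)) × Live π st′ v′

    branch : ∀ {t} bit {a} → bit ≡ τ t → (operation t , location (suc t)) ∈ edges (location t) →
             (pass (operation t) (location (suc t)) (Fin.combine a bit) 0F , rest) ∈ moves (at (location t)) (suc (suc a))
    branch 0F {a} _ e = Mem.∈-concatMap⁺ (branches a) (lose e (here refl))
    branch 1F {a} _ e = Mem.∈-concatMap⁺ (branches a) (lose e (there (here refl)))

    live-step : ∀ s π a → position s ≡ π → y s ≡ a → T (fits π a) → ∀ {st v} → Live π st v → Step (advance π) st a v
    live-step s begin 1F _ _ _ {v = v} (live-begin refl zeros) =
      at entry , v′ , initAction , here refl , (λ c → applies-perform (initAction c) (no-dec c)) ,
      live-letter (cong at (sym location-start)) (record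
        { settled   = record
          { yard-zero = cong suc (zeros _) ; yard-suc = λ q → zeros _
          ; coreg-sum = λ j → cong₂ _+_ (cong suc (zeros (coreg j))) (zeros (reg j))
          ; cobuf-sum = cong₂ _+_ (cong suc (zeros cobuf)) (zeros buf) }
        ; registers = λ j → trans (zeros _) (sym (register-start j))
        ; buffered  = trans (zeros _) (sym buffer-start)
        ; bounded   = λ j → subst (_≤ 1) (sym (cong₂ _+_ (zeros (reg j)) (zeros buf))) z≤n
        })
      where
      v′ : Counters → ℕ
      v′ c = perform (initAction c) (v c)
      no-dec : ∀ c → initAction c ≡ dec → v c ≢ 0
      no-dec (yard zero) ()
      no-dec (yard (suc _)) ()
      no-dec (reg _) ()
      no-dec (coreg _) ()
      no-dec buf ()
      no-dec cobuf ()
    live-step s (letter t) (suc (suc a)) eq ya _ {v = v} (live-letter refl rep) =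
      pass (operation t) (location (suc t)) (Fin.combine a (τ t)) 0F , v , rest , branch (τ t) {a} refl (edge t) , (λ _ → refl) ,
      live-body rep (cong (λ a → pass (operation t) (location (suc t)) (Fin.combine a (τ t)) 0F) a≡) (in-pass-start (λ _ → refl)) z≤n
      where
      a≡ : a ≡ decode (y (pos t))
      a≡ = trans (cong decode (sym ya)) (cong (decode ∘ y) (pos-unique s eq))
    live-step s (body t p (suc r)) 0F _ _ _ {v = v} (live-body {v₀ = v₀} rep refl I a≤) =
      pass (operation t) (location (suc t)) (d t) p , (λ c → perform (act c) (v c)) , act , mem ch , app ,
      live-body rep refl (proj₁ I′) (subst (_≤ v₀ buf) (sym (proj₂ I′))
        (Facts.chosen-≤ t (d t) settled (toℕ p) (InPass.a I) a≤))
      where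
      open Represents rep
      ch : Bool
      ch = Facts.choose t (d t) settled (InPass.a I)
      act : Counters → Action
      act = passAction (operation t) (digit (d t)) (toℕ p) ch
      app : ∀ c → Applies (act c) (v c) (perform (act c) (v c))
      app c = applies-perform (act c) (in-pass-feasible settled I bounded
        (opEnabled-cong (operation t) (sym ∘ registers) (enabled t)) a≤ c)
      I′ = in-pass-tick ch app I
      mem : ∀ ch → (pass (operation t) (location (suc t)) (d t) p , passAction (operation t) (digit (d t)) (toℕ p) ch) ∈
            moves (pass (operation t) (location (suc t)) (d t) p) 0F
      mem true  = here refl
      mem false = there (here refl)
    live-step s (body t p zero) 1F _ _ _ {v = v} (live-body {v₀ = v₀} rep refl I a≤) = go (next-pass p) refl
      where
      open Represents rep
      op = operation t
      go : ∀ m → next-pass p ≡ m → Step (end-pass t m) (pass op (location (suc t)) (d t) p) 1F v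
      go (just p′) np = pass op (location (suc t)) (d t) p′ , v , rest ,
        here (sym (cong (leave op (location (suc t)) (d t)) np)) , (λ _ → refl) ,
        live-body rep refl (proj₁ I′) (subst (_≤ v₀ buf) (sym (proj₂ I′)) a≤)
        where I′ = in-pass-next settled (next-pass-just p np) (λ _ → refl) I
      go nothing np = at (location (suc t)) , v′ , endAction op ,
        here (sym (cong (leave op (location (suc t)) (d t)) np)) , app ,
        live-letter refl (record
          { settled   = settled⁺
          ; registers = λ j → trans (reg⁺ j) (trans (regAfter-cong op registers buffered j) (sym (register-step t j)))
          ; buffered  = trans buf⁺ (trans (cong (λ β → bufAfter op β + digit (d t) * B^ t) buffered) (sym (buffer-step t)))
          ; bounded   = λ j → subst (_≤ B^ (suc t)) (sym (cong₂ _+_ (reg⁺ j) buf⁺)) (Facts.bounded⁺ t (d t) settled op bounded j)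
          })
        where
        v′ : Counters → ℕ
        v′ c = perform (endAction op c) (v c)
        app : ∀ c → Applies (endAction op c) (v c) (v′ c)
        app c = applies-perform (endAction op c) (in-pass-end-feasible (next-pass-nothing p np) settled I bounded
          (opEnabled-cong op (sym ∘ registers) (enabled t)) c)
        open Facts.Finished t (d t) (in-pass-finish (next-pass-nothing p np) settled I app)

    Configuration : ℕ → Set
    Configuration s = Σ[ st ∈ Control ] Σ[ v ∈ (Counters → ℕ) ] Live (position s) st v

    advanced : ∀ s → (C : Configuration s) → Step (position (suc s)) (proj₁ C) (y s) (proj₁ (proj₂ C))
    advanced s (st , v , live) = live-step s (position s) (y s) refl refl (fitting s) live

    configuration : ∀ s → Configuration s
    configuration zero    = init , (λ _ → 0) , live-begin refl (λ _ → refl)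
    configuration (suc s) with advanced s (configuration s)
    ... | st′ , v′ , _ , _ , _ , live′ = st′ , v′ , live′

    run : NetRun y
    run = record
      { state         = λ s → proj₁ (configuration s)
      ; counter       = λ s → proj₁ (proj₂ (configuration s))
      ; state-start   = refl
      ; counter-start = λ _ → refl
      ; net-step      = λ s → let _ , _ , act , mem , app , _ = advanced s (configuration s) in act , mem , app
      }

    at-letter : ∀ t → NetRun.state run (pos t) ≡ at (location t)
    at-letter t = go (position (pos t)) (position-pos t) (proj₂ (proj₂ (configuration (pos t))))
      where
      go : ∀ π {st v} → π ≡ letter t → Live π st v → st ≡ at (location t)
      go _ refl (live-letter eq _) = eq

    pos-suc : ∀ t → pos t < pos (suc t)
    pos-suc t = ℕ.≰⇒> λ le → contradiction
      (subst₂ _≤_ (cong stage (position-pos (suc t))) (cong stage (position-pos t)) (stage-≤ le)) (ℕ.<-irrefl refl)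

    t≤pos : ∀ t → t ≤ pos t
    t≤pos zero    = z≤n
    t≤pos (suc t) = ℕ.≤-<-trans (t≤pos t) (pos-suc t)

  program⇒inside : ∀ y → (∀ s → T (fits (position s) (y s))) → ProgramLanguage (decode ∘ y ∘ pos) → NetLanguage y
  program⇒inside y fitting (τ , R , often) = run , at goal , subst T (sym (dec-true (goal Fin.≟ goal) refl)) tt , λ s →
    let t , s≤t , eq = often s in pos t , ℕ.≤-trans s≤t (t≤pos t) , trans (at-letter t) (cong at eq)
    where open OfProgramRun y fitting τ R

-- Computable functions

record Computable {n} (f : Vec ℕ n → ℕ) : Set where
  constructor computable
  field
    rec      : Rec n
    computes : ∀ xs → rec [ xs ]↓ f xs

open Computable

computable-cong : ∀ {n} {f g : Vec ℕ n → ℕ} → (∀ xs → f xs ≡ g xs) → Computable f → Computable g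
computable-cong eq (computable r c) = computable r λ xs → subst (r [ xs ]↓_) (eq xs) (c xs)

varᶜ : ∀ {n} (i : Fin n) → Computable (λ xs → lookup xs i)
varᶜ i = computable (projᴿ i) (λ xs → proj↓ i)

compᶜ : ∀ {m n} {f : Vec ℕ m → ℕ} {g : Fin m → Vec ℕ n → ℕ} →
        Computable f → (∀ i → Computable (g i)) → Computable (λ xs → f (tabulate λ i → g i xs))
compᶜ {g = g} F G = computable (compᴿ (rec F) (tabulate (rec ∘ G))) λ xs →
  comp↓ (λ i → subst₂ (λ r v → r [ xs ]↓ v) (sym (Vec.lookup∘tabulate (rec ∘ G) i)) (sym (Vec.lookup∘tabulate (λ i → g i xs) i)) (computes (G i) xs))
        (computes F _)

unary : (ℕ → ℕ) → Vec ℕ 1 → ℕ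
unary f xs = f (lookup xs 0F)

binary : (ℕ → ℕ → ℕ) → Vec ℕ 2 → ℕ
binary f xs = f (lookup xs 0F) (lookup xs 1F)

ternary : (ℕ → ℕ → ℕ → ℕ) → Vec ℕ 3 → ℕ
ternary f xs = f (lookup xs 0F) (lookup xs 1F) (lookup xs (suc 1F))

record Computable₁ (f : ℕ → ℕ) : Set where
  constructor computable₁
  field uncurried : Computable (unary f)

record Computable₂ (f : ℕ → ℕ → ℕ) : Set where
  constructor computable₂
  field uncurried : Computable (binary f)

record Computable₃ (f : ℕ → ℕ → ℕ → ℕ) : Set where
  constructor computable₃
  field uncurried : Computable (ternary f)

comp₁ : ∀ {n f} {g : Vec ℕ n → ℕ} → Computable₁ f → Computable g → Computable (λ xs → f (g xs))
comp₁ {g = g} (computable₁ F) G = compᶜ {g = λ _ → g} F (λ _ → G)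

comp₂ : ∀ {n f} {g h : Vec ℕ n → ℕ} → Computable₂ f → Computable g → Computable h → Computable (λ xs → f (g xs) (h xs))
comp₂ {g = g} {h} (computable₂ F) G H = compᶜ {g = λ { 0F → g ; 1F → h }} F (λ { 0F → G ; 1F → H })

comp₃ : ∀ {n f} {g h k : Vec ℕ n → ℕ} → Computable₃ f → Computable g → Computable h → Computable k →
        Computable (λ xs → f (g xs) (h xs) (k xs))
comp₃ {g = g} {h} {k} (computable₃ F) G H K = compᶜ {g = λ { 0F → g ; 1F → h ; (suc 1F) → k }} F (λ { 0F → G ; 1F → H ; (suc 1F) → K })

bindᶜ : ∀ {n} {f : Vec ℕ (suc n) → ℕ} {b : Vec ℕ n → ℕ} → Computable f → Computable b → Computable (λ xs → f (b xs ∷ xs))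
bindᶜ F B = computable (compᴿ (rec F) (rec B ∷ tabulate projᴿ)) λ xs →
  comp↓ (λ { zero → computes B xs ; (suc i) → subst (_[ xs ]↓ lookup xs i) (sym (Vec.lookup∘tabulate projᴿ i)) (proj↓ i) })
        (computes F _)

sucᶜ : Computable₁ suc
sucᶜ = computable₁ (computable sucᴿ λ { (x ∷ []) → suc↓ })

constᶜ : ∀ {n} k → Computable {n} (λ _ → k)
constᶜ zero    = computable (compᴿ zeroᴿ []) λ xs → comp↓ {ys = []} (λ ()) zero↓
constᶜ (suc k) = comp₁ sucᶜ (constᶜ k)

primrecᶜ : ∀ {n} {h : ℕ → Vec ℕ n → ℕ} {f : Vec ℕ n → ℕ} {g : Vec ℕ (2 + n) → ℕ} → Computable f → Computable g →
           (∀ xs → h 0 xs ≡ f xs) → (∀ x xs → h (suc x) xs ≡ g (x ∷ h x xs ∷ xs)) →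
           Computable (λ xs → h (Vec.head xs) (Vec.tail xs))
primrecᶜ {h = h} {f} {g} F G base step = computable (precᴿ (rec F) (rec G)) λ { (x ∷ xs) → go x xs }
  where
  go : ∀ x xs → precᴿ (rec F) (rec G) [ x ∷ xs ]↓ h x xs
  go zero    xs = prec↓0 (subst (rec F [ xs ]↓_) (sym (base xs)) (computes F xs))
  go (suc x) xs = prec↓s (go x xs) (subst (rec G [ _ ]↓_) (sym (step x xs)) (computes G _))

unaryᶜ : ∀ {h : ℕ → ℕ} {g} → Computable g → (∀ x → h (suc x) ≡ g (x ∷ h x ∷ [])) → Computable₁ h
unaryᶜ {h} G step = computable₁ (computable-cong (λ { (x ∷ []) → refl })
  (primrecᶜ {h = λ x _ → h x} (constᶜ (h 0)) G (λ _ → refl) (λ { x [] → step x })))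

binaryᶜ : ∀ {h : ℕ → ℕ → ℕ} {f g} → Computable f → Computable g →
          (∀ y → h 0 y ≡ f (y ∷ [])) → (∀ x y → h (suc x) y ≡ g (x ∷ h x y ∷ y ∷ [])) → Computable₂ h
binaryᶜ {h} F G base step = computable₂ (computable-cong (λ { (x ∷ y ∷ []) → refl })
  (primrecᶜ {h = λ x xs → h x (lookup xs 0F)} F G (λ { (y ∷ []) → base y }) (λ { x (y ∷ []) → step x y })))

addᶜ : Computable₂ _+_
addᶜ = binaryᶜ (varᶜ 0F) (comp₁ sucᶜ (varᶜ 1F)) (λ _ → refl) (λ _ _ → refl)

mulᶜ : Computable₂ _*_
mulᶜ = binaryᶜ (constᶜ 0) (comp₂ addᶜ (varᶜ (suc 1F)) (varᶜ 1F)) (λ _ → refl) (λ _ _ → refl)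

predᶜ : Computable₁ pred
predᶜ = unaryᶜ (varᶜ 0F) (λ _ → refl)

monusᶜ : Computable₂ _∸_
monusᶜ = computable₂ (comp₂ flipped (varᶜ 1F) (varᶜ 0F))
  where
  flipped : Computable₂ (λ y x → x ∸ y)
  flipped = binaryᶜ (varᶜ 0F) (comp₁ predᶜ (varᶜ 1F)) (λ _ → refl) (λ y x → sym (ℕ.pred[m∸n]≡m∸[1+n] x y))

powᶜ : ∀ b → Computable₁ (b ^_)
powᶜ b = unaryᶜ (comp₂ mulᶜ (constᶜ b) (varᶜ 1F)) (λ _ → refl)

isZero isPositive : ℕ → ℕ
isZero zero    = 1
isZero (suc _) = 0
isPositive zero    = 0
isPositive (suc _) = 1

isZeroᶜ : Computable₁ isZero
isZeroᶜ = unaryᶜ (constᶜ 0) (λ _ → refl)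

isPositiveᶜ : Computable₁ isPositive
isPositiveᶜ = unaryᶜ (constᶜ 1) (λ _ → refl)

-- The distance of two numbers, as an equality test that is plainly computable.
differ : ℕ → ℕ → ℕ
differ x y = (x ∸ y) + (y ∸ x)

differᶜ : Computable₂ differ
differᶜ = computable₂ (comp₂ addᶜ (comp₂ monusᶜ (varᶜ 0F) (varᶜ 1F)) (comp₂ monusᶜ (varᶜ 1F) (varᶜ 0F)))

differ-≡ : ∀ x y → differ x y ≡ 0 → x ≡ y
differ-≡ x y eq = ℕ.≤-antisym (ℕ.m∸n≡0⇒m≤n (ℕ.m+n≡0⇒m≡0 (x ∸ y) eq)) (ℕ.m∸n≡0⇒m≤n (ℕ.m+n≡0⇒n≡0 (x ∸ y) eq))

differ-refl : ∀ x → differ x x ≡ 0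
differ-refl x = cong₂ _+_ (ℕ.n∸n≡0 x) (ℕ.n∸n≡0 x)

sumTo : (ℕ → ℕ) → ℕ → ℕ
sumTo f zero    = 0
sumTo f (suc m) = sumTo f m + f m

sumToᶜ : ∀ {n} {g : Vec ℕ (suc n) → ℕ} {b : Vec ℕ n → ℕ} → Computable g → Computable b →
         Computable (λ xs → sumTo (λ s → g (s ∷ xs)) (b xs))
sumToᶜ {n} {g} {b} G B = bindᶜ {f = λ ys → sumTo (λ s → g (s ∷ Vec.tail ys)) (Vec.head ys)}
  (primrecᶜ {h = λ m xs → sumTo (λ s → g (s ∷ xs)) m} (constᶜ 0)
    (comp₂ addᶜ (varᶜ 1F) skip) (λ _ → refl) (λ _ _ → refl)) B
  where
  skip : Computable {2 + n} (λ xs → g (Vec.head xs ∷ Vec.tail (Vec.tail xs)))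
  skip = computable (compᴿ (rec G) (projᴿ 0F ∷ tabulate (λ i → projᴿ (suc (suc i))))) λ { (s ∷ v ∷ xs) →
    comp↓ {ys = s ∷ xs} (λ { zero → proj↓ 0F ; (suc i) → subst (_[ _ ]↓ lookup xs i) (sym (Vec.lookup∘tabulate _ i)) (proj↓ (suc (suc i))) })
      (computes G _) }

sumTo-cong : ∀ {f g} m → (∀ s → s < m → f s ≡ g s) → sumTo f m ≡ sumTo g m
sumTo-cong zero    eq = refl
sumTo-cong (suc m) eq = cong₂ _+_ (sumTo-cong m (λ s s<m → eq s (ℕ.m≤n⇒m≤1+n s<m))) (eq m ℕ.≤-refl)

sumTo-zero : ∀ {f} m → sumTo f m ≡ 0 → ∀ s → s < m → f s ≡ 0
sumTo-zero {f} (suc m) eq s s<1+m with ℕ.m<1+n⇒m<n∨m≡n s<1+m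
... | inj₁ s<m  = sumTo-zero m (ℕ.m+n≡0⇒m≡0 _ eq) s s<m
... | inj₂ refl = ℕ.m+n≡0⇒n≡0 (sumTo f m) eq

sumTo-positive : ∀ {f} m → sumTo f m ≢ 0 → ∃[ s ] s < m × f s ≢ 0
sumTo-positive zero ne = contradiction refl ne
sumTo-positive {f} (suc m) ne with f m in eq
... | suc k = m , ℕ.≤-refl , λ z → contradiction (trans (sym eq) z) λ ()
... | zero with sumTo-positive m (λ z → ne (trans (cong (_+ 0) z) refl))
... | s , s<m , fs = s , ℕ.m≤n⇒m≤1+n s<m , fs

sumTo-suc : ∀ f m → sumTo f (suc m) ≡ f 0 + sumTo (f ∘ suc) m
sumTo-suc f zero    = ℕ.+-comm 0 (f 0)
sumTo-suc f (suc m) = trans (cong (_+ f (suc m)) (sumTo-suc f m)) (ℕ.+-assoc (f 0) _ _)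

sumTo-* : ∀ k f m → sumTo (λ s → k * f s) m ≡ k * sumTo f m
sumTo-* k f zero    = sym (ℕ.*-zeroʳ k)
sumTo-* k f (suc m) = trans (cong (_+ k * f m) (sumTo-* k f m)) (sym (ℕ.*-distribˡ-+ k (sumTo f m) (f m)))

sumTo-≥ : ∀ f m → (∀ s → 1 ≤ f s) → m ≤ sumTo f m
sumTo-≥ f zero    pos = z≤n
sumTo-≥ f (suc m) pos = subst (_≤ sumTo f m + f m) (ℕ.+-comm m 1) (ℕ.+-mono-≤ (sumTo-≥ f m pos) (pos m))

table : ∀ k → (Fin k → ℕ) → ℕ → ℕ
table zero    f x       = 0
table (suc k) f zero    = f 0F
table (suc k) f (suc x) = table k (f ∘ suc) x

tableᶜ : ∀ k f → Computable₁ (table k f)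
tableᶜ zero    f = computable₁ (constᶜ 0)
tableᶜ (suc k) f = unaryᶜ (comp₁ (tableᶜ k (f ∘ suc)) (varᶜ 0F)) (λ _ → refl)

table-toℕ : ∀ k f (i : Fin k) → table k f (toℕ i) ≡ f i
table-toℕ (suc k) f zero    = refl
table-toℕ (suc k) f (suc i) = table-toℕ k (f ∘ suc) i

-- Digits of codes

module Digits (n : ℕ) where

  -- Digits are obtained by counting up to the number: a successor raises the first digit, or resets
  -- it to 1 with a carry when it is `n`. This makes them primitive recursive without any division.
  firstDigit : ℕ → ℕ
  firstDigit zero    = 0
  firstDigit (suc c) = if does (firstDigit c ℕ.≟ n) then 1 else suc (firstDigit c)

  otherDigits : ℕ → ℕ
  otherDigits zero    = 0
  otherDigits (suc c) = if does (firstDigit c ℕ.≟ n) then suc (otherDigits c) else otherDigits c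

  dropDigits : ℕ → ℕ → ℕ
  dropDigits zero    c = c
  dropDigits (suc s) c = otherDigits (dropDigits s c)

  -- digit s ⌜ u ⌝ is 0 if s ≥ length u and otherwise one more than the letter at s.
  digit : ℕ → ℕ → ℕ
  digit s c = firstDigit (dropDigits s c)

  ifᶜ : ∀ {m} {b x y : Vec ℕ m → ℕ} → Computable b → Computable x → Computable y →
        Computable (λ xs → if does (b xs ℕ.≟ n) then x xs else y xs)
  ifᶜ {b = b} {x} {y} B X Y = computable-cong eq
    (comp₂ addᶜ (comp₂ mulᶜ (comp₁ isZeroᶜ (comp₂ differᶜ B (constᶜ n))) X)
                (comp₂ mulᶜ (comp₁ isPositiveᶜ (comp₂ differᶜ B (constᶜ n))) Y))
    where
    eq : ∀ xs → isZero (differ (b xs) n) * x xs + isPositive (differ (b xs) n) * y xs ≡ (if does (b xs ℕ.≟ n) then x xs else y xs)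
    eq xs = go (b xs ℕ.≟ n)
      where
      go : (d : Dec (b xs ≡ n)) → isZero (differ (b xs) n) * x xs + isPositive (differ (b xs) n) * y xs ≡ (if does d then x xs else y xs)
      go (yes p) rewrite p | differ-refl n = trans (ℕ.+-identityʳ _) (ℕ.+-identityʳ _)
      go (no ¬p) with differ (b xs) n in eq
      ... | zero  = contradiction (differ-≡ (b xs) n eq) ¬p
      ... | suc _ = ℕ.+-identityʳ _

  firstDigitᶜ : Computable₁ firstDigit
  firstDigitᶜ = unaryᶜ (ifᶜ (varᶜ 1F) (constᶜ 1) (comp₁ sucᶜ (varᶜ 1F))) (λ _ → refl)

  otherDigitsᶜ : Computable₁ otherDigits
  otherDigitsᶜ = unaryᶜ (ifᶜ (comp₁ firstDigitᶜ (varᶜ 0F)) (comp₁ sucᶜ (varᶜ 1F)) (varᶜ 1F)) (λ _ → refl)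

  dropDigitsᶜ : Computable₂ dropDigits
  dropDigitsᶜ = binaryᶜ (varᶜ 0F) (comp₁ otherDigitsᶜ (varᶜ 1F)) (λ _ → refl) (λ _ _ → refl)

  digitᶜ : Computable₂ digit
  digitᶜ = computable₂ (comp₁ firstDigitᶜ (comp₂ dropDigitsᶜ (varᶜ 0F) (varᶜ 1F)))

module _ (n′ : ℕ) where
  private n = suc n′
  open Digits n

  digits-carry : ∀ c → firstDigit c ≡ n → firstDigit (suc c) ≡ 1 × otherDigits (suc c) ≡ suc (otherDigits c)
  digits-carry c eq rewrite dec-true (firstDigit c ℕ.≟ n) eq = refl , refl

  digits-stay : ∀ c → firstDigit c ≢ n → firstDigit (suc c) ≡ suc (firstDigit c) × otherDigits (suc c) ≡ otherDigits c
  digits-stay c ne rewrite dec-false (firstDigit c ℕ.≟ n) ne = refl , refl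

  digits-of-sum : ∀ w a → a < n → firstDigit (suc (a + n * w)) ≡ suc a × otherDigits (suc (a + n * w)) ≡ w
  digits-of-sum zero    zero    _ rewrite ℕ.*-zeroʳ n′ = refl , refl
  -- The predecessor of this number has first digit `n` and rest `w`, so the carry occurs exactly
  -- here.
  digits-of-sum (suc w) zero    _ with digits-of-sum w n′ ℕ.≤-refl
  ... | p , q with digits-carry (suc (n′ + n * w)) p
  ... | p′ , q′ = trans (cong firstDigit eq) p′ , trans (cong otherDigits eq) (trans q′ (cong suc q))
    where
    eq : suc (n * suc w) ≡ suc (suc (n′ + n * w))
    eq = cong suc (ℕ.*-suc n w)
  digits-of-sum w       (suc a) a<n with digits-of-sum w a (ℕ.<⇒≤ a<n)
  ... | p , q with digits-stay (suc (a + n * w)) (ℕ.<⇒≢ a<n ∘ trans (sym p))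
  ... | p′ , q′ = trans p′ (cong suc p) , trans q′ q

  dropDigits-other : ∀ s c → dropDigits s (otherDigits c) ≡ otherDigits (dropDigits s c)
  dropDigits-other zero    c = refl
  dropDigits-other (suc s) c = cong otherDigits (dropDigits-other s c)

  digit-zero : ∀ s → digit s 0 ≡ 0
  digit-zero s = cong firstDigit (go s)
    where
    go : ∀ s → dropDigits s 0 ≡ 0
    go zero    = refl
    go (suc s) = cong otherDigits (go s)

  digit-shift : ∀ s (a : Fin n) u → digit (suc s) ⌜ a ∷ u ⌝ ≡ digit s ⌜ u ⌝
  digit-shift s a u = cong firstDigit (trans (sym (dropDigits-other s ⌜ a ∷ u ⌝))
    (cong (dropDigits s) (proj₂ (digits-of-sum ⌜ u ⌝ (toℕ a) (Fin.toℕ<n a)))))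

  digit-< : ∀ (σ : ωWord n) {s m} → s < m → digit s ⌜ σ ↾ m ⌝ ≡ suc (toℕ (σ s))
  digit-< σ {zero}  {suc m} _         = proj₁ (digits-of-sum ⌜ (σ ∘ suc) ↾ m ⌝ (toℕ (σ 0)) (Fin.toℕ<n (σ 0)))
  digit-< σ {suc s} {suc m} (s≤s s<m) = trans (digit-shift s (σ 0) ((σ ∘ suc) ↾ m)) (digit-< (σ ∘ suc) s<m)

  digit-≥ : ∀ (σ : ωWord n) {s m} → m ≤ s → digit s ⌜ σ ↾ m ⌝ ≡ 0
  digit-≥ σ {s}     {zero}  _         = digit-zero s
  digit-≥ σ {suc s} {suc m} (s≤s m≤s) = trans (digit-shift s (σ 0) ((σ ∘ suc) ↾ m)) (digit-≥ (σ ∘ suc) m≤s)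

  -- Computable functions are total on numbers. As every number is a code, a recursive relation on
  -- words becomes such a function without a separate test for codes.
  code-surjective : ∀ c → Σ[ u ∈ List (Fin n) ] ⌜ u ⌝ ≡ c
  code-surjective zero    = [] , refl
  code-surjective (suc c) with code-surjective c
  ... | u , refl = increment u , code-increment u
    where
    increment : List (Fin n) → List (Fin n)
    increment []      = 0F ∷ []
    increment (a ∷ u) with suc (toℕ a) ℕ.<? n
    ... | yes lt = fromℕ< lt ∷ u
    ... | no _   = 0F ∷ increment u
    code-increment : ∀ u → ⌜ increment u ⌝ ≡ suc ⌜ u ⌝
    code-increment []      = cong suc (ℕ.*-zeroʳ n)
    code-increment (a ∷ u) with suc (toℕ a) ℕ.<? n
    ... | yes lt = cong (λ x → suc (x + n * ⌜ u ⌝)) (Fin.toℕ-fromℕ< lt)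
    ... | no ≮   = cong suc (trans (cong (n *_) (code-increment u)) (trans (ℕ.*-suc n ⌜ u ⌝)
                     (cong (_+ n * ⌜ u ⌝) (ℕ.≤-antisym (ℕ.≮⇒≥ ≮) (Fin.toℕ<n a)))))

code-sum : ∀ {n} (σ : ωWord n) m → ⌜ σ ↾ m ⌝ ≡ sumTo (λ s → suc (toℕ (σ s)) * n ^ s) m
code-sum σ zero    = refl
code-sum {n} σ (suc m) = begin
  suc (toℕ (σ 0) + n * ⌜ (σ ∘ suc) ↾ m ⌝)                                   ≡⟨ cong (λ x → suc (toℕ (σ 0) + n * x)) (code-sum (σ ∘ suc) m) ⟩
  suc (toℕ (σ 0)) + n * sumTo (λ s → suc (toℕ (σ (suc s))) * n ^ s) m       ≡⟨ cong (suc (toℕ (σ 0)) +_) (sym (sumTo-* n _ m)) ⟩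
  suc (toℕ (σ 0)) + sumTo (λ s → n * (suc (toℕ (σ (suc s))) * n ^ s)) m     ≡⟨ cong₂ _+_ (sym (ℕ.*-identityʳ _)) (sumTo-cong m λ s _ → swap n (suc (toℕ (σ (suc s)))) (n ^ s)) ⟩
  suc (toℕ (σ 0)) * 1 + sumTo (λ s → suc (toℕ (σ (suc s))) * n ^ suc s) m   ≡⟨ sym (sumTo-suc (λ s → suc (toℕ (σ s)) * n ^ s) m) ⟩
  sumTo (λ s → suc (toℕ (σ s)) * n ^ s) (suc m)                             ∎
  where
  open ≡-Reasoning
  swap : ∀ x y z → x * (y * z) ≡ y * (x * z)
  swap = solve-∀

-- Compilation of partial recursive functions to loop programs

-- loop r c repeats, as long as register r is positive: decrement r, then c.
data Instr : Set where
  incr : ℕ → Instr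
  loop : ℕ → List Instr → Instr

Registers : Set
Registers = ℕ → ℕ

set : Registers → ℕ → ℕ → Registers
set ρ r v s = if does (s ℕ.≟ r) then v else ρ s

set-same : ∀ ρ r v → set ρ r v r ≡ v
set-same ρ r v rewrite dec-true (r ℕ.≟ r) refl = refl

set-other : ∀ ρ {r s} v → s ≢ r → set ρ r v s ≡ ρ s
set-other ρ {r} {s} v s≢r rewrite dec-false (s ℕ.≟ r) s≢r = refl

data Steps : List Instr → Registers → List Instr → Registers → Set where
  stop  : ∀ {κ ρ} → Steps κ ρ κ ρ
  incr  : ∀ {r κ ρ κ′ ρ′} → Steps κ (set ρ r (suc (ρ r))) κ′ ρ′ → Steps (incr r ∷ κ) ρ κ′ ρ′
  exit  : ∀ {r c κ ρ κ′ ρ′} → ρ r ≡ 0 → Steps κ ρ κ′ ρ′ → Steps (loop r c ∷ κ) ρ κ′ ρ′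
  enter : ∀ {r c κ ρ κ′ ρ′} v → ρ r ≡ suc v → Steps (c ++ loop r c ∷ κ) (set ρ r v) κ′ ρ′ → Steps (loop r c ∷ κ) ρ κ′ ρ′

steps-trans : ∀ {κ ρ κ′ ρ′ κ″ ρ″} → Steps κ ρ κ′ ρ′ → Steps κ′ ρ′ κ″ ρ″ → Steps κ ρ κ″ ρ″
steps-trans stop          q = q
steps-trans (incr p)      q = incr (steps-trans p q)
steps-trans (exit z p)    q = exit z (steps-trans p q)
steps-trans (enter v e p) q = enter v e (steps-trans p q)

-- One final state serves all continuations, which is what makes executions compose.
Exec : List Instr → Registers → (Registers → Set) → Set
Exec c ρ Q = Σ[ ρ′ ∈ Registers ] (∀ κ → Steps (c ++ κ) ρ κ ρ′) × Q ρ′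

exec-[] : ∀ {ρ Q} → Q ρ → Exec [] ρ Q
exec-[] q = _ , (λ κ → stop) , q

exec-++ : ∀ {c c′ ρ Q Q′} → Exec c ρ Q → (∀ ρ′ → Q ρ′ → Exec c′ ρ′ Q′) → Exec (c ++ c′) ρ Q′
exec-++ {c} {c′} {ρ} (ρ′ , p , q) next with next ρ′ q
... | ρ″ , p′ , q′ = ρ″ , (λ κ → subst (λ l → Steps l ρ κ ρ″) (sym (++-assoc c c′ κ)) (steps-trans (p (c′ ++ κ)) (p′ κ))) , q′

exec-incr : ∀ {r c ρ Q} → Exec c (set ρ r (suc (ρ r))) Q → Exec (incr r ∷ c) ρ Q
exec-incr (ρ′ , p , q) = ρ′ , (λ κ → incr (p κ)) , q

exec-weaken : ∀ {c ρ Q Q′} → Exec c ρ Q → (∀ ρ′ → Q ρ′ → Q′ ρ′) → Exec c ρ Q′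
exec-weaken (ρ′ , p , q) f = ρ′ , p , f ρ′ q

-- I k holds before the last k iterations.
exec-loop : ∀ {r c} (I : ℕ → Registers → Set) →
            (∀ k ρ → I (suc k) ρ → ∃[ v ] ρ r ≡ suc v × Exec c (set ρ r v) (I k)) →
            (∀ ρ → I 0 ρ → ρ r ≡ 0) →
            ∀ k {ρ} → I k ρ → Exec (loop r c ∷ []) ρ (I 0)
exec-loop I body end zero    {ρ} i = ρ , (λ κ → exit (end ρ i) stop) , i
exec-loop {r} {c} I body end (suc k) {ρ} i with body k ρ i
... | v , eq , ρ′ , p , i′ with exec-loop I body end k i′
... | ρ″ , p′ , i″ = ρ″ , (λ κ → enter v eq (steps-trans (p (loop r c ∷ κ)) (p′ κ))) , i″

Sets : Registers → ℕ → ℕ → Registers → Set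
Sets ρ r v ρ′ = ∀ s → ρ′ s ≡ set ρ r v s

exec-clear : ∀ r ρ → Exec (loop r [] ∷ []) ρ (Sets ρ r 0)
exec-clear r ρ = exec-weaken (exec-loop I body (λ _ → proj₁) (ρ r) (refl , λ _ _ → refl)) finish
  where
  I : ℕ → Registers → Set
  I k ρ′ = ρ′ r ≡ k × (∀ s → s ≢ r → ρ′ s ≡ ρ s)
  body : ∀ k ρ′ → I (suc k) ρ′ → ∃[ v ] ρ′ r ≡ suc v × Exec [] (set ρ′ r v) (I k)
  body k ρ′ (eq , same) = k , eq , exec-[] (set-same ρ′ r k , λ s s≢r → trans (set-other ρ′ k s≢r) (same s s≢r))
  finish : ∀ ρ′ → I 0 ρ′ → Sets ρ r 0 ρ′
  finish ρ′ (eq , same) s with s ℕ.≟ r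
  ... | yes refl = trans eq (sym (set-same ρ s 0))
  ... | no s≢r   = trans (same s s≢r) (sym (set-other ρ 0 s≢r))

Moves : Registers → ℕ → ℕ → Registers → Set
Moves ρ x y ρ′ = ρ′ x ≡ 0 × ρ′ y ≡ ρ y + ρ x × (∀ s → s ≢ x → s ≢ y → ρ′ s ≡ ρ s)

exec-move : ∀ {x y} ρ → x ≢ y → Exec (loop x (incr y ∷ []) ∷ []) ρ (Moves ρ x y)
exec-move {x} {y} ρ x≢y = exec-weaken (exec-loop I body (λ _ → proj₁) (ρ x) (refl , refl , λ _ _ _ → refl))
    λ { ρ′ (p , q , same) → p , trans (sym (ℕ.+-identityʳ _)) q , same }
  where
  I : ℕ → Registers → Set
  I k ρ′ = ρ′ x ≡ k × ρ′ y + k ≡ ρ y + ρ x × (∀ s → s ≢ x → s ≢ y → ρ′ s ≡ ρ s)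
  body : ∀ k ρ′ → I (suc k) ρ′ → ∃[ v ] ρ′ x ≡ suc v × Exec (incr y ∷ []) (set ρ′ x v) (I k)
  body k ρ′ (p , q , same) = k , p , exec-incr (exec-[]
    ( trans (set-other ρ₁ _ x≢y) (set-same ρ′ x k)
    , trans (cong (_+ k) (trans (set-same ρ₁ y _) (cong suc (set-other ρ′ k (≢-sym x≢y))))) (trans (sym (ℕ.+-suc (ρ′ y) k)) q)
    , λ s s≢x s≢y → trans (set-other ρ₁ _ s≢y) (trans (set-other ρ′ k s≢x) (same s s≢x s≢y))))
    where ρ₁ = set ρ′ x k

-- A loop consumes its register, so a second copy is made in `z` and poured back.
copy-to : ℕ → ℕ → ℕ → List Instr
copy-to x y z = loop x (incr y ∷ incr z ∷ []) ∷ loop z (incr x ∷ []) ∷ []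

exec-copy : ∀ {x y z} ρ → x ≢ y → x ≢ z → y ≢ z → ρ y ≡ 0 → ρ z ≡ 0 → Exec (copy-to x y z) ρ (Sets ρ y (ρ x))
exec-copy {x} {y} {z} ρ x≢y x≢z y≢z y0 z0 = exec-++
    (exec-loop I body (λ _ → proj₁) (ρ x) (refl , cong (_+ ρ x) y0 , cong (_+ ρ x) z0 , λ _ _ _ _ → refl))
    λ ρ′ i → exec-weaken (exec-move ρ′ (≢-sym x≢z)) (finish ρ′ i)
  where
  I : ℕ → Registers → Set
  I k ρ′ = ρ′ x ≡ k × ρ′ y + k ≡ ρ x × ρ′ z + k ≡ ρ x × (∀ s → s ≢ x → s ≢ y → s ≢ z → ρ′ s ≡ ρ s)
  body : ∀ k ρ′ → I (suc k) ρ′ → ∃[ v ] ρ′ x ≡ suc v × Exec (incr y ∷ incr z ∷ []) (set ρ′ x v) (I k)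
  body k ρ′ (p , q , r , same) = k , p , exec-incr (exec-incr (exec-[]
    ( trans (set-other ρ₂ _ x≢z) (trans (set-other ρ₁ _ x≢y) (set-same ρ′ x k))
    , trans (cong (_+ k) (trans (set-other ρ₂ _ y≢z) (trans (set-same ρ₁ y _) (cong suc (set-other ρ′ k (≢-sym x≢y))))))
        (trans (sym (ℕ.+-suc (ρ′ y) k)) q)
    , trans (cong (_+ k) (trans (set-same ρ₂ z _) (cong suc (trans (set-other ρ₁ _ (≢-sym y≢z)) (set-other ρ′ k (≢-sym x≢z))))))
        (trans (sym (ℕ.+-suc (ρ′ z) k)) r)
    , λ s s≢x s≢y s≢z → trans (set-other ρ₂ _ s≢z) (trans (set-other ρ₁ _ s≢y) (trans (set-other ρ′ k s≢x) (same s s≢x s≢y s≢z))))))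
    where
    ρ₁ = set ρ′ x k
    ρ₂ = set ρ₁ y (suc (ρ₁ y))
  finish : ∀ ρ′ → I 0 ρ′ → ∀ ρ″ → Moves ρ′ z x ρ″ → Sets ρ y (ρ x) ρ″
  finish ρ′ (p , q , r , same) ρ″ (z≡ , x≡ , same′) s with s ℕ.≟ y
  ... | yes refl = trans (same′ s y≢z (≢-sym x≢y)) (trans (sym (ℕ.+-identityʳ _)) (trans q (sym (set-same ρ s (ρ x)))))
  ... | no s≢y with s ℕ.≟ x | s ℕ.≟ z
  ... | yes refl | _        = trans x≡ (trans (cong (_+ ρ′ z) p) (trans (trans (sym (ℕ.+-identityʳ _)) r) (sym (set-other ρ (ρ s) s≢y))))
  ... | no _     | yes refl = trans z≡ (sym (trans (set-other ρ (ρ x) s≢y) z0))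
  ... | no s≢x   | no s≢z   = trans (same′ s s≢z s≢x) (trans (same s s≢x s≢y s≢z) (sym (set-other ρ (ρ x) s≢y)))

registersFrom : ℕ → ∀ m → Vec ℕ m
registersFrom o m = tabulate λ i → o + toℕ i

clearFrom : ℕ → ℕ → List Instr
clearFrom o zero    = []
clearFrom o (suc m) = (loop o [] ∷ []) ++ clearFrom (suc o) m

mutual
  -- The value is put into register out; the registers from b on are scratch.
  compile : ∀ {n} → Rec n → Vec ℕ n → ℕ → ℕ → List Instr
  compile zeroᴿ        _          out b = []
  compile sucᴿ         (x ∷ [])   out b = copy-to x out b ++ incr out ∷ []
  compile (projᴿ i)    xs         out b = copy-to (lookup xs i) out b
  compile (compᴿ {m} f gs) xs     out b =
    compileAll gs xs b (b + m) ++ compile f (registersFrom b m) out (b + m) ++ clearFrom b m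
  compile (precᴿ f g)  (x ∷ xs)   out b =
    copy-to x b (1 + b) ++ compile f xs (2 + b) (4 + b) ++
    (loop b (compile g (1 + b ∷ 2 + b ∷ xs) (3 + b) (4 + b) ++ (loop (2 + b) [] ∷ []) ++
             (loop (3 + b) (incr (2 + b) ∷ []) ∷ []) ++ incr (1 + b) ∷ []) ∷ []) ++
    (loop (2 + b) (incr out ∷ []) ∷ []) ++ loop (1 + b) [] ∷ []
  compile (muᴿ f)      xs         out b =
    compile f (b ∷ xs) (1 + b) (2 + b) ++
    (loop (1 + b) ((loop (1 + b) [] ∷ []) ++ incr b ∷ compile f (b ∷ xs) (1 + b) (2 + b)) ∷ []) ++
    loop b (incr out ∷ []) ∷ []

  compileAll : ∀ {n m} → Vec (Rec n) m → Vec ℕ n → ℕ → ℕ → List Instr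
  compileAll []       xs o b = []
  compileAll (g ∷ gs) xs o b = compile g xs o b ++ compileAll gs xs (suc o) b

Clear : ℕ → Registers → Set
Clear b ρ = ∀ s → b ≤ s → ρ s ≡ 0

record Ready {n} (xs : Vec ℕ n) (out b : ℕ) (vs : Vec ℕ n) (ρ : Registers) : Set where
  field
    below     : ∀ i → lookup xs i < b
    out-below : out < b
    distinct  : ∀ i → lookup xs i ≢ out
    clear     : Clear b ρ
    out-zero  : ρ out ≡ 0
    inputs    : ∀ i → ρ (lookup xs i) ≡ lookup vs i

exec-clearFrom : ∀ o m ρ → Clear (o + m) ρ → Exec (clearFrom o m) ρ (λ ρ′ → (∀ s → s < o → ρ′ s ≡ ρ s) × Clear o ρ′)
exec-clearFrom o zero    ρ cl = exec-[] ((λ _ _ → refl) , subst (λ k → Clear k ρ) (ℕ.+-identityʳ o) cl)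
exec-clearFrom o (suc m) ρ cl = exec-++ (exec-clear o ρ) λ ρ₁ eq →
  exec-weaken (exec-clearFrom (suc o) m ρ₁ λ s le → trans (eq s) (trans
      (set-other ρ 0 (ℕ.>⇒≢ (ℕ.≤-trans (s≤s (ℕ.m≤m+n o m)) le))) (cl s (subst (_≤ s) (sym (ℕ.+-suc o m)) le))))
    λ ρ₂ (same , cl₂) → (λ s s<o → trans (same s (ℕ.m≤n⇒m≤1+n s<o)) (trans (eq s) (set-other ρ 0 (ℕ.<⇒≢ s<o)))) ,
      λ s o≤s → case ℕ.m≤n⇒m<n∨m≡n o≤s of λ
        { (inj₁ o<s)  → cl₂ s o<s
        ; (inj₂ refl) → trans (same o ℕ.≤-refl) (trans (eq o) (set-same ρ o 0)) }

-- The derivation of a primitive recursion descends from its argument to 0, while the compiled loop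
-- counts upwards; a trace is the derivation in the order of the loop.
data Trace {n} (g : Rec (2 + n)) (vs : Vec ℕ n) (y : ℕ) : ℕ → ℕ → ℕ → Set where
  finished : ∀ {i} → Trace g vs y i y 0
  iterate  : ∀ {i v v′ k} → g [ i ∷ v ∷ vs ]↓ v′ → Trace g vs y (suc i) v′ k → Trace g vs y i v (suc k)

trace-snoc : ∀ {n g} {vs : Vec ℕ n} {y z i v k} → Trace g vs y i v k → g [ i + k ∷ y ∷ vs ]↓ z → Trace g vs z i v (suc k)
trace-snoc {g = g} {vs} {y} {z} {i} finished d = iterate (subst (λ j → g [ j ∷ y ∷ vs ]↓ z) (ℕ.+-identityʳ i) d) finished
trace-snoc {g = g} {vs} {y} {z} {i} {k = suc k} (iterate e t) d = iterate e (trace-snoc t (subst (λ j → g [ j ∷ y ∷ vs ]↓ z) (ℕ.+-suc i k) d))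

trace : ∀ {n f g} {vs : Vec ℕ n} {x y} → precᴿ f g [ x ∷ vs ]↓ y → ∃[ v ] f [ vs ]↓ v × Trace g vs y 0 v x
trace (prec↓0 d) = _ , d , finished
trace (prec↓s d e) with trace d
... | v , d₀ , t = v , d₀ , trace-snoc t e

sets-self : ∀ ρ {r v} → ρ r ≡ v → Sets ρ r v ρ
sets-self ρ {r} {v} eq s with s ℕ.≟ r
... | yes refl = trans eq (sym (set-same ρ s v))
... | no s≢r   = sym (set-other ρ v s≢r)

at-set : ∀ {ρ r v ρ′} → Sets ρ r v ρ′ → ρ′ r ≡ v
at-set {ρ} {r} {v} eq = trans (eq r) (set-same ρ r v)

off-set : ∀ {ρ r v ρ′ s} → Sets ρ r v ρ′ → s ≢ r → ρ′ s ≡ ρ s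
off-set {ρ} {r} {v} {s = s} eq s≢r = trans (eq s) (set-other ρ v s≢r)

sets-intro : ∀ {ρ r v} ρ′ → ρ′ r ≡ v → (∀ s → s ≢ r → ρ′ s ≡ ρ s) → Sets ρ r v ρ′
sets-intro {ρ} {r} {v} ρ′ eq same s with s ℕ.≟ r
... | yes refl = trans eq (sym (set-same ρ s v))
... | no s≢r   = trans (same s s≢r) (sym (set-other ρ v s≢r))

clear-extend : ∀ {b ρ} → ρ b ≡ 0 → Clear (suc b) ρ → Clear b ρ
clear-extend z cl s b≤s with ℕ.m≤n⇒m<n∨m≡n b≤s
... | inj₁ b<s  = cl s b<s
... | inj₂ refl = z

-- With numerals for `k` and `l` the implicit argument is found by evaluation, so scratch registers
-- are told apart without proof.
shifted-≢ : ∀ k l b {_ : T (not (does (k ℕ.≟ l)))} → k + b ≢ l + b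
shifted-≢ k l b {ne} eq = contradiction (ℕ.+-cancelʳ-≡ b k l eq) (λ { refl → absurd ne })
  where
  absurd : ¬ T (not (does (k ℕ.≟ k)))
  absurd t rewrite dec-true (k ℕ.≟ k) refl = t

above-≢ : ∀ {b s} k → s < b → s ≢ k + b
above-≢ {b} k s<b = ℕ.<⇒≢ (ℕ.<-≤-trans s<b (ℕ.m≤n+m b k))

restored : ∀ {ρ ρ′ out v b} → Clear b ρ → Clear b ρ′ → ρ′ out ≡ v → (∀ s → s < b → s ≢ out → ρ′ s ≡ ρ s) → Sets ρ out v ρ′
restored {ρ′ = ρ′} {b = b} cl cl′ eq same = sets-intro ρ′ eq λ s s≢out → case ℕ.<-≤-connex s b of λ
  { (inj₁ s<b) → same s s<b s≢out
  ; (inj₂ b≤s) → trans (cl′ s b≤s) (sym (cl s b≤s)) }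

mutual
  compile-correct : ∀ {n} (f : Rec n) {vs y} → f [ vs ]↓ y → ∀ {xs out b ρ} → Ready xs out b vs ρ →
                    Exec (compile f xs out b) ρ (Sets ρ out y)
  compile-correct zeroᴿ zero↓ {ρ = ρ} R = exec-[] (sets-self ρ (Ready.out-zero R))
  compile-correct sucᴿ suc↓ {x ∷ []} {out} {b} {ρ} R = exec-++
      (exec-copy ρ (distinct 0F) (ℕ.<⇒≢ (below 0F)) (ℕ.<⇒≢ out-below) out-zero (clear b ℕ.≤-refl))
      λ ρ₁ eq → exec-incr (exec-[] (sets-intro (set ρ₁ out (suc (ρ₁ out)))
        (trans (set-same ρ₁ out _) (cong suc (trans (at-set {ρ} {out} eq) (inputs 0F))))
        λ s s≢out → trans (set-other ρ₁ _ s≢out) (off-set {ρ} eq s≢out)))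
    where open Ready R
  compile-correct (projᴿ i) (proj↓ i) {xs} {out} {b} {ρ} R =
    subst (λ v → Exec (copy-to (lookup xs i) out b) ρ (Sets ρ out v)) (inputs i)
      (exec-copy ρ (distinct i) (ℕ.<⇒≢ (below i)) (ℕ.<⇒≢ out-below) out-zero (clear b ℕ.≤-refl))
    where open Ready R
  compile-correct (compᴿ {m} f gs) (comp↓ {ys = ys} {z = z} ds d) {xs} {out} {b} {ρ} R = exec-++
      (compileAll-correct gs {ys = ys} ds below ℕ.≤-refl clear inputs)
      λ ρ₁ (same₁ , values , clear₁) → exec-++
        (compile-correct f d (record
          { below     = λ i → subst (_< b + m) (sym (Vec.lookup∘tabulate _ i)) (ℕ.+-monoʳ-< b (Fin.toℕ<n i))
          ; out-below = ℕ.<-≤-trans out-below (ℕ.m≤m+n b m)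
          ; distinct  = λ i eq → ℕ.<⇒≱ out-below (subst (b ≤_) (trans (sym (Vec.lookup∘tabulate _ i)) eq) (ℕ.m≤m+n b (toℕ i)))
          ; clear     = clear₁
          ; out-zero  = trans (same₁ out out-below) out-zero
          ; inputs    = λ i → trans (cong ρ₁ (Vec.lookup∘tabulate _ i)) (values i)
          }))
        λ ρ₂ eq₂ → exec-weaken (exec-clearFrom b m ρ₂ λ s le →
            trans (off-set {ρ₁} eq₂ (ℕ.>⇒≢ (ℕ.<-≤-trans out-below (ℕ.≤-trans (ℕ.m≤m+n b m) le)))) (clear₁ s le))
          λ ρ₃ (same₃ , clear₃) → restored clear clear₃
            (trans (same₃ out out-below) (at-set {ρ₁} {out} eq₂))
            λ s s<b s≢out → trans (same₃ s s<b) (trans (off-set {ρ₁} eq₂ s≢out) (same₁ s s<b))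
    where open Ready R
  compile-correct (precᴿ f g) {v₀ ∷ vs} {y} d {x ∷ xs} {out} {b} {ρ} R with trace d
  ... | v , df , tr = exec-++
      (exec-copy ρ (above-≢ 0 (below 0F)) (above-≢ 1 (below 0F)) (shifted-≢ 0 1 b) (clear b ℕ.≤-refl) (clear (1 + b) (ℕ.n≤1+n b)))
      λ ρ₁ eq₁ → exec-++ (compile-correct f df (record
          { below     = λ i → ℕ.<-≤-trans (below (suc i)) (ℕ.m≤n+m b 4)
          ; out-below = ℕ.+-monoˡ-< b {2} {4} (s≤s (s≤s (s≤s z≤n)))
          ; distinct  = λ i → above-≢ 2 (below (suc i))
          ; clear     = λ s le → trans (off-set {ρ} eq₁ (ℕ.>⇒≢ (ℕ.<-≤-trans (ℕ.m<n+m b {4} (s≤s z≤n)) le))) (clear s (ℕ.≤-trans (ℕ.m≤n+m b 4) le))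
          ; out-zero  = trans (off-set {ρ} eq₁ (shifted-≢ 2 0 b)) (clear (2 + b) (ℕ.m≤n+m b 2))
          ; inputs    = λ i → trans (off-set {ρ} eq₁ (above-≢ 0 (below (suc i)))) (inputs (suc i))
          }))
      λ ρ₂ eq₂ → exec-++ (exec-loop I body (λ ρ′ i → proj₁ (proj₂ (proj₂ (proj₂ i)))) v₀
        ( 0 , v , tr
        , trans (off-set {ρ₁} eq₂ (shifted-≢ 0 2 b)) (trans (at-set {ρ} eq₁) (inputs 0F))
        , trans (off-set {ρ₁} eq₂ (shifted-≢ 1 2 b)) (trans (off-set {ρ} eq₁ (shifted-≢ 1 0 b)) (clear (1 + b) (ℕ.n≤1+n b)))
        , at-set {ρ₁} {2 + b} eq₂
        , (λ s le → trans (off-set {ρ₁} eq₂ (ℕ.>⇒≢ le)) (trans (off-set {ρ} eq₁ (ℕ.>⇒≢ (ℕ.<-≤-trans (ℕ.m<n+m b {3} (s≤s z≤n)) le))) (clear s (ℕ.≤-trans (ℕ.m≤n+m b 3) le))))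
        , λ s s<b → trans (off-set {ρ₁} eq₂ (above-≢ 2 s<b)) (off-set {ρ} eq₁ (above-≢ 0 s<b))
        ))
      λ { ρ₃ (i , _ , finished , cnt , idx , acc , cl , same) → exec-++ (exec-move ρ₃ (≢-sym (above-≢ 2 out-below)))
        λ ρ₄ (from0 , to , others) → exec-weaken (exec-clear (1 + b) ρ₄) λ ρ₅ eq₅ → restored clear
          (clear-extend (trans (off-set {ρ₄} eq₅ (shifted-≢ 0 1 b)) (trans (others b (shifted-≢ 0 2 b) (≢-sym (above-≢ 0 out-below))) cnt))
          (clear-extend (at-set {ρ₄} {1 + b} eq₅)
          (clear-extend (trans (off-set {ρ₄} eq₅ (shifted-≢ 2 1 b)) from0)
            λ s le → trans (off-set {ρ₄} eq₅ (ℕ.>⇒≢ (ℕ.<-≤-trans (ℕ.n<1+n _) (ℕ.<⇒≤ le))))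
              (trans (others s (ℕ.>⇒≢ le) (ℕ.>⇒≢ (ℕ.<-≤-trans out-below (ℕ.≤-trans (ℕ.m≤n+m b 3) le)))) (cl s le)))))
          (trans (off-set {ρ₄} eq₅ (above-≢ 1 out-below)) (trans to (cong₂ _+_ (trans (same out out-below) out-zero) acc)))
          λ s s<b s≢out → trans (off-set {ρ₄} eq₅ (above-≢ 1 s<b)) (trans (others s (above-≢ 2 s<b) s≢out) (same s s<b)) }
    where
    open Ready R
    -- With `k` rounds to go, `b` holds `k`, `1 + b` the index and `2 + b` the value so far; the
    -- trace is the part of the derivation that still has to be executed.
    I : ℕ → Registers → Set
    I k ρ′ = ∃[ i ] ∃[ v ] Trace g vs y i v k × ρ′ b ≡ k × ρ′ (1 + b) ≡ i × ρ′ (2 + b) ≡ v × Clear (3 + b) ρ′ ×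
             (∀ s → s < b → ρ′ s ≡ ρ s)
    body : ∀ k ρ′ → I (suc k) ρ′ → ∃[ w ] ρ′ b ≡ suc w ×
           Exec (compile g (1 + b ∷ 2 + b ∷ xs) (3 + b) (4 + b) ++ (loop (2 + b) [] ∷ []) ++
                 (loop (3 + b) (incr (2 + b) ∷ []) ∷ []) ++ incr (1 + b) ∷ []) (set ρ′ b w) (I k)
    body k ρ′ (i , v , iterate {v′ = v′} dg tr , cnt , idx , acc , cl , same) = k , cnt , exec-++
        (compile-correct g dg (record
          { below     = λ { 0F → ℕ.+-monoˡ-< b {1} {4} (s≤s (s≤s z≤n)) ; 1F → ℕ.+-monoˡ-< b {2} {4} (s≤s (s≤s (s≤s z≤n)))
                          ; (suc (suc j)) → ℕ.<-≤-trans (below (suc j)) (ℕ.m≤n+m b 4) }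
          ; out-below = ℕ.+-monoˡ-< b {3} {4} ℕ.≤-refl
          ; distinct  = λ { 0F → shifted-≢ 1 3 b ; 1F → shifted-≢ 2 3 b ; (suc (suc j)) → above-≢ 3 (below (suc j)) }
          ; clear     = λ s le → trans (off₀ (ℕ.>⇒≢ (ℕ.<-≤-trans (ℕ.m<n+m b {4} (s≤s z≤n)) le))) (cl s (ℕ.<⇒≤ le))
          ; out-zero  = trans (off₀ (shifted-≢ 3 0 b)) (cl (3 + b) ℕ.≤-refl)
          ; inputs    = λ { 0F → trans (off₀ (shifted-≢ 1 0 b)) idx ; 1F → trans (off₀ (shifted-≢ 2 0 b)) acc
                          ; (suc (suc j)) → trans (off₀ (above-≢ 0 (below (suc j)))) (trans (same _ (below (suc j))) (inputs (suc j))) }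
          }))
        λ ρ₁ eq₁ → exec-++ (exec-clear (2 + b) ρ₁) λ ρ₂ eq₂ → exec-++ (exec-move ρ₂ (shifted-≢ 3 2 b)) λ ρ₃ (from0 , to , others) →
          let off₃ : ∀ {s} → s ≢ 1 + b → set ρ₃ (1 + b) (suc (ρ₃ (1 + b))) s ≡ ρ₃ s
              off₃ = set-other ρ₃ (suc (ρ₃ (1 + b)))
              keep : ∀ {s} → s ≢ 3 + b → s ≢ 2 + b → s ≢ b → ρ₃ s ≡ ρ′ s
              keep {s} s≢3 s≢2 s≢0 = trans (others s s≢3 s≢2) (trans (off-set {ρ₁} eq₂ s≢2) (trans (off-set {set ρ′ b k} eq₁ s≢3) (off₀ s≢0)))
          in exec-incr (exec-[]
            ( suc i , v′ , tr
            , trans (off₃ (shifted-≢ 0 1 b)) (trans (others b (shifted-≢ 0 3 b) (shifted-≢ 0 2 b)) (trans (off-set {ρ₁} eq₂ (shifted-≢ 0 2 b))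
                (trans (off-set {set ρ′ b k} eq₁ (shifted-≢ 0 3 b)) (set-same ρ′ b k))))
            , trans (set-same ρ₃ (1 + b) _) (cong suc (trans (keep (shifted-≢ 1 3 b) (shifted-≢ 1 2 b) (shifted-≢ 1 0 b)) idx))
            , trans (off₃ (shifted-≢ 2 1 b)) (trans to (cong₂ _+_ (at-set {ρ₁} {2 + b} eq₂)
                (trans (off-set {ρ₁} eq₂ (shifted-≢ 3 2 b)) (at-set {set ρ′ b k} {3 + b} eq₁))))
            , clear-extend (trans (off₃ (shifted-≢ 3 1 b)) from0)
                (λ s le → trans (off₃ (ℕ.>⇒≢ (ℕ.<-≤-trans (ℕ.+-monoˡ-< b {1} {4} (s≤s (s≤s z≤n))) le)))
                  (trans (keep (ℕ.>⇒≢ le) (ℕ.>⇒≢ (ℕ.<⇒≤ le)) (ℕ.>⇒≢ (ℕ.<-≤-trans (ℕ.m<n+m b {4} (s≤s z≤n)) le))) (cl s (ℕ.<⇒≤ le))))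
            , λ s s<b → trans (off₃ (above-≢ 1 s<b)) (trans (keep (above-≢ 3 s<b) (above-≢ 2 s<b) (above-≢ 0 s<b)) (same s s<b))
            ))
      where
      off₀ : ∀ {s} → s ≢ b → set ρ′ b k s ≡ ρ′ s
      off₀ = set-other ρ′ k
  compile-correct (muᴿ f) {vs} {y} (mu↓ before d) {xs} {out} {b} {ρ} R = exec-++
      (search y 0 ρ refl (clear b ℕ.≤-refl) (λ s le → clear s (ℕ.<⇒≤ le)) (λ _ _ → refl))
      λ ρ₁ i₁ → exec-++ (exec-loop I body (λ { ρ′ (_ , _ , _ , flag , _) → flag }) y i₁)
        λ { ρ₂ (i , i≡y , idx , flag , cl , same) → exec-weaken (exec-move ρ₂ (≢-sym (above-≢ 0 out-below)))
          λ ρ₃ (from0 , to , others) → restored clear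
            (clear-extend from0 (clear-extend (trans (others (1 + b) (shifted-≢ 1 0 b) (≢-sym (above-≢ 1 out-below))) flag)
              λ s le → trans (others s (ℕ.>⇒≢ (ℕ.<⇒≤ le)) (ℕ.>⇒≢ (ℕ.<-≤-trans out-below (ℕ.≤-trans (ℕ.m≤n+m b 2) le)))) (cl s le)))
            (trans to (cong₂ _+_ (trans (same out out-below) out-zero) (trans idx (trans (sym (ℕ.+-identityʳ i)) i≡y))))
            λ s s<b s≢out → trans (others s (above-≢ 0 s<b) s≢out) (same s s<b) }
    where
    open Ready R
    -- Register `1 + b` holds the value of `f` at the current candidate, which becomes zero only
    -- when no candidate is left before `y`.
    Flag : ℕ → ℕ → Set
    Flag zero    w = w ≡ 0
    Flag (suc _) w = ∃[ v ] w ≡ suc v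
    I : ℕ → Registers → Set
    I k ρ′ = ∃[ i ] i + k ≡ y × ρ′ b ≡ i × Flag k (ρ′ (1 + b)) × Clear (2 + b) ρ′ × (∀ s → s < b → ρ′ s ≡ ρ s)
    search : ∀ k i ρ′ → i + k ≡ y → ρ′ b ≡ i → Clear (1 + b) ρ′ → (∀ s → s < b → ρ′ s ≡ ρ s) →
             Exec (compile f (b ∷ xs) (1 + b) (2 + b)) ρ′ (I k)
    search k i ρ′ i+k≡y idx cl same = flagged k refl i+k≡y
      where
      ready : Ready (b ∷ xs) (1 + b) (2 + b) (i ∷ vs) ρ′
      ready = record
        { below     = λ { 0F → ℕ.m<n+m b {2} (s≤s z≤n) ; (suc j) → ℕ.<-≤-trans (below j) (ℕ.m≤n+m b 2) }
        ; out-below = ℕ.+-monoˡ-< b {1} {2} ℕ.≤-refl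
        ; distinct  = λ { 0F → shifted-≢ 0 1 b ; (suc j) → above-≢ 1 (below j) }
        ; clear     = λ s le → cl s (ℕ.<⇒≤ le)
        ; out-zero  = cl (1 + b) ℕ.≤-refl
        ; inputs    = λ { 0F → idx ; (suc j) → trans (same _ (below j)) (inputs j) }
        }
      conclude : ∀ {w} → Flag k w → ∀ ρ″ → Sets ρ′ (1 + b) w ρ″ → I k ρ″
      conclude fl ρ″ eq = i , i+k≡y , trans (off-set {ρ′} eq (shifted-≢ 0 1 b)) idx , subst (Flag k) (sym (at-set {ρ′} {1 + b} eq)) fl ,
        (λ s le → trans (off-set {ρ′} eq (ℕ.>⇒≢ le)) (cl s (ℕ.<⇒≤ le))) ,
        λ s s<b → trans (off-set {ρ′} eq (above-≢ 1 s<b)) (same s s<b)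
      flagged : ∀ k′ → k ≡ k′ → i + k′ ≡ y → Exec (compile f (b ∷ xs) (1 + b) (2 + b)) ρ′ (I k)
      flagged zero     refl eq = exec-weaken (compile-correct f (subst (λ j → f [ j ∷ vs ]↓ 0) (trans (sym eq) (ℕ.+-identityʳ i)) d) ready) (conclude refl)
      flagged (suc k′) refl eq with before i (subst (i <_) eq (ℕ.m<m+n i (s≤s z≤n)))
      ... | v , df = exec-weaken (compile-correct f df ready) (conclude (v , refl))
    body : ∀ k ρ′ → I (suc k) ρ′ → ∃[ w ] ρ′ (1 + b) ≡ suc w ×
           Exec ((loop (1 + b) [] ∷ []) ++ incr b ∷ compile f (b ∷ xs) (1 + b) (2 + b)) (set ρ′ (1 + b) w) (I k)
    body k ρ′ (i , i+k≡y , idx , (w , fl) , cl , same) = w , fl , exec-++ (exec-clear (1 + b) ρ₀) λ ρ₁ eq₁ → exec-incr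
        (search k (suc i) (set ρ₁ b (suc (ρ₁ b))) (trans (sym (ℕ.+-suc i k)) i+k≡y)
          (trans (set-same ρ₁ b _) (cong suc (trans (off-set {ρ₀} eq₁ (shifted-≢ 0 1 b)) (trans (set-other ρ′ w (shifted-≢ 0 1 b)) idx))))
          (clear-extend (trans (set-other ρ₁ _ (shifted-≢ 1 0 b)) (at-set {ρ₀} {1 + b} eq₁))
            λ s le → trans (set-other ρ₁ _ (ℕ.>⇒≢ (ℕ.<⇒≤ le))) (trans (off-set {ρ₀} eq₁ (ℕ.>⇒≢ le)) (trans (set-other ρ′ w (ℕ.>⇒≢ le)) (cl s le))))
          λ s s<b → trans (set-other ρ₁ _ (above-≢ 0 s<b)) (trans (off-set {ρ₀} eq₁ (above-≢ 1 s<b)) (trans (set-other ρ′ w (above-≢ 1 s<b)) (same s s<b))))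
      where
      ρ₀ = set ρ′ (1 + b) w

  compileAll-correct : ∀ {n m} (gs : Vec (Rec n) m) {vs ys} → (∀ i → lookup gs i [ vs ]↓ lookup ys i) →
    ∀ {xs o b ρ} → (∀ i → lookup xs i < o) → o + m ≤ b → Clear o ρ → (∀ i → ρ (lookup xs i) ≡ lookup vs i) →
    Exec (compileAll gs xs o b) ρ (λ ρ′ → (∀ s → s < o → ρ′ s ≡ ρ s) × (∀ i → ρ′ (o + toℕ i) ≡ lookup ys i) × Clear (o + m) ρ′)
  compileAll-correct [] ds {o = o} {ρ = ρ} below o≤b clear inputs =
    exec-[] ((λ _ _ → refl) , (λ ()) , subst (λ k → Clear k ρ) (sym (ℕ.+-identityʳ o)) clear)
  compileAll-correct {m = suc m} (g ∷ gs) {vs} {y ∷ ys} ds {xs} {o} {b} {ρ} below o≤b clear inputs = exec-++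
    (compile-correct g (ds 0F) (record
      { below     = λ i → ℕ.<-≤-trans (below i) (ℕ.≤-trans (ℕ.m≤m+n o (suc m)) o≤b)
      ; out-below = ℕ.<-≤-trans (ℕ.m<m+n o (s≤s z≤n)) o≤b
      ; distinct  = λ i → ℕ.<⇒≢ (below i)
      ; clear     = λ s le → clear s (ℕ.≤-trans (ℕ.≤-trans (ℕ.m≤m+n o (suc m)) o≤b) le)
      ; out-zero  = clear o ℕ.≤-refl
      ; inputs    = inputs
      }))
    λ ρ₁ eq₁ → exec-weaken (compileAll-correct gs {ys = ys} (ds ∘ suc) {o = suc o} (λ i → ℕ.m≤n⇒m≤1+n (below i)) (subst (_≤ b) (ℕ.+-suc o m) o≤b)
        (λ s le → trans (off-set {ρ} eq₁ (ℕ.>⇒≢ le)) (clear s (ℕ.<⇒≤ le)))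
        (λ i → trans (off-set {ρ} eq₁ (ℕ.<⇒≢ (below i))) (inputs i)))
      λ ρ₂ (same , values , clear₂) →
        (λ s s<o → trans (same s (ℕ.m≤n⇒m≤1+n s<o)) (off-set {ρ} eq₁ (ℕ.<⇒≢ s<o))) ,
        (λ { zero    → trans (cong ρ₂ (ℕ.+-identityʳ o)) (trans (same o ℕ.≤-refl) (at-set {ρ} eq₁))
           ; (suc i) → trans (cong ρ₂ (ℕ.+-suc o (toℕ i))) (values i) }) ,
        subst (λ k → Clear k ρ₂) (sym (ℕ.+-suc o m)) clear₂

-- The control points of a loop program are the continuations of its execution.

continuations : List Instr → List (List Instr)
continuations []             = [] ∷ []
continuations (incr r ∷ κ)   = (incr r ∷ κ) ∷ continuations κ
continuations (loop r c ∷ κ) = (loop r c ∷ κ) ∷ List.map (_++ loop r c ∷ κ) (continuations c) ++ continuations κ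

nexts : List Instr → List (List Instr)
nexts []             = []
nexts (incr r ∷ κ)   = κ ∷ []
nexts (loop r c ∷ κ) = κ ∷ (c ++ loop r c ∷ κ) ∷ []

self-continuation : ∀ κ → κ ∈ continuations κ
self-continuation []             = here refl
self-continuation (incr r ∷ κ)   = here refl
self-continuation (loop r c ∷ κ) = here refl

nexts-++ : ∀ s {κ κ″} → s ≢ [] → κ″ ∈ nexts (s ++ κ) → ∃[ s″ ] s″ ∈ nexts s × κ″ ≡ s″ ++ κ
nexts-++ []             ne m = contradiction refl ne
nexts-++ (incr r ∷ s)   ne (here eq)         = s , here refl , eq
nexts-++ (loop r c ∷ s) ne (here eq)         = s , here refl , eq
nexts-++ (loop r c ∷ s) {κ} ne (there (here eq)) = _ , there (here refl) , trans eq (sym (++-assoc c (loop r c ∷ s) κ))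

-- Although entering a loop prolongs the continuation, the body works in front of its own loop and
-- falls back on it when finished, so only finitely many control points arise.
continuations-closed : ∀ κ {κ′ κ″} → κ′ ∈ continuations κ → κ″ ∈ nexts κ′ → κ″ ∈ continuations κ
continuations-closed []             (here refl) ()
continuations-closed (incr r ∷ κ)   (here refl) (here refl) = there (self-continuation κ)
continuations-closed (incr r ∷ κ)   (there m)   m″          = there (continuations-closed κ m m″)
continuations-closed (loop r c ∷ κ) {κ′} {κ″} m m″ = go m
  where
  L = loop r c ∷ κ
  inner : ∀ {s} → s ∈ continuations c → s ++ L ∈ continuations L
  inner m = there (Mem.∈-++⁺ˡ (Mem.∈-map⁺ (_++ L) m))
  outer : κ″ ∈ nexts L → κ″ ∈ continuations L
  outer (here refl)         = there (Mem.∈-++⁺ʳ _ (self-continuation κ))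
  outer (there (here refl)) = inner (self-continuation c)
  body : ∀ s → s ∈ continuations c → κ″ ∈ nexts (s ++ L) → κ″ ∈ continuations L
  body []      _ m″ = outer m″
  body (i ∷ s) m m″ with nexts-++ (i ∷ s) (λ ()) m″
  ... | s″ , m‴ , refl = inner (continuations-closed c m m‴)
  go : κ′ ∈ continuations L → κ″ ∈ continuations L
  go (here refl) = outer m″
  go (there m) with Mem.∈-++⁻ (List.map (_++ L) (continuations c)) m
  ... | inj₂ m′ = there (Mem.∈-++⁺ʳ _ (continuations-closed κ m′ m″))
  ... | inj₁ m′ with Mem.∈-map⁻ (_++ L) m′
  ... | s , ms , refl = body s ms m″

maxRegister : List Instr → ℕ
maxRegister []             = 0
maxRegister (incr r ∷ κ)   = r ⊔ maxRegister κ
maxRegister (loop r c ∷ κ) = r ⊔ (maxRegister c ⊔ maxRegister κ)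

maxRegister-++ : ∀ s {κ m} → maxRegister s ≤ m → maxRegister κ ≤ m → maxRegister (s ++ κ) ≤ m
maxRegister-++ []             p q = q
maxRegister-++ (incr r ∷ s)   p q = ℕ.⊔-lub (ℕ.m⊔n≤o⇒m≤o r _ p) (maxRegister-++ s (ℕ.m⊔n≤o⇒n≤o r _ p) q)
maxRegister-++ (loop r c ∷ s) p q = ℕ.⊔-lub (ℕ.m⊔n≤o⇒m≤o r _ p)
  (ℕ.⊔-lub (ℕ.m⊔n≤o⇒m≤o (maxRegister c) _ (ℕ.m⊔n≤o⇒n≤o r _ p))
           (maxRegister-++ s (ℕ.m⊔n≤o⇒n≤o (maxRegister c) _ (ℕ.m⊔n≤o⇒n≤o r _ p)) q))

maxRegister-continuation : ∀ κ {κ′} → κ′ ∈ continuations κ → maxRegister κ′ ≤ maxRegister κ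
maxRegister-continuation []             (here refl) = ℕ.≤-refl
maxRegister-continuation (incr r ∷ κ)   (here refl) = ℕ.≤-refl
maxRegister-continuation (incr r ∷ κ)   (there m)   = ℕ.≤-trans (maxRegister-continuation κ m) (ℕ.m≤n⊔m r _)
maxRegister-continuation (loop r c ∷ κ) (here refl) = ℕ.≤-refl
maxRegister-continuation (loop r c ∷ κ) (there m) with Mem.∈-++⁻ (List.map (_++ loop r c ∷ κ) (continuations c)) m
... | inj₂ m′ = ℕ.≤-trans (maxRegister-continuation κ m′) (ℕ.≤-trans (ℕ.m≤n⊔m (maxRegister c) _) (ℕ.m≤n⊔m r _))
... | inj₁ m′ with Mem.∈-map⁻ (_++ loop r c ∷ κ) m′
... | s , ms , refl = maxRegister-++ s
  (ℕ.≤-trans (maxRegister-continuation c ms) (ℕ.≤-trans (ℕ.m≤m⊔n (maxRegister c) _) (ℕ.m≤n⊔m r _))) ℕ.≤-refl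

-- Round by round, the program adds the buffer to register 0, evaluates G at
-- register 1 and register 0, and upon success passes through its goal and
-- increments register 1.

module MainLoop (G : ℕ → ℕ → ℕ) (Gᶜ : Computable₂ G) (G-01 : ∀ i w → G i w ≡ 0 ⊎ G i w ≡ 1) where

  F : Rec 2
  F = Computable.rec (Computable₂.uncurried Gᶜ)

  C : List Instr
  C = compile F (1 ∷ 0 ∷ []) 2 3

  Κ : List (List Instr)
  Κ = continuations C

  K : ℕ
  -- Large enough both for the registers of `C` and for the registers 0, 1, 2 used between
  -- evaluations.
  K = 2 + maxRegister C

  clamp : ℕ → Fin (suc K)
  clamp r = fromℕ< (s≤s (ℕ.m⊓n≤n r K))

  toℕ-clamp : ∀ {r} → r ≤ K → toℕ (clamp r) ≡ r
  toℕ-clamp {r} r≤K = trans (Fin.toℕ-fromℕ< _) (ℕ.m≤n⇒m⊓n≡m r≤K)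

  Location : Set
  Location = Fin (2 + List.length Κ)

  top goal : Location
  top  = 0F
  goal = 1F

  comp : Fin (List.length Κ) → Location
  comp i = suc (suc i)

  locate : ∀ {κ} → κ ∈ Κ → Location
  locate m = comp (Any.index m)

  branch : ∀ κ → κ ∈ Κ → List (Op K × Location)
  branch []             m = (ZERO (clamp 2) , top) ∷ (DEC (clamp 2) , goal) ∷ []
  branch (incr r ∷ κ)   m = (INC (clamp r) , locate (continuations-closed C m (here refl))) ∷ []
  branch (loop r c ∷ κ) m = (ZERO (clamp r) , locate (continuations-closed C m (here refl)))
                          ∷ (DEC (clamp r) , locate (continuations-closed C m (there (here refl)))) ∷ []

  edgesFrom : Location → List (Op K × Location)
  edgesFrom zero          = (SNAP , locate (self-continuation C)) ∷ []
  edgesFrom (suc zero)    = (INC (clamp 1) , top) ∷ []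
  edgesFrom (suc (suc i)) = branch (List.lookup Κ i) (Mem.∈-lookup i)

  program : Program K
  program = record { locations = 2 + List.length Κ ; entry = top ; goal = goal ; edges = edgesFrom }

  At : Location → List Instr → Set
  At q κ = ∃[ i ] q ≡ comp i × List.lookup Κ i ≡ κ

  at-locate : ∀ {κ} (m : κ ∈ Κ) → At (locate m) κ
  at-locate m = Any.index m , refl , sym (lookup-index m)

  data Edge : List Instr → Op K → Location → Set where
    fail    : Edge [] (ZERO (clamp 2)) top
    succeed : Edge [] (DEC (clamp 2)) goal
    incr    : ∀ {r κ q} → At q κ → Edge (incr r ∷ κ) (INC (clamp r)) q
    exit    : ∀ {r c κ q} → At q κ → Edge (loop r c ∷ κ) (ZERO (clamp r)) q
    enter   : ∀ {r c κ q} → At q (c ++ loop r c ∷ κ) → Edge (loop r c ∷ κ) (DEC (clamp r)) q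

  branch-edge : ∀ κ m {op q} → (op , q) ∈ branch κ m → Edge κ op q
  branch-edge []             m (here refl)         = fail
  branch-edge []             m (there (here refl)) = succeed
  branch-edge (incr r ∷ κ)   m (here refl)         = incr (at-locate _)
  branch-edge (loop r c ∷ κ) m (here refl)         = exit (at-locate _)
  branch-edge (loop r c ∷ κ) m (there (here refl)) = enter (at-locate _)

  maxRegister-at : ∀ {q κ} → At q κ → maxRegister κ ≤ K
  maxRegister-at (i , _ , refl) = ℕ.≤-trans (maxRegister-continuation C (Mem.∈-lookup i)) (ℕ.m≤n+m _ 2)

  -- The program never blocks: a zero test always comes with a decrement of the same register. Hence
  -- every stream of digits has a run.
  choice : ∀ q ρ → Σ[ op ∈ Op K ] Σ[ q′ ∈ Location ] (op , q′) ∈ edgesFrom q × OpEnabled op ρ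
  choice zero          ρ = _ , _ , here refl , tt
  choice (suc zero)    ρ = _ , _ , here refl , tt
  choice (suc (suc i)) ρ = go (List.lookup Κ i) (Mem.∈-lookup i)
    where
    go : ∀ κ m → Σ[ op ∈ Op K ] Σ[ q′ ∈ Location ] (op , q′) ∈ branch κ m × OpEnabled op ρ
    go [] m with ρ (clamp 2) ℕ.≟ 0
    ... | yes z = _ , _ , here refl , z
    ... | no ¬z = _ , _ , there (here refl) , ¬z
    go (incr r ∷ κ) m = _ , _ , here refl , tt
    go (loop r c ∷ κ) m with ρ (clamp r) ℕ.≟ 0
    ... | yes z = _ , _ , here refl , z
    ... | no ¬z = _ , _ , there (here refl) , ¬z

  module _ (n′ : ℕ) where
    open Coding n′ K program using (n; B; ProgramRun; digits; ProgramLanguage)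

    existsRun : ∀ d → ProgramRun d
    existsRun d = record
      { location       = λ t → proj₁ (configuration t)
      ; register       = λ t → proj₁ (proj₂ (configuration t))
      ; buffer         = λ t → proj₂ (proj₂ (configuration t))
      ; location-start = refl
      ; register-start = λ _ → refl
      ; buffer-start   = refl
      ; operation      = operation
      ; edge           = λ t → proj₁ (proj₂ (proj₂ (chosen t)))
      ; enabled        = λ t → proj₂ (proj₂ (proj₂ (chosen t)))
      ; register-step  = λ _ _ → refl
      ; buffer-step    = λ _ → refl
      }
      where
      Configuration : Set
      Configuration = Location × (Fin (suc K) → ℕ) × ℕ
      step : ℕ → Configuration → Configuration
      step t (q , ρ , β) = let op , q′ , _ = choice q ρ in
        q′ , regAfter op ρ β , bufAfter op β + suc (toℕ (d t)) * B ^ t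
      configuration : ℕ → Configuration
      configuration zero    = top , (λ _ → 0) , 0
      configuration (suc t) = step t (configuration t)
      chosen : ∀ t → _
      chosen t = choice (proj₁ (configuration t)) (proj₁ (proj₂ (configuration t)))
      operation : ℕ → Op K
      operation t = proj₁ (chosen t)

    module OfRun {d : ℕ → Fin (n * 2)} (R : ProgramRun d) where
      open ProgramRun R

      fed : ℕ → ℕ
      fed = sumTo (λ s → suc (toℕ (d s)) * B ^ s)

      -- The number `w` is what the last `SNAP` has brought into use; the digits fed since then wait
      -- in the buffer.
      record Tracks (w t : ℕ) (ρ : Registers) : Set where
        field
          registers : ∀ j → register t j ≡ ρ (toℕ j)
          buffered  : w + buffer t ≡ fed t

      NoGoal : ℕ → ℕ → Set
      NoGoal t t′ = ∀ s → t ≤ s → s < t′ → location s ≢ goal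

      noGoal-∷ : ∀ {t t′} → location t ≢ goal → NoGoal (suc t) t′ → NoGoal t t′
      noGoal-∷ ne p s t≤s s<t′ with ℕ.m≤n⇒m<n∨m≡n t≤s
      ... | inj₁ t<s  = p s t<s s<t′
      ... | inj₂ refl = ne

      feed : ∀ {w t} β → bufAfter (operation t) (buffer t) ≡ β → w + β ≡ fed t → w + buffer (suc t) ≡ fed (suc t)
      feed {w} {t} β eq eq′ = trans (cong (w +_) (buffer-step t)) (trans (cong (λ β → w + (β + suc (toℕ (d t)) * B ^ t)) eq)
        (trans (sym (ℕ.+-assoc w β _)) (cong (_+ suc (toℕ (d t)) * B ^ t) eq′)))

      edge-at : ∀ {t κ} → At (location t) κ → Edge κ (operation t) (location (suc t))
      edge-at {t} {κ} (i , q≡ , refl) = branch-edge (List.lookup Κ i) (Mem.∈-lookup i)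
        (subst (λ q → (operation t , location (suc t)) ∈ edgesFrom q) q≡ (edge t))

      at≢goal : ∀ {q κ} → At q κ → q ≢ goal
      at≢goal (i , () , _) refl

      clamp-does : ∀ {r} → r ≤ K → ∀ j → does (clamp r Fin.≟ j) ≡ does (toℕ j ℕ.≟ r)
      clamp-does {r} r≤K j = go (toℕ j ℕ.≟ r)
        where
        go : (e : Dec (toℕ j ≡ r)) → does (clamp r Fin.≟ j) ≡ does e
        go (yes eq) = dec-true (clamp r Fin.≟ j) (Fin.toℕ-injective (trans (toℕ-clamp r≤K) (sym eq)))
        go (no ne)  = dec-false (clamp r Fin.≟ j) (λ { refl → ne (toℕ-clamp r≤K) })

      update : ∀ {t ρ r} → r ≤ K → (∀ j → register t j ≡ ρ (toℕ j)) → ∀ (f : ℕ → ℕ) {v} → f (ρ r) ≡ v → ∀ j →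
               (if does (clamp r Fin.≟ j) then f (register t j) else register t j) ≡ set ρ r v (toℕ j)
      update {t} {ρ} {r} r≤K reg≡ f refl j =
        trans (cong (λ b → if b then f (register t j) else register t j) (clamp-does r≤K j)) (go (toℕ j ℕ.≟ r))
        where
        go : (e : Dec (toℕ j ≡ r)) → (if does e then f (register t j) else register t j) ≡ (if does e then f (ρ r) else ρ (toℕ j))
        go (yes refl) = cong f (reg≡ j)
        go (no _)     = reg≡ j

      at-clamp : ∀ {t ρ r} → r ≤ K → (∀ j → register t j ≡ ρ (toℕ j)) → register t (clamp r) ≡ ρ r
      at-clamp {ρ = ρ} r≤K reg≡ = trans (reg≡ _) (cong ρ (toℕ-clamp r≤K))

      enabled-as : ∀ {t op} → operation t ≡ op → OpEnabled op (register t)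
      enabled-as {t} refl = enabled t

      register-as : ∀ {t op} → operation t ≡ op → ∀ j → register (suc t) j ≡ regAfter op (register t) (buffer t) j
      register-as {t} refl = register-step t

      Reaches : ℕ → ℕ → List Instr → Registers → Set
      Reaches w t κ ρ = ∃[ t′ ] t ≤ t′ × NoGoal t t′ × At (location t′) κ × Tracks w t′ ρ

      -- The run is given and cannot be steered. But of a zero test and a decrement on one register
      -- only one is enabled, so the run is bound to the deterministic execution.
      follow : ∀ {κ ρ κ′ ρ′} → Steps κ ρ κ′ ρ′ → ∀ {w} t → At (location t) κ → Tracks w t ρ → Reaches w t κ′ ρ′
      follow stop t at tr = t , ℕ.≤-refl , (λ s t≤s s<t → contradiction t≤s (ℕ.<⇒≱ s<t)) , at , tr
      follow {κ′ = κ′} {ρ′} (incr {r} {κ} {ρ} p) {w} t at tr = go (edge-at at) refl refl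
        where
        open Tracks tr
        r≤K = ℕ.m⊔n≤o⇒m≤o r _ (maxRegister-at at)
        go : ∀ {op q} → Edge (incr r ∷ κ) op q → op ≡ operation t → q ≡ location (suc t) → Reaches w t κ′ ρ′
        go (incr at′) eq refl with follow p (suc t) at′ (record
              { registers = λ j → trans (register-as (sym eq) j) (update {ρ = ρ} r≤K registers suc refl j)
              ; buffered  = feed (buffer t) (cong (λ op → bufAfter op (buffer t)) (sym eq)) buffered })
        ... | t′ , le , ng , at″ , tr′ = t′ , ℕ.<⇒≤ le , noGoal-∷ (at≢goal at) ng , at″ , tr′
      follow {κ′ = κ′} {ρ′} (exit {r} {c} {κ} {ρ} z p) {w} t at tr = go (edge-at at) refl refl
        where
        open Tracks tr
        r≤K = ℕ.m⊔n≤o⇒m≤o r _ (maxRegister-at at)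
        go : ∀ {op q} → Edge (loop r c ∷ κ) op q → op ≡ operation t → q ≡ location (suc t) → Reaches w t κ′ ρ′
        go (enter at′) eq _ = ⊥-elim (enabled-as (sym eq) (trans (at-clamp r≤K registers) z))
        go (exit at′) eq refl with follow p (suc t) at′ (record
              { registers = λ j → trans (register-as (sym eq) j) (registers j)
              ; buffered  = feed (buffer t) (cong (λ op → bufAfter op (buffer t)) (sym eq)) buffered })
        ... | t′ , le , ng , at″ , tr′ = t′ , ℕ.<⇒≤ le , noGoal-∷ (at≢goal at) ng , at″ , tr′
      follow {κ′ = κ′} {ρ′} (enter {r} {c} {κ} {ρ} v e p) {w} t at tr = go (edge-at at) refl refl
        where
        open Tracks tr
        r≤K = ℕ.m⊔n≤o⇒m≤o r _ (maxRegister-at at)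
        go : ∀ {op q} → Edge (loop r c ∷ κ) op q → op ≡ operation t → q ≡ location (suc t) → Reaches w t κ′ ρ′
        go (exit at′) eq _ = contradiction (trans (sym e) (trans (sym (at-clamp r≤K registers)) (enabled-as (sym eq)))) λ ()
        go (enter at′) eq refl with follow p (suc t) at′ (record
              { registers = λ j → trans (register-as (sym eq) j) (update {ρ = ρ} r≤K registers pred (cong pred e) j)
              ; buffered  = feed (buffer t) (cong (λ op → bufAfter op (buffer t)) (sym eq)) buffered })
        ... | t′ , le , ng , at″ , tr′ = t′ , ℕ.<⇒≤ le , noGoal-∷ (at≢goal at) ng , at″ , tr′

      -- The registers between rounds: the fed number, a counter, and flag f.
      state₃ : ℕ → ℕ → ℕ → Registers
      state₃ w i f 0                   = w
      state₃ w i f 1                   = i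
      state₃ w i f 2                   = f
      state₃ w i f (suc (suc (suc _))) = 0

      record AtTop (t i : ℕ) : Set where
        field
          location-top : location t ≡ top
          number       : ℕ
          tracks       : Tracks number t (state₃ number i 0)

      2≤K : 2 ≤ K
      2≤K = ℕ.m≤m+n 2 _

      start : AtTop 0 0
      start = record
        { location-top = location-start ; number = 0
        ; tracks = record { registers = λ j → trans (register-start j) (zeros (toℕ j)) ; buffered = buffer-start } }
        where
        zeros : ∀ s → 0 ≡ state₃ 0 0 0 s
        zeros 0                   = refl
        zeros 1                   = refl
        zeros 2                   = refl
        zeros (suc (suc (suc _))) = refl

      tracks-≗ : ∀ {w t ρ ρ′} → (∀ s → ρ s ≡ ρ′ s) → Tracks w t ρ → Tracks w t ρ′
      tracks-≗ eq tr = record { registers = λ j → trans (Tracks.registers tr j) (eq (toℕ j)) ; buffered = Tracks.buffered tr }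

      snap : ∀ {t i} → AtTop t i → At (location (suc t)) C × Tracks (fed t) (suc t) (state₃ (fed t) i 0)
      snap {t} {i} top-t with subst (λ q → (operation t , location (suc t)) ∈ edgesFrom q) (AtTop.location-top top-t) (edge t)
      ... | here eq = subst (λ q → At q C) (sym (cong proj₂ eq)) (at-locate _) , record
        { registers = λ j → trans (register-as (cong proj₁ eq) j) (add j)
        ; buffered  = feed 0 (cong (λ op → bufAfter op (buffer t)) (cong proj₁ eq)) (ℕ.+-identityʳ _) }
        where
        open AtTop top-t
        open Tracks tracks
        add : ∀ j → regAfter SNAP (register t) (buffer t) j ≡ state₃ (fed t) i 0 (toℕ j)
        add zero                = trans (cong (_+ buffer t) (registers zero)) buffered
        add (suc zero)          = registers (suc zero)
        add (suc (suc zero))    = registers (suc (suc zero))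
        add (suc (suc (suc j))) = registers (suc (suc (suc j)))

      evaluate : ∀ {w i} → Exec C (state₃ w i 0) (Sets (state₃ w i 0) 2 (G i w))
      evaluate {w} {i} = compile-correct F (Computable.computes (Computable₂.uncurried Gᶜ) (i ∷ w ∷ [])) (record
        { below     = λ { 0F → s≤s (s≤s z≤n) ; 1F → s≤s z≤n }
        ; out-below = s≤s (s≤s (s≤s z≤n))
        ; distinct  = λ { 0F () ; 1F () }
        ; clear     = λ { (suc (suc (suc _))) _ → refl ; 0 () ; 1 (s≤s ()) ; 2 (s≤s (s≤s ())) }
        ; out-zero  = refl
        ; inputs    = λ { 0F → refl ; 1F → refl } })

      set-flag : ∀ {w i f} g s → set (state₃ w i f) 2 g s ≡ state₃ w i g s
      set-flag g 0                   = refl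
      set-flag g 1                   = refl
      set-flag g 2                   = refl
      set-flag g (suc (suc (suc _))) = refl

      set-counter : ∀ {w i f} g s → set (state₃ w i f) 1 g s ≡ state₃ w g f s
      set-counter g 0                   = refl
      set-counter g 1                   = refl
      set-counter g 2                   = refl
      set-counter g (suc (suc (suc _))) = refl

      evaluated : ∀ {t i} → AtTop t i →
        ∃[ t′ ] t < t′ × NoGoal t t′ × At (location t′) [] × Tracks (fed t) t′ (state₃ (fed t) i (G i (fed t)))
      evaluated {t} {i} top-t with snap top-t | evaluate {fed t} {i}
      ... | at , tr | ρ′ , steps , sets with follow (subst (λ κ → Steps κ (state₃ (fed t) i 0) [] ρ′) (++-identityʳ C) (steps [])) (suc t) at tr
      ... | t′ , le , ng , at′ , tr′ = t′ , le , noGoal-∷ (λ eq → case trans (sym (AtTop.location-top top-t)) eq of λ ()) ng , at′ ,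
        tracks-≗ (λ s → trans (sets s) (set-flag (G i (fed t)) s)) tr′

      Failed Succeeded : ℕ → ℕ → Set
      Failed t i    = ∃[ t′ ] t < t′ × NoGoal t t′ × AtTop t′ i
      Succeeded t i = ∃[ t′ ] t < t′ × AtTop t′ (suc i) × ∃[ s ] t ≤ s × location s ≡ goal

      round-fails : ∀ {t i} → AtTop t i → G i (fed t) ≡ 0 → Failed t i
      round-fails {t} {i} top-t z with evaluated top-t
      ... | t₁ , t<t₁ , ng , at , tr = go (edge-at at) refl refl
        where
        open Tracks tr
        go : ∀ {op q} → Edge [] op q → op ≡ operation t₁ → q ≡ location (suc t₁) → Failed t i
        go succeed eq _  = ⊥-elim (enabled-as (sym eq) (trans (at-clamp {ρ = state₃ (fed t) i (G i (fed t))} 2≤K registers) z))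
        go fail    eq eq′ = suc t₁ , ℕ.m≤n⇒m≤1+n t<t₁ , noGoal , record
          { location-top = sym eq′ ; number = fed t
          ; tracks = record
            { registers = λ j → trans (register-as (sym eq) j) (trans (registers j) (cong (λ f → state₃ (fed t) i f (toℕ j)) z))
            ; buffered  = feed (buffer t₁) (cong (λ op → bufAfter op (buffer t₁)) (sym eq)) buffered } }
          where
          noGoal : NoGoal t (suc t₁)
          noGoal s t≤s s<1+t₁ with ℕ.m<1+n⇒m<n∨m≡n s<1+t₁
          ... | inj₁ s<t₁ = ng s t≤s s<t₁
          ... | inj₂ refl = at≢goal at

      round-succeeds : ∀ {t i} → AtTop t i → G i (fed t) ≡ 1 → Succeeded t i
      round-succeeds {t} {i} top-t one with evaluated top-t
      ... | t₁ , t<t₁ , ng , at , tr = go (edge-at at) refl refl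
        where
        open Tracks tr
        go : ∀ {op q} → Edge [] op q → op ≡ operation t₁ → q ≡ location (suc t₁) → Succeeded t i
        go fail    eq _   = contradiction (trans (sym one) (trans (sym (at-clamp {ρ = state₃ (fed t) i (G i (fed t))} 2≤K registers)) (enabled-as (sym eq)))) λ ()
        go succeed eq eq′ with subst (λ q → (operation (suc t₁) , location (suc (suc t₁))) ∈ edgesFrom q) (sym eq′) (edge (suc t₁))
        ... | here eq″ = suc (suc t₁) , ℕ.m≤n⇒m≤1+n (ℕ.m≤n⇒m≤1+n t<t₁) , record
            { location-top = cong proj₂ eq″ ; number = fed t ; tracks = tracks-≗ (set-counter (suc i)) final } ,
            suc t₁ , ℕ.<⇒≤ (ℕ.m≤n⇒m≤1+n t<t₁) , sym eq′
          where
          middle : Tracks (fed t) (suc t₁) (state₃ (fed t) i 0)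
          middle = tracks-≗ (set-flag 0) (record
            { registers = λ j → trans (register-as (sym eq) j) (update {ρ = state₃ (fed t) i (G i (fed t))} 2≤K registers pred (cong pred one) j)
            ; buffered  = feed (buffer t₁) (cong (λ op → bufAfter op (buffer t₁)) (sym eq)) buffered })
          final : Tracks (fed t) (suc (suc t₁)) (set (state₃ (fed t) i 0) 1 (suc i))
          final = record
            { registers = λ j → trans (register-as (cong proj₁ eq″) j) (update {ρ = state₃ (fed t) i 0} (ℕ.<⇒≤ 2≤K) (Tracks.registers middle) suc refl j)
            ; buffered  = feed (buffer (suc t₁)) (cong (λ op → bufAfter op (buffer (suc t₁))) (cong proj₁ eq″)) (Tracks.buffered middle) }

      Successes : Set
      Successes = ∀ i → ∃[ t ] G i (fed t) ≡ 1

      GoalOften : Set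
      GoalOften = ∀ t → ∃[ t′ ] t ≤ t′ × location t′ ≡ goal

      late-top : ∀ t₀ → ∃[ t ] ∃[ i ] t₀ ≤ t × AtTop t i
      late-top zero = 0 , 0 , z≤n , start
      late-top (suc t₀) with late-top t₀
      ... | t , i , t₀≤t , top-t with G-01 i (fed t)
      ... | inj₁ z   = let t′ , t<t′ , _ , top′ = round-fails top-t z in t′ , i , ℕ.≤-<-trans t₀≤t t<t′ , top′
      ... | inj₂ one = let t′ , t<t′ , top′ , _ = round-succeeds top-t one in t′ , suc i , ℕ.≤-<-trans t₀≤t t<t′ , top′

      -- The program samples the fed number only when a round begins and may miss the moment of
      -- success; `mono` preserves the success until the next round. The fuel bounds the time until
      -- then.
      successes⇒goalOften : (∀ i {t t′} → t ≤ t′ → G i (fed t) ≡ 1 → G i (fed t′) ≡ 1) → Successes → GoalOften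
      successes⇒goalOften mono succ t₀ with late-top t₀
      ... | t , i , t₀≤t , top-t with succ i
      ... | m , one = reach m t t₀≤t top-t (ℕ.m≤m+n m t)
        where
        reach : ∀ fuel t → t₀ ≤ t → AtTop t i → m ≤ fuel + t → ∃[ t′ ] t₀ ≤ t′ × location t′ ≡ goal
        reach fuel t t₀≤t top-t m≤ with G-01 i (fed t)
        ... | inj₂ one = let _ , _ , _ , s , t≤s , eq = round-succeeds top-t one in s , ℕ.≤-trans t₀≤t t≤s , eq
        reach zero t t₀≤t top-t m≤ | inj₁ z = contradiction (trans (sym z) (mono i m≤ one)) λ ()
        reach (suc fuel) t t₀≤t top-t m≤ | inj₁ z with round-fails top-t z
        ... | t′ , t<t′ , _ , top′ = reach fuel t′ (ℕ.≤-trans t₀≤t (ℕ.<⇒≤ t<t′)) top′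
                (ℕ.≤-trans m≤ (subst (_≤ fuel + t′) (ℕ.+-suc fuel t) (ℕ.+-monoʳ-≤ fuel t<t′)))

      -- A failing round does not meet the goal, so a later visit to it lies beyond that round. Each
      -- round takes time, and therefore one of the rounds up to the visit succeeds and raises the
      -- counter to the next `i`.
      goalOften⇒successes : GoalOften → Successes
      goalOften⇒successes often i = success (at-top i)
        where
        find-success : ∀ fuel t i s → AtTop t i → t ≤ s → location s ≡ goal → s ≤ fuel + t →
                       (∃[ t′ ] G i (fed t′) ≡ 1) × ∃[ t′ ] AtTop t′ (suc i)
        find-success fuel t i s top-t t≤s eq s≤ with G-01 i (fed t)
        ... | inj₂ one = let t′ , _ , top′ , _ = round-succeeds top-t one in (t , one) , t′ , top′
        ... | inj₁ z with round-fails top-t z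
        find-success zero t i s top-t t≤s eq s≤ | inj₁ z | t′ , t<t′ , ng , top′ =
          contradiction eq (ng s t≤s (ℕ.≤-<-trans s≤ t<t′))
        find-success (suc fuel) t i s top-t t≤s eq s≤ | inj₁ z | t′ , t<t′ , ng , top′ =
          find-success fuel t′ i s top′ (ℕ.≮⇒≥ λ s<t′ → ng s t≤s s<t′ eq) eq
            (ℕ.≤-trans s≤ (subst (_≤ fuel + t′) (ℕ.+-suc fuel t) (ℕ.+-monoʳ-≤ fuel t<t′)))
        success : ∃[ t ] AtTop t i → ∃[ t′ ] G i (fed t′) ≡ 1
        success (t , top-t) with often t
        ... | s , t≤s , eq = proj₁ (find-success s t i s top-t t≤s eq (ℕ.m≤m+n s t))
        at-top : ∀ i → ∃[ t ] AtTop t i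
        at-top zero = 0 , start
        at-top (suc i) with at-top i
        ... | t , top-t with often t
        ... | s , t≤s , eq = proj₂ (find-success s t i s top-t t≤s eq (ℕ.m≤m+n s t))

    number : ωWord n → ωWord 2 → ℕ → ℕ
    number σ τ = sumTo (λ s → suc (toℕ (digits σ τ s)) * B ^ s)

    programLanguage⇔ : (∀ σ τ i {t t′} → t ≤ t′ → G i (number σ τ t) ≡ 1 → G i (number σ τ t′) ≡ 1) → ∀ σ →
      ProgramLanguage σ ⇔ (Σ[ τ ∈ ωWord 2 ] ∀ i → ∃[ t ] G i (number σ τ t) ≡ 1)
    programLanguage⇔ mono σ = mk⇔
      (λ (τ , R , often) → τ , OfRun.goalOften⇒successes R often)
      (λ (τ , succ) → τ , existsRun (digits σ τ) , OfRun.successes⇒goalOften (existsRun (digits σ τ)) (mono σ τ) succ)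

-- A counter program for an analytic set

sumTo-stop : ∀ {f} t → (∀ s → t ≤ s → f s ≡ 0) → ∀ m → sumTo f m ≡ sumTo f (m ⊓ t)
sumTo-stop     t z zero    = refl
sumTo-stop {f} t z (suc m) with ℕ.<-≤-connex m t
... | inj₁ m<t rewrite ℕ.m≤n⇒m⊓n≡m m<t = refl
... | inj₂ t≤m rewrite ℕ.m≥n⇒m⊓n≡n (ℕ.m≤n⇒m≤1+n t≤m) = begin
  sumTo f m + f m  ≡⟨ cong (sumTo f m +_) (z m t≤m) ⟩
  sumTo f m + 0    ≡⟨ ℕ.+-identityʳ _ ⟩
  sumTo f m        ≡⟨ sumTo-stop t z m ⟩
  sumTo f (m ⊓ t)  ≡⟨ cong (sumTo f) (ℕ.m≥n⇒m⊓n≡n t≤m) ⟩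
  sumTo f t        ∎
  where open ≡-Reasoning

code-injective : ∀ n′ (u v : List (Fin (suc n′))) → ⌜ u ⌝ ≡ ⌜ v ⌝ → u ≡ v
code-injective n′ []      []      eq = refl
code-injective n′ (a ∷ u) (b ∷ v) eq
  with digits-of-sum n′ ⌜ u ⌝ (toℕ a) (Fin.toℕ<n a) | digits-of-sum n′ ⌜ v ⌝ (toℕ b) (Fin.toℕ<n b)
... | p , q | p′ , q′ = cong₂ _∷_
  (Fin.toℕ-injective (ℕ.suc-injective (trans (sym p) (trans (cong (Digits.firstDigit (suc n′)) eq) p′))))
  (code-injective n′ u v (trans (sym q) (trans (cong (Digits.otherDigits (suc n′)) eq) q′)))

module AnalyticProgram (n′ : ℕ) (R : ℕ → List (Fin 2) → List (Fin (suc n′)) → Set) (recursive : Recursive R) where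

  n B : ℕ
  n = suc n′
  B = n * 2 + 2

  open Digits B

  words : ∀ m′ → ℕ → List (Fin (suc m′))
  words m′ c = proj₁ (code-surjective m′ c)

  holds : ℕ → ℕ → ℕ → ℕ
  holds i x y with proj₂ recursive i (words 1 x) (words n′ y)
  ... | inj₁ _ = 1
  ... | inj₂ _ = 0

  holdsᶜ : Computable₃ holds
  holdsᶜ = computable₃ (computable (proj₁ recursive) λ { (i ∷ x ∷ y ∷ []) →
    subst₂ (λ c c′ → proj₁ recursive [ i ∷ c ∷ c′ ∷ [] ]↓ holds i x y)
      (proj₂ (code-surjective 1 x)) (proj₂ (code-surjective n′ y)) (evaluated i x y) })
    where
    evaluated : ∀ i x y → proj₁ recursive [ i ∷ ⌜ words 1 x ⌝ ∷ ⌜ words n′ y ⌝ ∷ [] ]↓ holds i x y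
    evaluated i x y with proj₂ recursive i (words 1 x) (words n′ y)
    ... | inj₁ (_ , d) = d
    ... | inj₂ (_ , d) = d

  words-code : ∀ m′ u → words m′ ⌜ u ⌝ ≡ u
  words-code m′ u = code-injective m′ _ u (proj₂ (code-surjective m′ ⌜ u ⌝))

  holds⇔ : ∀ i u v → holds i ⌜ u ⌝ ⌜ v ⌝ ≢ 0 ⇔ R i u v
  holds⇔ i u v = mk⇔ to from
    where
    to : holds i ⌜ u ⌝ ⌜ v ⌝ ≢ 0 → R i u v
    to ne with proj₂ recursive i (words 1 ⌜ u ⌝) (words n′ ⌜ v ⌝)
    ... | inj₁ (r , _) = subst₂ (R i) (words-code 1 u) (words-code n′ v) r
    ... | inj₂ _       = contradiction refl ne
    from : R i u v → holds i ⌜ u ⌝ ⌜ v ⌝ ≢ 0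
    from r with proj₂ recursive i (words 1 ⌜ u ⌝) (words n′ ⌜ v ⌝)
    ... | inj₁ _        = λ ()
    ... | inj₂ (¬r , _) = contradiction (subst₂ (R i) (sym (words-code 1 u)) (sym (words-code n′ v)) r) ¬r

  component : ∀ {m} → (Fin n × Fin 2 → Fin m) → Fin (suc (n * 2)) → ℕ
  component f zero    = 0
  component f (suc x) = suc (toℕ (f (Fin.remQuot 2 x)))

  unpack : ∀ {m} → (Fin n × Fin 2 → Fin m) → ℕ → ℕ → ℕ
  unpack {m} f w = sumTo (λ s → table (suc (n * 2)) (component f) (digit s w) * m ^ s)

  unpackᶜ : ∀ {m k} (f : Fin n × Fin 2 → Fin m) {w b : Vec ℕ k → ℕ} → Computable (λ xs → w (Vec.tail xs)) → Computable b →
            Computable (λ xs → unpack f (w xs) (b xs))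
  unpackᶜ {m} f W b = sumToᶜ {g = λ xs → table (suc (n * 2)) (component f) (digit (lookup xs 0F) _) * m ^ lookup xs 0F}
    (comp₂ mulᶜ (comp₁ (tableᶜ (suc (n * 2)) (component f)) (comp₂ digitᶜ (varᶜ 0F) W)) (comp₁ (powᶜ m) (varᶜ 0F))) b

  -- The program does not know how many digits `w` has, so it tries every length up to `w`, which is
  -- at least that number. Longer lengths just unpack the whole prefix again.
  successes : ℕ → ℕ → ℕ
  successes i w = sumTo (λ m → holds i (unpack proj₂ w m) (unpack proj₁ w m)) (suc w)

  abstract
    G : ℕ → ℕ → ℕ
    G i w = isPositive (successes i w)

    G-def : ∀ i w → G i w ≡ isPositive (successes i w)
    G-def i w = refl

    Gᶜ : Computable₂ G
    Gᶜ = computable₂ (comp₁ isPositiveᶜ (sumToᶜ {g = λ xs → holds (lookup xs 1F) (unpack proj₂ (lookup xs (suc 1F)) (lookup xs 0F)) (unpack proj₁ (lookup xs (suc 1F)) (lookup xs 0F))}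
      (comp₃ holdsᶜ (varᶜ 1F)
        (unpackᶜ proj₂ {w = λ xs → lookup xs (suc 1F)} (computable-cong (λ { (_ ∷ _ ∷ _ ∷ _ ∷ []) → refl }) (varᶜ (suc (suc 1F)))) (varᶜ 0F))
        (unpackᶜ proj₁ {w = λ xs → lookup xs (suc 1F)} (computable-cong (λ { (_ ∷ _ ∷ _ ∷ _ ∷ []) → refl }) (varᶜ (suc (suc 1F)))) (varᶜ 0F)))
      (comp₁ sucᶜ (varᶜ 1F))))

    G-01 : ∀ i w → G i w ≡ 0 ⊎ G i w ≡ 1
    G-01 i w with successes i w
    ... | zero  = inj₁ refl
    ... | suc _ = inj₂ refl

  open MainLoop G Gᶜ G-01 using (K; program; number; programLanguage⇔)

  module _ (σ : ωWord n) (τ : ωWord 2) where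

    packed : ωWord B
    packed s = Fin.combine (σ s) (τ s) Fin.↑ˡ 2

    number-code : ∀ t → number n′ σ τ t ≡ ⌜ packed ↾ t ⌝
    number-code t = trans (sumTo-cong t λ s _ → cong (λ x → suc x * B ^ s) (sym (Fin.toℕ-↑ˡ (Fin.combine (σ s) (τ s)) 2))) (sym (code-sum packed t))

    unpack-code : ∀ {m} (f : Fin n × Fin 2 → Fin m) t k → unpack f (number n′ σ τ t) k ≡ ⌜ (λ s → f (σ s , τ s)) ↾ (k ⊓ t) ⌝
    unpack-code {m} f t k = begin
      unpack f (number n′ σ τ t) k                             ≡⟨ cong (λ w → unpack f w k) (number-code t) ⟩
      unpack f ⌜ packed ↾ t ⌝ k                                ≡⟨ sumTo-stop t (λ s t≤s → cong (λ e → table (suc (n * 2)) (component f) e * m ^ s) (digit-≥ (suc (n′ * 2 + 2)) packed t≤s)) k ⟩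
      unpack f ⌜ packed ↾ t ⌝ (k ⊓ t)                          ≡⟨ sumTo-cong (k ⊓ t) (λ s s<k → cong (_* m ^ s) (entry s (ℕ.<-≤-trans s<k (ℕ.m⊓n≤n k t)))) ⟩
      sumTo (λ s → suc (toℕ (f (σ s , τ s))) * m ^ s) (k ⊓ t)  ≡⟨ sym (code-sum (λ s → f (σ s , τ s)) (k ⊓ t)) ⟩
      ⌜ (λ s → f (σ s , τ s)) ↾ (k ⊓ t) ⌝                      ∎
      where
      open ≡-Reasoning
      entry : ∀ s → s < t → table (suc (n * 2)) (component f) (digit s ⌜ packed ↾ t ⌝) ≡ suc (toℕ (f (σ s , τ s)))
      entry s s<t = trans (cong (table (suc (n * 2)) (component f)) (trans (digit-< (suc (n′ * 2 + 2)) packed s<t)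
          (cong suc (Fin.toℕ-↑ˡ (Fin.combine (σ s) (τ s)) 2))))
        (trans (table-toℕ (suc (n * 2)) (component f) (suc (Fin.combine (σ s) (τ s))))
          (cong (λ x → suc (toℕ (f x))) (Fin.remQuot-combine (σ s) (τ s))))

    t≤number : ∀ t → t ≤ number n′ σ τ t
    t≤number t = sumTo-≥ _ t (λ s → ℕ.*-mono-≤ {1} {suc (toℕ (Fin.combine (σ s) (τ s)))} (s≤s z≤n) (ℕ.m^n>0 B s))

    G⇒ : ∀ i t → G i (number n′ σ τ t) ≡ 1 → ∃[ m ] m ≤ t × R i (τ ↾ m) (σ ↾ m)
    G⇒ i t one with sumTo-positive (suc (number n′ σ τ t)) (λ z → contradiction (trans (sym one) (trans (G-def i _) (cong isPositive z))) λ ())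
    ... | k , _ , ne = k ⊓ t , ℕ.m⊓n≤n k t , Equivalence.to (holds⇔ i _ _)
      (subst₂ (λ x y → holds i x y ≢ 0) (unpack-code proj₂ t k) (unpack-code proj₁ t k) ne)

    G⇐ : ∀ i t m → m ≤ t → R i (τ ↾ m) (σ ↾ m) → G i (number n′ σ τ t) ≡ 1
    G⇐ i t m m≤t r = trans (G-def i _) (positive λ z → Equivalence.from (holds⇔ i (τ ↾ m) (σ ↾ m)) r
        (trans (cong₂ (holds i) (code≡ proj₂) (code≡ proj₁))
          (sumTo-zero _ z m (s≤s (ℕ.≤-trans m≤t (t≤number t))))))
      where
      code≡ : ∀ {k} (f : Fin n × Fin 2 → Fin k) → ⌜ (λ s → f (σ s , τ s)) ↾ m ⌝ ≡ unpack f (number n′ σ τ t) m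
      code≡ f = sym (trans (unpack-code f t m) (cong (λ k → ⌜ (λ s → f (σ s , τ s)) ↾ k ⌝) (ℕ.m≤n⇒m⊓n≡m m≤t)))
      positive : ∀ {x} → x ≢ 0 → isPositive x ≡ 1
      positive {zero}  ne = contradiction refl ne
      positive {suc x} ne = refl

  open Coding n′ K program using (ProgramLanguage)

  programLanguage : ∀ σ → ProgramLanguage σ ⇔ (Σ[ τ ∈ ωWord 2 ] ∀ i → ∃[ m ] R i (τ ↾ m) (σ ↾ m))
  programLanguage σ = mk⇔ to from
    where
    monotone : ∀ σ τ i {t t′} → t ≤ t′ → G i (number n′ σ τ t) ≡ 1 → G i (number n′ σ τ t′) ≡ 1
    monotone σ τ i {t} {t′} t≤t′ one with G⇒ σ τ i t one
    ... | m , m≤t , r = G⇐ σ τ i t′ m (ℕ.≤-trans m≤t t≤t′) r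
    program⇔ : ProgramLanguage σ ⇔ (Σ[ τ ∈ ωWord 2 ] ∀ i → ∃[ t ] G i (number n′ σ τ t) ≡ 1)
    program⇔ = programLanguage⇔ n′ monotone σ
    to : ProgramLanguage σ → Σ[ τ ∈ ωWord 2 ] ∀ i → ∃[ m ] R i (τ ↾ m) (σ ↾ m)
    to p with Equivalence.to program⇔ p
    ... | τ , succ = τ , λ i → proj₁ (G⇒ σ τ i (proj₁ (succ i)) (proj₂ (succ i))) , proj₂ (proj₂ (G⇒ σ τ i (proj₁ (succ i)) (proj₂ (succ i))))
    from : (Σ[ τ ∈ ωWord 2 ] ∀ i → ∃[ m ] R i (τ ↾ m) (σ ↾ m)) → ProgramLanguage σ
    from (τ , r) = Equivalence.from program⇔ (τ , λ i → proj₁ (r i) , G⇐ σ τ i (proj₁ (r i)) (proj₁ (r i)) ℕ.≤-refl (proj₂ (r i)))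

-- Degrees of analytic sets

module AnalyticToNet (em : ExcludedMiddle 0ℓ) where

  noLetters∈r-PNω : (L : ωLang 0) → r-PNω 0 L
  noLetters∈r-PNω L with NetAutomaton.netLanguage∈r-PNω trivial (s≤s z≤n)
    where
    trivial : Net 0
    trivial = record
      { State = Fin 1 ; Counter = Fin 1 ; finiteState = finite-Fin 1 ; finiteCounter = finite-Fin 1
      ; start = 0F ; transitions = λ _ () ; accepting = λ _ → false }
  ... | k , 1≤k , A , _ = k , 1≤k , A , (λ {σ} _ → case σ 0 of λ ()) , (λ {σ} _ → case σ 0 of λ ())

  analytic-extensional : ∀ {n} {L : ωLang n} → Σ¹₁ n L → Extensional L
  analytic-extensional (R , _ , L⇔) {x} {y} x≡y l with Equivalence.to (L⇔ x) l
  ... | τ , r = Equivalence.from (L⇔ y) (τ , λ i → proj₁ (r i) ,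
          subst (R i (τ ↾ proj₁ (r i))) (↾-cong (proj₁ (r i)) (λ s _ → x≡y s)) (proj₂ (r i)))

  analytic-degree : ∀ {n} (L : ωLang n) → Σ¹₁ n L → ∃[ m ] Σ[ L′ ∈ ωLang m ] r-PNω m L′ × L ≡W L′
  analytic-degree {zero} L _ = 0 , L , noLetters∈r-PNω L , ≡W-refl
  analytic-degree {suc n′} L analytic@(R , recursive , L⇔) with em {Classical.Ranks.Ranked em L []}
  ... | yes root = 2 , Toggle.Toggle budget , ToggleNet.toggle∈r-PNω em budget , L≡WToggle
    where open FiniteRankDegree em L (analytic-extensional analytic) (λ _ → 0F) root using (budget; L≡WToggle)
  ... | no unrooted = γ , Net.NetLanguage net , NetAutomaton.netLanguage∈r-PNω net positive-size ,
    Saturation.Reduction.L≡WL′ L (analytic-extensional analytic) (Net.NetLanguage net)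
      pos decode (fits ∘ position) code code-local code-fits decode-code inside⇔ outside-open unranked (λ _ → 0F)
    where
    open Classical em using (module Saturation)
    open AnalyticProgram n′ R recursive using (G; Gᶜ; G-01; programLanguage)
    open MainLoop G Gᶜ G-01 using (K; program)
    open Coding n′ K program
    open CodingBackward n′ K program using (inside⇒program; outside-open)
    open CodingForward n′ K program using (program⇒inside)
    positive-size : 1 ≤ Finite.size (Net.finiteCounter net)
    positive-size = s≤s z≤n
    inside⇔ : ∀ y → (∀ s → T (fits (position s) (y s))) → Net.NetLanguage net y ⇔ L (decode ∘ y ∘ pos)
    inside⇔ y fitting = mk⇔
      (Equivalence.from (L⇔ _) ∘ Equivalence.to (programLanguage _) ∘ inside⇒program y fitting)
      (program⇒inside y fitting ∘ Equivalence.from (programLanguage _) ∘ Equivalence.to (L⇔ _))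
    unranked : ∀ r → Alternation.Alternates L r true []
    unranked r with em {Alternation.Alternates L r true []}
    ... | yes a = a
    ... | no ¬a = ⊥-elim (unrooted (r , ¬a))

-- Languages of nets with λ-transitions are effective analytic

finite-Maybe : ∀ {A} → Finite A → Finite (Maybe A)
finite-Maybe FA = finite-retract (finite-⊎ (finite-Fin 1) FA)
  (λ { nothing → inj₁ 0F ; (just a) → inj₂ a }) (λ { (inj₁ _) → nothing ; (inj₂ a) → just a })
  λ { nothing → refl ; (just a) → refl }

finite-Vec : ∀ {A} k → Finite A → Finite (Vec A k)
finite-Vec zero    FA = finite-retract (finite-Fin 1) (λ _ → 0F) (λ _ → []) λ { [] → refl }
finite-Vec (suc k) FA = finite-retract (finite-× FA (finite-Vec k FA)) (λ { (a ∷ v) → a , v }) (λ (a , v) → a ∷ v)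
  λ { (a ∷ v) → refl }

finite-Action : Finite Action
finite-Action = finite-retract (finite-Fin 3) (λ { hold → 0F ; inc → 1F ; dec → suc 1F })
  (λ { 0F → hold ; 1F → inc ; (suc (suc _)) → dec }) λ { hold → refl ; inc → refl ; dec → refl }

sumFin : ∀ k → (Fin k → ℕ) → ℕ
sumFin zero    f = 0
sumFin (suc k) f = f 0F + sumFin k (f ∘ suc)

sumFinᶜ : ∀ {m} k {f : Fin k → Vec ℕ m → ℕ} → (∀ c → Computable (f c)) → Computable (λ xs → sumFin k (λ c → f c xs))
sumFinᶜ zero    F = constᶜ 0
sumFinᶜ (suc k) F = comp₂ addᶜ (F 0F) (sumFinᶜ k (F ∘ suc))

sumFin-cong : ∀ k {f g : Fin k → ℕ} → (∀ c → f c ≡ g c) → sumFin k f ≡ sumFin k g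
sumFin-cong zero    eq = refl
sumFin-cong (suc k) eq = cong₂ _+_ (eq 0F) (sumFin-cong k (eq ∘ suc))

sumFin-zero : ∀ k {f : Fin k → ℕ} → sumFin k f ≡ 0 → ∀ c → f c ≡ 0
sumFin-zero (suc k) eq zero    = ℕ.m+n≡0⇒m≡0 _ eq
sumFin-zero (suc k) {f} eq (suc c) = sumFin-zero k (ℕ.m+n≡0⇒n≡0 (f 0F) eq) c

sumFin-all-zero : ∀ k {f : Fin k → ℕ} → (∀ c → f c ≡ 0) → sumFin k f ≡ 0
sumFin-all-zero zero    z = refl
sumFin-all-zero (suc k) z = cong₂ _+_ (z 0F) (sumFin-all-zero k (z ∘ suc))

-- Arithmetic of guessed runs

module Checker {k n : ℕ} (A : BüchiAutomaton k (Maybe (Fin n))) where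
  open BüchiAutomaton A

  Transition : Set
  Transition = Fin states × Maybe (Fin n) × Vec (Fin 2) k × Fin states × Vec Action k

  abstract
    finite-Transition : Finite Transition
    finite-Transition = finite-× (finite-Fin states) (finite-× (finite-Maybe (finite-Fin n))
      (finite-× (finite-Vec k (finite-Fin 2)) (finite-× (finite-Fin states) (finite-Vec k finite-Action))))

  open Finite finite-Transition using (encode; decode; decode-encode) renaming (size to E₀) public

  -- A transition is written as a block of E bits, and is given by their sum.
  E : ℕ
  E = suc E₀

  source target : Transition → Fin states
  source (q , _) = q
  target (_ , _ , _ , q , _) = q

  label : Transition → Maybe (Fin n)
  label (_ , a , _) = a

  tests : Transition → Vec (Fin 2) k
  tests (_ , _ , i , _) = i

  actionsOf : Transition → Vec Action k
  actionsOf (_ , _ , _ , _ , j) = j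

  permitted : Transition → Bool
  permitted (q , a , i , q′ , j) = Δ q a i q′ j

  number : Transition → ℕ
  number t = suc (toℕ (encode t))

  entryAt : (Transition → ℕ) → Fin E → ℕ
  entryAt f zero    = 0
  entryAt f (suc e) = f (decode e)

  entry : (Transition → ℕ) → ℕ → ℕ
  entry f = table E (entryAt f)

  entryᶜ : ∀ f → Computable₁ (entry f)
  entryᶜ f = tableᶜ E (entryAt f)

  entry-number : ∀ f t → entry f (number t) ≡ f t
  entry-number f t = trans (table-toℕ E (entryAt f) (suc (encode t))) (cong f (decode-encode t))

  -- A nonzero entry shows that `x` lies in the range of the table, and one transition then accounts
  -- for all entries at `x`. With the constant `one` this recognizes the valid numbers.
  entry-≢0 : ∀ f x → entry f x ≢ 0 → ∃[ t ] ∀ g → entry g x ≡ g t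
  entry-≢0 f zero    ne = contradiction refl ne
  entry-≢0 f (suc x) ne = let e , eq = go E₀ x decode ne in decode e , eq
    where
    go : ∀ m x (d : Fin m → Transition) → table m (f ∘ d) x ≢ 0 → ∃[ e ] ∀ g → table m (g ∘ d) x ≡ g (d e)
    go zero    x       d ne = contradiction refl ne
    go (suc m) zero    d ne = 0F , λ g → refl
    go (suc m) (suc x) d ne = let e , eq = go m x (d ∘ suc) ne in suc e , eq

  isInc isDec : Action → ℕ
  isInc inc = 1
  isInc _   = 0
  isDec dec = 1
  isDec _   = 0

  reads letterCode : Maybe (Fin n) → ℕ
  reads nothing       = 0
  reads (just _)      = 1
  letterCode nothing  = 0
  letterCode (just a) = suc (toℕ a)

  final : Fin states → ℕ
  final q = if lookup F q then 1 else 0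

  one forbidden sourceOf targetOf readsOf letterOf finalOf : Transition → ℕ
  one _       = 1
  forbidden t = if permitted t then 0 else 1
  sourceOf    = toℕ ∘ source
  targetOf    = toℕ ∘ target
  readsOf     = reads ∘ label
  letterOf    = letterCode ∘ label
  finalOf     = final ∘ source

  testOf incOf decOf : Fin k → Transition → ℕ
  testOf c t = toℕ (lookup (tests t) c)
  incOf c t  = isInc (lookup (actionsOf t) c)
  decOf c t  = isDec (lookup (actionsOf t) c)

  -- x s is the number of the transition taken at time s, and z p is the code of the letter at p.
  module _ (x : ℕ → ℕ) where
    val : Fin k → ℕ → ℕ
    val c zero    = 0
    val c (suc s) = (val c s + entry (incOf c) (x s)) ∸ entry (decOf c) (x s)

    letters : ℕ → ℕ
    letters zero    = 0
    letters (suc s) = letters s + entry readsOf (x s)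

    current : ℕ → ℕ
    current zero    = toℕ q₀
    current (suc s) = entry targetOf (x s)

    counterError : ℕ → Fin k → ℕ
    counterError s c = differ (entry (testOf c) (x s)) (isPositive (val c s))

    -- A sum of naturals vanishes only if each summand does: `x s` has to be a valid number of a
    -- permitted transition that leaves the current state, has the tests of the current counters,
    -- and reads the next letter if it reads any.
    err : (ℕ → ℕ) → ℕ → ℕ
    err z s = isZero (entry one (x s)) + (entry forbidden (x s)
            + (differ (entry sourceOf (x s)) (current s) + (sumFin k (counterError s)
            + entry readsOf (x s) * differ (entry letterOf (x s)) (z (letters s)))))

    -- Nonzero at a final state visited at a time `s ≥ i` with at least `i` letters read. Asked for
    -- every `i`, this expresses at once the Büchi condition and that the labels do not end in λ for
    -- ever.
    good : ℕ → ℕ → ℕ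
    good i s = isZero (i ∸ s) * (isZero (i ∸ letters s) * entry finalOf (x s))

  module _ {x x′ : ℕ → ℕ} where
    val-cong : ∀ c s → (∀ t → t < s → x t ≡ x′ t) → val x c s ≡ val x′ c s
    val-cong c zero    eq = refl
    val-cong c (suc s) eq rewrite eq s ℕ.≤-refl | val-cong c s (λ t t<s → eq t (ℕ.m≤n⇒m≤1+n t<s)) = refl

    letters-cong : ∀ s → (∀ t → t < s → x t ≡ x′ t) → letters x s ≡ letters x′ s
    letters-cong zero    eq = refl
    letters-cong (suc s) eq rewrite eq s ℕ.≤-refl | letters-cong s (λ t t<s → eq t (ℕ.m≤n⇒m≤1+n t<s)) = refl

    current-cong : ∀ s → (∀ t → t < s → x t ≡ x′ t) → current x s ≡ current x′ s
    current-cong zero    eq = refl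
    current-cong (suc s) eq rewrite eq s ℕ.≤-refl = refl

    module _ (s : ℕ) (eq : ∀ t → t ≤ s → x t ≡ x′ t) where
      private
        eq< : ∀ t → t < s → x t ≡ x′ t
        eq< t t<s = eq t (ℕ.<⇒≤ t<s)

      err-cong : ∀ {z z′} → z (letters x s) ≡ z′ (letters x s) → err x z s ≡ err x′ z′ s
      err-cong {z} {z′} zeq =
        cong₂ _+_ (cong (isZero ∘ entry one) here≡)
        (cong₂ _+_ (cong (entry forbidden) here≡)
        (cong₂ _+_ (cong₂ differ (cong (entry sourceOf) here≡) (current-cong s eq<))
        (cong₂ _+_ (sumFin-cong k (λ c → cong₂ differ (cong (entry (testOf c)) here≡)
                     (cong isPositive (val-cong c s eq<))))
        (cong₂ _*_ (cong (entry readsOf) here≡)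
          (cong₂ differ (cong (entry letterOf) here≡) (trans zeq (cong z′ (letters-cong s eq<))))))))
        where here≡ = eq s ℕ.≤-refl

      good-cong : ∀ i → good x i s ≡ good x′ i s
      good-cong i = cong (isZero (i ∸ s) *_) (cong₂ _*_ (cong (λ l → isZero (i ∸ l)) (letters-cong s eq<))
        (cong (entry finalOf) (eq s ℕ.≤-refl)))

  letters-step : ∀ x s → letters x (suc s) ≤ suc (letters x s)
  letters-step x s = subst (letters x (suc s) ≤_) (ℕ.+-comm _ 1) (ℕ.+-monoʳ-≤ (letters x s) (entry≤1 (x s)))
    where
    reads≤1 : ∀ a → reads a ≤ 1
    reads≤1 nothing  = z≤n
    reads≤1 (just _) = ℕ.≤-refl
    table≤1 : ∀ m (f : Fin m → ℕ) → (∀ i → f i ≤ 1) → ∀ x → table m f x ≤ 1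
    table≤1 zero    f p x       = z≤n
    table≤1 (suc m) f p zero    = p 0F
    table≤1 (suc m) f p (suc x) = table≤1 m (f ∘ suc) (p ∘ suc) x
    entry≤1 : ∀ x → entry readsOf x ≤ 1
    entry≤1 = table≤1 E _ λ { zero → z≤n ; (suc e) → reads≤1 (label (decode e)) }

  letters-≤ : ∀ x s → letters x s ≤ s
  letters-≤ x zero    = z≤n
  letters-≤ x (suc s) = ℕ.≤-trans (letters-step x s) (s≤s (letters-≤ x s))

  letters-mono : ∀ x {s s′} → s ≤ s′ → letters x s ≤ letters x s′
  letters-mono x {s} {s′} s≤s′ with ℕ.m≤n⇒m<n∨m≡n s≤s′
  ... | inj₂ refl = ℕ.≤-refl
  letters-mono x {s} {suc s′} _ | inj₁ (s≤s s≤s′) = ℕ.≤-trans (letters-mono x s≤s′) (ℕ.m≤m+n _ _)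

  letters-reach : ∀ x m s → m ≤ letters x s → ∃[ t ] letters x t ≡ m
  letters-reach x m s m≤ with ℕ.m≤n⇒m<n∨m≡n m≤
  ... | inj₂ refl = s , refl
  letters-reach x m (suc s) m≤ | inj₁ m< = letters-reach x m s (ℕ.≤-pred (ℕ.≤-trans m< (letters-step x s)))

  block : (ℕ → ℕ) → ℕ → ℕ
  block β s = sumTo (λ b → β (b + s * E)) E

  module D₂ = Digits 2
  module Dₙ = Digits n

  bitOf : Fin 3 → ℕ
  bitOf i = pred (toℕ i)

  bit : ℕ → ℕ → ℕ
  bit u p = table 3 bitOf (D₂.digit p u)

  blockAt : ℕ → ℕ → ℕ
  blockAt u = block (bit u)

  letterAt : ℕ → ℕ → ℕ
  letterAt v p = Dₙ.digit p v

  -- The last bit of block `s` is at `E₀ + s * E`; a nonzero digit there says that the word contains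
  -- the entire block.
  complete : ℕ → ℕ → ℕ
  complete u s = D₂.digit (E₀ + s * E) u

  private
    2F : ∀ {m} → Fin (3 + m)
    2F = suc 1F

  blockᶜ : Computable₂ (λ s u → blockAt u s)
  blockᶜ = computable₂ (sumToᶜ
    {g = λ xs → table 3 bitOf (D₂.digit (lookup xs 0F + lookup xs 1F * E) (lookup xs 2F))}
    (comp₁ (tableᶜ 3 bitOf) (comp₂ D₂.digitᶜ (comp₂ addᶜ (varᶜ 0F) (comp₂ mulᶜ (varᶜ 1F) (constᶜ E))) (varᶜ 2F))) (constᶜ E))

  valᶜ : ∀ c → Computable₂ (λ s u → val (blockAt u) c s)
  valᶜ c = binaryᶜ (constᶜ 0)
    (comp₂ monusᶜ (comp₂ addᶜ (varᶜ 1F) (comp₁ (entryᶜ (incOf c)) (comp₂ blockᶜ (varᶜ 0F) (varᶜ 2F))))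
                  (comp₁ (entryᶜ (decOf c)) (comp₂ blockᶜ (varᶜ 0F) (varᶜ 2F))))
    (λ _ → refl) (λ _ _ → refl)

  lettersᶜ : Computable₂ (λ s u → letters (blockAt u) s)
  lettersᶜ = binaryᶜ (constᶜ 0)
    (comp₂ addᶜ (varᶜ 1F) (comp₁ (entryᶜ readsOf) (comp₂ blockᶜ (varᶜ 0F) (varᶜ 2F)))) (λ _ → refl) (λ _ _ → refl)

  currentᶜ : Computable₂ (λ s u → current (blockAt u) s)
  currentᶜ = binaryᶜ (constᶜ (toℕ q₀)) (comp₁ (entryᶜ targetOf) (comp₂ blockᶜ (varᶜ 0F) (varᶜ 2F))) (λ _ → refl) (λ _ _ → refl)

  errᶜ : Computable₃ (λ i u v → err (blockAt u) (letterAt v) i)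
  errᶜ = computable₃ (comp₂ addᶜ (comp₁ isZeroᶜ (at one)) (comp₂ addᶜ (at forbidden)
    (comp₂ addᶜ (comp₂ differᶜ (at sourceOf) (comp₂ currentᶜ (varᶜ 0F) (varᶜ 1F)))
    (comp₂ addᶜ (sumFinᶜ k λ c → comp₂ differᶜ (at (testOf c)) (comp₁ isPositiveᶜ (comp₂ (valᶜ c) (varᶜ 0F) (varᶜ 1F))))
    (comp₂ mulᶜ (at readsOf) (comp₂ differᶜ (at letterOf) (comp₂ Dₙ.digitᶜ (comp₂ lettersᶜ (varᶜ 0F) (varᶜ 1F)) (varᶜ 2F))))))))
    where
    at : ∀ f → Computable {3} (λ xs → entry f (blockAt (lookup xs 1F) (lookup xs 0F)))
    at f = comp₁ (entryᶜ f) (comp₂ blockᶜ (varᶜ 0F) (varᶜ 1F))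

  goodᶜ : Computable₃ (λ i s u → good (blockAt u) i s)
  goodᶜ = computable₃ (comp₂ mulᶜ (comp₁ isZeroᶜ (comp₂ monusᶜ (varᶜ 0F) (varᶜ 1F)))
    (comp₂ mulᶜ (comp₁ isZeroᶜ (comp₂ monusᶜ (varᶜ 0F) (comp₂ lettersᶜ (varᶜ 1F) (varᶜ 2F))))
                (comp₁ (entryᶜ finalOf) (comp₂ blockᶜ (varᶜ 1F) (varᶜ 2F)))))

  completeᶜ : Computable₂ (λ s u → complete u s)
  completeᶜ = computable₂ (comp₂ D₂.digitᶜ (comp₂ addᶜ (constᶜ E₀) (comp₂ mulᶜ (varᶜ 0F) (constᶜ E))) (varᶜ 1F))

  -- The code of a word is at least its length, so the bound `u` admits every complete block.
  visits : ℕ → ℕ → ℕ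
  visits i u = sumTo (λ s → complete u s * good (blockAt u) i s) u

  abstract
    G : ℕ → ℕ → ℕ → ℕ
    G i u v = isPositive (isZero (err (blockAt u) (letterAt v) i) * (complete u i * visits i u))

    G-def : ∀ i u v → G i u v ≡ isPositive (isZero (err (blockAt u) (letterAt v) i) * (complete u i * visits i u))
    G-def i u v = refl

    Gᶜ : Computable₃ G
    Gᶜ = computable₃ (comp₁ isPositiveᶜ (comp₂ mulᶜ (comp₁ isZeroᶜ (comp₃ errᶜ (varᶜ 0F) (varᶜ 1F) (varᶜ 2F)))
      (comp₂ mulᶜ (comp₂ completeᶜ (varᶜ 0F) (varᶜ 1F))
        (sumToᶜ {g = λ xs → complete (lookup xs 2F) (lookup xs 0F) * good (blockAt (lookup xs 2F)) (lookup xs 1F) (lookup xs 0F)}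
          (comp₂ mulᶜ (comp₂ completeᶜ (varᶜ 0F) (varᶜ 2F)) (comp₃ goodᶜ (varᶜ 1F) (varᶜ 0F) (varᶜ 2F))) (varᶜ 1F)))))

  isPositive-1 : ∀ {x} → isPositive x ≡ 1 → x ≢ 0
  isPositive-1 () refl

  isPositive-≢0 : ∀ {x} → x ≢ 0 → isPositive x ≡ 1
  isPositive-≢0 {zero}  ne = contradiction refl ne
  isPositive-≢0 {suc x} ne = refl

  isZero-≢0 : ∀ {x} → isZero x ≢ 0 → x ≡ 0
  isZero-≢0 {zero}  ne = refl
  isZero-≢0 {suc x} ne = contradiction refl ne

  *-≢0 : ∀ {x y} → x * y ≢ 0 → x ≢ 0 × y ≢ 0
  *-≢0 {x} ne = (λ { refl → ne refl }) , (λ { refl → ne (ℕ.*-zeroʳ x) })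

  ≢0-* : ∀ {x y} → x ≢ 0 → y ≢ 0 → x * y ≢ 0
  ≢0-* {x} x≢0 y≢0 eq with ℕ.m*n≡0⇒m≡0∨n≡0 x eq
  ... | inj₁ z = x≢0 z
  ... | inj₂ z = y≢0 z

  Rel : ℕ → List (Fin 2) → List (Fin n) → Set
  Rel i u v = G i ⌜ u ⌝ ⌜ v ⌝ ≡ 1

  rel-recursive : Recursive Rel
  rel-recursive = Computable.rec (Computable₃.uncurried Gᶜ) , λ i u v → decide i ⌜ u ⌝ ⌜ v ⌝
    where
    decide : ∀ i x y → (G i x y ≡ 1 × Computable.rec (Computable₃.uncurried Gᶜ) [ i ∷ x ∷ y ∷ [] ]↓ 1) ⊎
                       (¬ (G i x y ≡ 1) × Computable.rec (Computable₃.uncurried Gᶜ) [ i ∷ x ∷ y ∷ [] ]↓ 0)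
    decide i x y with G i x y | G-def i x y | Computable.computes (Computable₃.uncurried Gᶜ) (i ∷ x ∷ y ∷ [])
    ... | g | eq | d with isZero (err (blockAt x) (letterAt y) i) * (complete x i * visits i x)
    decide i x y | _ | refl | d | zero  = inj₂ ((λ ()) , d)
    decide i x y | _ | refl | d | suc _ = inj₁ (refl , d)

-- Sequences of transitions as binary words

module CheckerWords {k n′ : ℕ} (A : BüchiAutomaton k (Maybe (Fin (suc n′)))) where
  n : ℕ
  n = suc n′
  open BüchiAutomaton A using (states; q₀; Δ; F)
  open Checker A

  codesOf : ωWord n → ℕ → ℕ
  codesOf σ p = suc (toℕ (σ p))

  blocksOf : ωWord 2 → ℕ → ℕ
  blocksOf τ = block (toℕ ∘ τ)

  private
    position-≤ : ∀ {b s s′} → b < E → s ≤ s′ → b + s * E ≤ E₀ + s′ * E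
    position-≤ (s≤s b≤) s≤s′ = ℕ.+-mono-≤ b≤ (ℕ.*-monoˡ-≤ E s≤s′)

  module _ (τ : ωWord 2) (σ : ωWord n) (m : ℕ) where
    private
      u = ⌜ τ ↾ m ⌝
      v = ⌜ σ ↾ m ⌝

    complete⇒< : ∀ s → complete u s ≢ 0 → E₀ + s * E < m
    complete⇒< s ne with ℕ.<-≤-connex (E₀ + s * E) m
    ... | inj₁ lt = lt
    ... | inj₂ ge = contradiction (digit-≥ 1 τ ge) ne

    <⇒complete : ∀ s → E₀ + s * E < m → complete u s ≢ 0
    <⇒complete s lt z = contradiction (trans (sym (digit-< 1 τ lt)) z) λ ()

    bit-< : ∀ {p} → p < m → bit u p ≡ toℕ (τ p)
    bit-< {p} p<m = trans (cong (table 3 bitOf) (digit-< 1 τ p<m)) (table-toℕ 3 bitOf (suc (τ p)))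

    blocks-agree : ∀ s → E₀ + s * E < m → ∀ t → t ≤ s → blockAt u t ≡ blocksOf τ t
    blocks-agree s lt t t≤s = sumTo-cong E λ b b<E → bit-< (ℕ.≤-<-trans (position-≤ b<E t≤s) lt)

    -- One length `m` can serve for both words, since a transition occupies `E` bits of `τ`, at
    -- least one, and reads at most one letter of `σ`.
    letter-agree : ∀ s → E₀ + s * E < m → letterAt v (letters (blockAt u) s) ≡ codesOf σ (letters (blockAt u) s)
    letter-agree s lt = digit-< n′ σ (ℕ.≤-<-trans (ℕ.≤-trans (letters-≤ (blockAt u) s)
      (ℕ.≤-trans (ℕ.m≤m*n s E) (ℕ.m≤n+m (s * E) E₀))) lt)

    G⇒ : ∀ i → G i u v ≡ 1 → err (blocksOf τ) (codesOf σ) i ≡ 0 × ∃[ s ] good (blocksOf τ) i s ≢ 0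
    G⇒ i one with *-≢0 (isPositive-1 (trans (sym (G-def i u v)) one))
    ... | e , rest with *-≢0 rest
    ... | c , vis with sumTo-positive u vis
    ... | s , _ , gs with *-≢0 gs
    ... | cs , g = trans (sym (err-cong i (blocks-agree i (complete⇒< i c)) {letterAt v} {codesOf σ} (letter-agree i (complete⇒< i c)))) (isZero-≢0 e) ,
      s , subst (_≢ 0) (good-cong s (blocks-agree s (complete⇒< s cs)) i) g

    G⇐ : ∀ i s → E₀ + i * E < m → E₀ + s * E < m → err (blocksOf τ) (codesOf σ) i ≡ 0 → good (blocksOf τ) i s ≢ 0 → G i u v ≡ 1
    G⇐ i s i< s< e g = trans (G-def i u v) (isPositive-≢0 (≢0-* err≢0 (≢0-* (<⇒complete i i<) visits≢0)))
      where
      err≢0 : isZero (err (blockAt u) (letterAt v) i) ≢ 0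
      err≢0 = subst (λ x → isZero x ≢ 0) (sym (trans (err-cong i (blocks-agree i i<) {letterAt v} {codesOf σ} (letter-agree i i<)) e)) λ ()
      s<u : s < u
      s<u = ℕ.<-≤-trans (ℕ.≤-<-trans (ℕ.≤-trans (ℕ.m≤m*n s E) (ℕ.m≤n+m (s * E) E₀)) s<)
        (subst (m ≤_) (sym (code-sum τ m)) (sumTo-≥ _ m (λ p → ℕ.*-mono-≤ {1} {suc (toℕ (τ p))} (s≤s z≤n) (ℕ.m^n>0 2 p))))
      visits≢0 : visits i u ≢ 0
      visits≢0 z = ≢0-* (<⇒complete s s<) (subst (_≢ 0) (sym (good-cong s (blocks-agree s s<) i)) g) (sumTo-zero u z s s<u)

  Checked : ωWord n → (ℕ → ℕ) → Set
  Checked σ x = (∀ i → err x (codesOf σ) i ≡ 0) × (∀ i → ∃[ s ] good x i s ≢ 0)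

  rel⇒checked : ∀ σ τ → (∀ i → ∃[ m ] Rel i (τ ↾ m) (σ ↾ m)) → Checked σ (blocksOf τ)
  rel⇒checked σ τ r = (λ i → proj₁ (G⇒ τ σ (proj₁ (r i)) i (proj₂ (r i)))) , λ i → proj₂ (G⇒ τ σ (proj₁ (r i)) i (proj₂ (r i)))

  checked⇒rel : ∀ σ τ → Checked σ (blocksOf τ) → ∀ i → ∃[ m ] Rel i (τ ↾ m) (σ ↾ m)
  checked⇒rel σ τ (errs , goods) i with goods i
  ... | s , g = suc (E₀ + i * E) + (E₀ + s * E) ,
    G⇐ τ σ (suc (E₀ + i * E) + (E₀ + s * E)) i s (ℕ.m≤m+n (suc (E₀ + i * E)) _) (s≤s (ℕ.m≤n+m _ (E₀ + i * E))) (errs i) g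

  checked-cong : ∀ σ {x x′} → (∀ s → x s ≡ x′ s) → Checked σ x → Checked σ x′
  checked-cong σ {x} {x′} eq (errs , goods) =
    (λ i → trans (sym (err-cong i (λ t _ → eq t) {codesOf σ} {codesOf σ} refl)) (errs i)) ,
    (λ i → proj₁ (goods i) , subst (_≢ 0) (good-cong (proj₁ (goods i)) (λ t _ → eq t) i) (proj₂ (goods i)))

  -- Within its block the number of a transition is written in unary: that many ones, then zeros.
  writes : (ℕ → Transition) → ωWord 2
  writes e p = if does (p % E ℕ.<? number (e (p / E))) then 1F else 0F

  number-≤ : ∀ t → number t ≤ E
  number-≤ t = s≤s (ℕ.<⇒≤ (Fin.toℕ<n _))

  sumTo-below : ∀ c m → sumTo (λ b → if does (b ℕ.<? c) then 1 else 0) m ≡ m ⊓ c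
  sumTo-below c zero    = refl
  sumTo-below c (suc m) with ℕ.<-≤-connex m c
  ... | inj₁ m<c rewrite dec-true (m ℕ.<? c) m<c | sumTo-below c m | ℕ.m≤n⇒m⊓n≡m (ℕ.<⇒≤ m<c) | ℕ.m≤n⇒m⊓n≡m m<c = ℕ.+-comm m 1
  ... | inj₂ c≤m rewrite dec-false (m ℕ.<? c) (ℕ.≤⇒≯ c≤m) | sumTo-below c m | ℕ.m≥n⇒m⊓n≡n c≤m | ℕ.m≥n⇒m⊓n≡n (ℕ.m≤n⇒m≤1+n c≤m) = ℕ.+-identityʳ c

  blocksOf-writes : ∀ e s → blocksOf (writes e) s ≡ number (e s)
  blocksOf-writes e s = trans (sumTo-cong E entry≡) (trans (sumTo-below (number (e s)) E) (ℕ.m≥n⇒m⊓n≡n (number-≤ (e s))))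
    where
    toℕ-if : ∀ b → toℕ {2} (if b then 1F else 0F) ≡ (if b then 1 else 0)
    toℕ-if true  = refl
    toℕ-if false = refl
    entry≡ : ∀ b → b < E → toℕ (writes e (b + s * E)) ≡ (if does (b ℕ.<? number (e s)) then 1 else 0)
    entry≡ b b<E = trans (toℕ-if _) (cong₂ (λ r q → if does (r ℕ.<? number (e q)) then 1 else 0)
      (trans ([m+kn]%n≡m%n b s E) (m<n⇒m%n≡m b<E))
      (trans (+-distrib-/-∣ʳ b (divides s refl)) (cong₂ _+_ (m<n⇒m/n≡0 b<E) (m*n/n≡m s E))))

vec-ext : ∀ {A : Set} {k} {xs ys : Vec A k} → (∀ i → lookup xs i ≡ lookup ys i) → xs ≡ ys
vec-ext {xs = []}     {[]}     eq = refl
vec-ext {xs = x ∷ xs} {y ∷ ys} eq = cong₂ _∷_ (eq 0F) (vec-ext (eq ∘ suc))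

-- Acceptance asks for one recurring state. If none recurred, each value with property `P` would
-- have a time after which it is not taken, and the sum of these finitely many times would bound
-- them all.
pigeonhole : ExcludedMiddle 0ℓ → ∀ {m} (f : ℕ → Fin m) (P : Fin m → Set) → (∀ i → ∃[ s ] i ≤ s × P (f s)) →
             ∃[ q ] P q × (∀ i → ∃[ s ] i ≤ s × f s ≡ q)
pigeonhole em {m} f P often with em {∃[ q ] P q × (∀ i → ∃[ s ] i ≤ s × f s ≡ q)}
... | yes found = found
... | no none   = ⊥-elim (proj₂ (stops (f s)) Pfs s (ℕ.≤-trans (below (f s)) le) refl)
  where
  stops : ∀ q → ∃[ N ] (P q → ∀ s → N ≤ s → f s ≢ q)
  stops q with em {∃[ N ] (P q → ∀ s → N ≤ s → f s ≢ q)}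
  ... | yes ends = ends
  ... | no ¬ends = ⊥-elim (¬ends (0 , λ Pq → ⊥-elim (none (q , Pq , λ i → returns i Pq))))
    where
    returns : ∀ i → P q → ∃[ s ] i ≤ s × f s ≡ q
    returns i Pq with em {∃[ s ] i ≤ s × f s ≡ q}
    ... | yes r = r
    ... | no ¬r = ⊥-elim (¬ends (i , λ _ s i≤s eq → ¬r (s , i≤s , eq)))
  bound : ℕ
  bound = sumFin m (proj₁ ∘ stops)
  below : ∀ q → proj₁ (stops q) ≤ bound
  below = member m (proj₁ ∘ stops)
    where
    member : ∀ m (g : Fin m → ℕ) q → g q ≤ sumFin m g
    member (suc m) g zero    = ℕ.m≤m+n (g 0F) _
    member (suc m) g (suc q) = ℕ.≤-trans (member m (g ∘ suc) q) (ℕ.m≤n+m _ (g 0F))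
  s   = proj₁ (often bound)
  le  = proj₁ (proj₂ (often bound))
  Pfs = proj₂ (proj₂ (often bound))

catMaybes-∷ʳ-just : ∀ {A : Set} (l : List (Maybe A)) a → List.catMaybes (l ∷ʳ just a) ≡ List.catMaybes l ∷ʳ a
catMaybes-∷ʳ-just l a = catMaybes-++ l (just a ∷ [])

catMaybes-∷ʳ-nothing : ∀ {A : Set} (l : List (Maybe A)) → List.catMaybes (l ∷ʳ nothing) ≡ List.catMaybes l
catMaybes-∷ʳ-nothing l = trans (catMaybes-++ l (nothing ∷ [])) (++-identityʳ _)

-- Checked sequences are accepting runs

module CheckerCorrect {k n′ : ℕ} (A : BüchiAutomaton k (Maybe (Fin (suc n′)))) where
  open BüchiAutomaton A
  open Checker A
  open CheckerWords A using (n; codesOf; Checked; writes; blocksOf; blocksOf-writes; checked-cong; rel⇒checked; checked⇒rel)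

  change : Action → ℕ → ℕ
  change a v = (v + isInc a) ∸ isDec a

  applies-change : ∀ a {v} → (v ≡ 0 → a ≢ dec) → Applies a v (change a v)
  applies-change hold {v}     _  = ℕ.+-identityʳ v
  applies-change inc  {v}     _  = ℕ.+-comm v 1
  applies-change dec  {zero}  ok = contradiction refl (ok refl)
  applies-change dec  {suc v} _  = cong suc (ℕ.+-identityʳ v)

  change-applies : ∀ a {v v′} → Applies a v v′ → v′ ≡ change a v
  change-applies hold {v} refl = sym (ℕ.+-identityʳ v)
  change-applies inc  {v} refl = sym (ℕ.+-comm v 1)
  change-applies dec  {v′ = v′} refl = sym (ℕ.+-identityʳ v′)

  toℕ-test : ∀ v → toℕ (test v) ≡ isPositive v
  toℕ-test zero    = refl
  toℕ-test (suc _) = refl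

  module FromChecked (em : ExcludedMiddle 0ℓ) (σ : ωWord n) (x : ℕ → ℕ) (checked : Checked σ x) where

    private
      part₁ : ∀ i → isZero (entry one (x i)) ≡ 0
      part₁ i = ℕ.m+n≡0⇒m≡0 _ (proj₁ checked i)
      rest₁ = λ i → ℕ.m+n≡0⇒n≡0 (isZero (entry one (x i))) (proj₁ checked i)
      rest₂ = λ i → ℕ.m+n≡0⇒n≡0 (entry forbidden (x i)) (rest₁ i)
      rest₃ = λ i → ℕ.m+n≡0⇒n≡0 (differ (entry sourceOf (x i)) (current x i)) (rest₂ i)
      rest₄ = λ i → ℕ.m+n≡0⇒n≡0 (sumFin k (counterError x i)) (rest₃ i)

      isZero-0 : ∀ {y} → isZero y ≡ 0 → y ≢ 0
      isZero-0 () refl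

    e : ℕ → Transition
    e i = proj₁ (entry-≢0 one (x i) (isZero-0 (part₁ i)))

    entry-e : ∀ i g → entry g (x i) ≡ g (e i)
    entry-e i = proj₂ (entry-≢0 one (x i) (isZero-0 (part₁ i)))

    permitted-e : ∀ i → T (permitted (e i))
    permitted-e i = if-zero (trans (sym (entry-e i forbidden)) (ℕ.m+n≡0⇒m≡0 _ (rest₁ i)))
      where
      if-zero : ∀ {b} → (if b then 0 else 1) ≡ 0 → T b
      if-zero {true} _ = tt

    source-e : ∀ i → toℕ (source (e i)) ≡ current x i
    source-e i = trans (sym (entry-e i sourceOf)) (differ-≡ _ _ (ℕ.m+n≡0⇒m≡0 _ (rest₂ i)))

    tests-e : ∀ i c → toℕ (lookup (tests (e i)) c) ≡ isPositive (val x c i)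
    tests-e i c = trans (sym (entry-e i (testOf c))) (differ-≡ _ _ (sumFin-zero k (ℕ.m+n≡0⇒m≡0 _ (rest₃ i)) c))

    letter-e : ∀ i {a} → label (e i) ≡ just a → a ≡ σ (letters x i)
    letter-e i {a} eq = Fin.toℕ-injective (ℕ.suc-injective (differ-≡ _ _ (trans (sym (ℕ.+-identityʳ _)) match)))
      where
      match : 1 * differ (suc (toℕ a)) (codesOf σ (letters x i)) ≡ 0
      match = subst₂ (λ r l → r * differ l (codesOf σ (letters x i)) ≡ 0)
        (trans (entry-e i readsOf) (cong reads eq)) (trans (entry-e i letterOf) (cong letterCode eq)) (rest₄ i)

    values : ℕ → Vec ℕ k
    values i = tabulate (λ c → val x c i)

    source-next : ∀ i → source (e (suc i)) ≡ target (e i)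
    source-next i = Fin.toℕ-injective (trans (source-e (suc i)) (entry-e i targetOf))

    tests-values : ∀ i → tests (e i) ≡ Vec.map test (values i)
    tests-values i = vec-ext λ c → Fin.toℕ-injective (trans (tests-e i c) (sym (trans (cong toℕ
      (trans (Vec.lookup-map c test (values i)) (cong test (Vec.lookup∘tabulate _ c)))) (toℕ-test (val x c i)))))

    val-step : ∀ i c → val x c (suc i) ≡ change (lookup (actionsOf (e i)) c) (val x c i)
    val-step i c = cong₂ (λ a b → (val x c i + a) ∸ b) (entry-e i (incOf c)) (entry-e i (decOf c))

    run : Run (label ∘ e)
    run = record
      { config  = λ i → source (e i) , values i
      ; initial = cong₂ _,_ (Fin.toℕ-injective (source-e 0)) (tabulate-zero _ (λ c → refl))
      ; step    = λ i → actionsOf (e i) , allowed i , equation i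
      }
      where
      allowed : ∀ i → T (Δ (source (e i)) (label (e i)) (Vec.map test (values i)) (source (e (suc i))) (actionsOf (e i)))
      allowed i = subst₂ (λ is q′ → T (Δ (source (e i)) (label (e i)) is q′ (actionsOf (e i))))
        (tests-values i) (sym (source-next i)) (permitted-e i)
      -- Here blindness enters: a permitted transition cannot decrement a counter that tests zero,
      -- so the truncated subtraction in `val` is exact.
      not-dec : ∀ i c → val x c i ≡ 0 → lookup (actionsOf (e i)) c ≢ dec
      not-dec i c z isdec with proj₁ (blind _ _ _ _ _ (permitted-e i) c
        (Fin.toℕ-injective (trans (tests-e i c) (cong isPositive z))))
      ... | inj₁ h = contradiction (trans (sym h) isdec) λ ()
      ... | inj₂ h = contradiction (trans (sym h) isdec) λ ()
      equation : ∀ i c → int (lookup (values (suc i)) c) ≡ int (lookup (values i) c) ℤ.+ value (lookup (actionsOf (e i)) c)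
      equation i c = applies⇒ℤ a (subst₂ (Applies a) (sym (Vec.lookup∘tabulate _ c))
          (sym (trans (Vec.lookup∘tabulate _ c) (val-step i c))) (applies-change a (not-dec i c)))
        where a = lookup (actionsOf (e i)) c

    concatenates : ∀ i → List.catMaybes ((label ∘ e) ↾ i) ≡ σ ↾ letters x i
    concatenates zero    = refl
    concatenates (suc i) = trans (cong List.catMaybes (sym (applyUpTo-∷ʳ (label ∘ e) i))) (go (label (e i)) refl)
      where
      go : ∀ a → label (e i) ≡ a → List.catMaybes ((label ∘ e) ↾ i ∷ʳ label (e i)) ≡ σ ↾ letters x (suc i)
      go nothing eq = trans (cong (λ a → List.catMaybes ((label ∘ e) ↾ i ∷ʳ a)) eq)
        (trans (catMaybes-∷ʳ-nothing ((label ∘ e) ↾ i)) (trans (concatenates i)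
          (cong (σ ↾_) (sym (trans (cong (letters x i +_) (trans (entry-e i readsOf) (cong reads eq))) (ℕ.+-identityʳ _))))))
      go (just a) eq = trans (cong (λ a → List.catMaybes ((label ∘ e) ↾ i ∷ʳ a)) eq)
        (trans (catMaybes-∷ʳ-just ((label ∘ e) ↾ i) a) (trans (cong₂ _∷ʳ_ (concatenates i) (letter-e i eq))
          (trans (applyUpTo-∷ʳ σ (letters x i))
            (cong (σ ↾_) (sym (trans (cong (letters x i +_) (trans (entry-e i readsOf) (cong reads eq))) (ℕ.+-comm _ 1)))))))

    good-parts : ∀ i → ∃[ s ] i ≤ s × i ≤ letters x s × source (e s) ∈ₛ F
    good-parts i with proj₂ checked i
    ... | s , g with *-≢0 g
    ... | late , g′ with *-≢0 g′
    ... | read , fin = s , ℕ.m∸n≡0⇒m≤n (isZero-≢0 late) , ℕ.m∸n≡0⇒m≤n (isZero-≢0 read) ,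
        Vec.lookup⇒[]= _ F (final-true (subst (_≢ 0) (entry-e s finalOf) fin))
      where
      final-true : ∀ {b} → (if b then 1 else 0) ≢ 0 → b ≡ true
      final-true {true}  _  = refl
      final-true {false} ne = contradiction refl ne

    accepted : language A σ
    accepted = label ∘ e , ((λ t → letters x t , concatenates t) , reach) , run ,
      pigeonhole em (source ∘ e) (_∈ₛ F) (λ i → let s , i≤s , _ , fin = good-parts i in s , i≤s , fin)
      where
      reach : ∀ m → ∃[ t ] List.catMaybes ((label ∘ e) ↾ t) ≡ σ ↾ m
      reach m with good-parts m
      ... | s , _ , m≤ , _ with letters-reach x m s m≤
      ... | t , eq = t , trans (concatenates t) (cong (σ ↾_) eq)

  module FromRun (σ : ωWord n) (b : ℕ → Maybe (Fin n)) (concatenates : ConcatenatesTo b σ) (r : Run b) (accepting : Accepting r) where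
    open Run r

    cs : ℕ → Vec ℕ k
    cs s = proj₂ (config s)

    e : ℕ → Transition
    e s = state (config s) , b s , Vec.map test (cs s) , state (config (suc s)) , proj₁ (step s)

    x : ℕ → ℕ
    x s = number (e s)

    entry-e : ∀ g s → entry g (x s) ≡ g (e s)
    entry-e g s = entry-number g (e s)

    val-e : ∀ c s → val x c s ≡ lookup (cs s) c
    val-e c zero    = sym (trans (cong (λ cf → lookup (proj₂ cf) c) initial) (Vec.lookup-replicate c 0))
    val-e c (suc s) = trans (cong₂ _∸_ (cong₂ _+_ (val-e c s) (entry-e (incOf c) s)) (entry-e (decOf c) s))
      (sym (change-applies (lookup (proj₁ (step s)) c) (ℤ⇒applies (lookup (proj₁ (step s)) c) (proj₂ (proj₂ (step s)) c))))

    letters-e : ∀ s → List.catMaybes (b ↾ s) ≡ σ ↾ letters x s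
    letters-e s with proj₁ concatenates s
    ... | m , eq = trans eq (cong (σ ↾_) (trans (sym (length-↾ σ m)) (trans (cong length (sym eq)) (len s))))
      where
      len : ∀ s → length (List.catMaybes (b ↾ s)) ≡ letters x s
      len zero    = refl
      len (suc s) = trans (cong (length ∘ List.catMaybes) (sym (applyUpTo-∷ʳ b s))) (go (b s) refl)
        where
        go : ∀ a → b s ≡ a → length (List.catMaybes (b ↾ s ∷ʳ b s)) ≡ letters x (suc s)
        go nothing eq = trans (cong (λ a → length (List.catMaybes (b ↾ s ∷ʳ a))) eq) (trans (cong length (catMaybes-∷ʳ-nothing (b ↾ s)))
          (trans (len s) (sym (trans (cong (letters x s +_) (trans (entry-e readsOf s) (cong reads eq))) (ℕ.+-identityʳ _)))))
        go (just a) eq = trans (cong (λ a → length (List.catMaybes (b ↾ s ∷ʳ a))) eq) (trans (cong length (catMaybes-∷ʳ-just (b ↾ s) a))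
          (trans (length-++ (List.catMaybes (b ↾ s))) (cong₂ _+_ (len s) (sym (trans (entry-e readsOf s) (cong reads eq))))))

    letter-e : ∀ s {a} → b s ≡ just a → a ≡ σ (letters x s)
    letter-e s {a} eq = ∷ʳ-injectiveʳ _ (σ ↾ letters x s) (begin
      List.catMaybes (b ↾ s) ∷ʳ a             ≡⟨ sym (catMaybes-∷ʳ-just (b ↾ s) a) ⟩
      List.catMaybes (b ↾ s ∷ʳ just a)        ≡⟨ cong (λ a → List.catMaybes (b ↾ s ∷ʳ a)) (sym eq) ⟩
      List.catMaybes (b ↾ s ∷ʳ b s)           ≡⟨ cong List.catMaybes (applyUpTo-∷ʳ b s) ⟩
      List.catMaybes (b ↾ suc s)              ≡⟨ letters-e (suc s) ⟩
      σ ↾ letters x (suc s)                   ≡⟨ cong (σ ↾_) (trans (cong (letters x s +_) (trans (entry-e readsOf s) (cong reads eq))) (ℕ.+-comm _ 1)) ⟩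
      σ ↾ suc (letters x s)                   ≡⟨ sym (applyUpTo-∷ʳ σ (letters x s)) ⟩
      σ ↾ letters x s ∷ʳ σ (letters x s)      ∎)
      where open ≡-Reasoning

    no-error : ∀ i → err x (codesOf σ) i ≡ 0
    no-error i = cong₂ _+_ (cong isZero (entry-e one i))
      (cong₂ _+_ (trans (entry-e forbidden i) (if-T (proj₁ (proj₂ (step i)))))
      (cong₂ _+_ (trans (cong₂ differ (entry-e sourceOf i) (current-e i)) (differ-refl (sourceOf (e i))))
      (cong₂ _+_ (sumFin-all-zero k λ c → trans (cong₂ differ (trans (entry-e (testOf c) i) (counter-test c)) refl) (differ-refl (isPositive (val x c i))))
        (letter-ok (b i) refl))))
      where
      if-T : ∀ {b} → T b → (if b then 0 else 1) ≡ 0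
      if-T {true} _ = refl
      current-e : ∀ i → current x i ≡ toℕ (state (config i))
      current-e zero    = cong (toℕ ∘ proj₁) (sym initial)
      current-e (suc i) = entry-e targetOf i
      counter-test : ∀ c → toℕ (lookup (Vec.map test (cs i)) c) ≡ isPositive (val x c i)
      counter-test c = trans (cong toℕ (Vec.lookup-map c test (cs i))) (trans (toℕ-test _) (cong isPositive (sym (val-e c i))))
      letter-ok : ∀ a → b i ≡ a → entry readsOf (x i) * differ (entry letterOf (x i)) (codesOf σ (letters x i)) ≡ 0
      letter-ok nothing  eq = cong (_* differ (entry letterOf (x i)) (codesOf σ (letters x i))) (trans (entry-e readsOf i) (cong reads eq))
      letter-ok (just a) eq = trans (cong₂ _*_ (trans (entry-e readsOf i) (cong reads eq))
        (trans (cong₂ differ (trans (entry-e letterOf i) (cong letterCode eq)) (cong (suc ∘ toℕ) (sym (letter-e i eq)))) (differ-refl (suc (toℕ a))))) refl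

    unbounded : ∀ m → ∃[ t ] letters x t ≡ m
    unbounded m with proj₂ concatenates m
    ... | t , eq = t , trans (sym (length-↾ σ _)) (trans (cong length (trans (sym (letters-e t)) eq)) (length-↾ σ m))

    all-good : ∀ i → ∃[ s ] good x i s ≢ 0
    all-good i with unbounded i
    ... | t , read with proj₂ (proj₂ accepting) (i ⊔ t)
    ... | s , le , st = s , ≢0-* (zero-≢0 (ℕ.m≤n⇒m∸n≡0 (ℕ.≤-trans (ℕ.m≤m⊔n i t) le)))
        (≢0-* (zero-≢0 (ℕ.m≤n⇒m∸n≡0 (subst (_≤ letters x s) read (letters-mono x (ℕ.≤-trans (ℕ.m≤n⊔m i t) le)))))
          (subst (_≢ 0) (sym (trans (entry-e finalOf s) (cong (λ b → if b then 1 else 0)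
            (trans (cong (lookup F) st) (Vec.[]=⇒lookup (proj₁ (proj₂ accepting))))))) λ ()))
      where
      zero-≢0 : ∀ {y} → y ≡ 0 → isZero y ≢ 0
      zero-≢0 refl ()

  language∈Σ¹₁ : ExcludedMiddle 0ℓ → Σ¹₁ n (language A)
  language∈Σ¹₁ em = Rel , rel-recursive , λ σ → mk⇔
    (λ (b , concatenates , r , accepting) → let open FromRun σ b concatenates r accepting in
      writes e , checked⇒rel σ (writes e) (checked-cong σ (sym ∘ blocksOf-writes e) (no-error , all-good)))
    (λ (τ , r) → FromChecked.accepted em σ (blocksOf τ) (rel⇒checked σ τ r))

-- Real-time nets as nets

module WithoutLambda {k n : ℕ} (A : BüchiAutomaton k (Fin n)) where
  open BüchiAutomaton A

  Δ-just : Fin states → Maybe (Fin n) → Vec (Fin 2) k → Fin states → Vec Action k → Bool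
  Δ-just q (just a) i q′ j = Δ q a i q′ j
  Δ-just q nothing  i q′ j = false

  blind-just : ∀ q a i q′ j → T (Δ-just q a i q′ j) → ∀ m → lookup i m ≡ 0F →
               (lookup j m ≡ hold ⊎ lookup j m ≡ inc) × T (Δ-just q a (i [ m ]≔ 1F) q′ j)
  blind-just q (just a) = blind q a

  automaton : BüchiAutomaton k (Maybe (Fin n))
  automaton = record { machine = record { states = states ; q₀ = q₀ ; Δ = Δ-just ; blind = blind-just } ; F = F }

  catMaybes-just : ∀ (σ : ωWord n) t → List.catMaybes ((just ∘ σ) ↾ t) ≡ σ ↾ t
  catMaybes-just σ zero    = refl
  catMaybes-just σ (suc t) = cong (σ 0 ∷_) (catMaybes-just (σ ∘ suc) t)

  to : ∀ {σ} → realTimeLanguage A σ → language automaton σ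
  to {σ} (r , acc) = just ∘ σ , ((λ t → t , catMaybes-just σ t) , (λ m → m , catMaybes-just σ m)) ,
    record { config = config ; initial = initial ; step = step } , acc
    where open Run r

  -- No transition is labelled by λ, so each prefix of the labels yields as many letters as it has
  -- labels, and comparing lengths identifies these letters with those of `σ`.
  from : ∀ {σ} → language automaton σ → realTimeLanguage A σ
  from {σ} (b , (prefixes , _) , r , acc) = record { config = config ; initial = initial ; step = step′ } , acc
    where
    open BüchiAutomaton automaton using () renaming (module Run to Run′)
    open Run′ r
    letter : ∀ t → ∃[ a ] b t ≡ just a
    letter t with b t | step t
    ... | just a  | _ = a , refl
    ... | nothing | _ , () , _
    read : ∀ t → List.catMaybes (b ↾ t) ≡ (proj₁ ∘ letter) ↾ t
    read t = trans (cong List.catMaybes (↾-cong t (λ s _ → proj₂ (letter s)))) (catMaybes-just (proj₁ ∘ letter) t)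
    letter-σ : ∀ t → b t ≡ just (σ t)
    letter-σ t with prefixes (suc t)
    ... | m , eq = trans (proj₂ (letter t)) (cong just (↾-at (proj₁ ∘ letter) σ (suc t) agree ℕ.≤-refl))
      where
      m≡ : m ≡ suc t
      m≡ = trans (sym (length-↾ σ m)) (trans (cong length (trans (sym eq) (read (suc t)))) (length-↾ (proj₁ ∘ letter) (suc t)))
      agree : (proj₁ ∘ letter) ↾ suc t ≡ σ ↾ suc t
      agree = trans (sym (read (suc t))) (trans eq (cong (σ ↾_) m≡))
    step′ : ∀ t → σ t ∶ config t ↦ config (suc t)
    step′ t with step t
    ... | j , tr , eqs = j , subst (λ a → T (Δ-just _ a _ _ j)) (letter-σ t) tr , eqs

r-PNω⊆PNω : ∀ {n} {L : ωLang n} → r-PNω n L → PNω n L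
r-PNω⊆PNω (k , 1≤k , A , L⊆ , ⊆L) = k , 1≤k , automaton , to ∘ L⊆ , ⊆L ∘ from
  where open WithoutLambda A

noLetters∈Σ¹₁ : (L : ωLang 0) → Σ¹₁ 0 L
noLetters∈Σ¹₁ L = (λ _ _ _ → ⊤) ,
  (Computable.rec (constᶜ 1) , λ i u v → inj₁ (tt , Computable.computes (constᶜ 1) (i ∷ ⌜ u ⌝ ∷ ⌜ v ⌝ ∷ []))) ,
  λ σ → case σ 0 of λ ()

Σ¹₁-resp : ∀ {n} {L L′ : ωLang n} → L ≐ L′ → Σ¹₁ n L′ → Σ¹₁ n L
Σ¹₁-resp (L⊆ , ⊆L) (R , recursive , L′⇔) = R , recursive , λ σ →
  mk⇔ (Equivalence.to (L′⇔ σ) ∘ L⊆) (⊆L ∘ Equivalence.from (L′⇔ σ))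

PNω⊆Σ¹₁ : ExcludedMiddle 0ℓ → ∀ {n} {L : ωLang n} → PNω n L → Σ¹₁ n L
PNω⊆Σ¹₁ em {zero} {L} _ = noLetters∈Σ¹₁ L
PNω⊆Σ¹₁ em {suc n′} (_ , _ , A , L≐) = Σ¹₁-resp L≐ (CheckerCorrect.language∈Σ¹₁ A em)

-- From nets to analytic sets the language itself is kept. For the converse, one real-time net
-- serves both classes.
mainTheorem2 : (∀ ℓ → ExcludedMiddle ℓ) →
    EqualWadgeHierarchies r-PNω Σ¹₁ × EqualWadgeHierarchies PNω Σ¹₁
mainTheorem2 em =
  ( (λ {n} L _ L∈ → n , L , PNω⊆Σ¹₁ em₀ (r-PNω⊆PNω L∈) , ≡W-refl)
  , (λ L _ → analytic-degree L) ) ,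
  ( (λ {n} L _ L∈ → n , L , PNω⊆Σ¹₁ em₀ L∈ , ≡W-refl)
  , λ L _ L∈ → let m , L′ , L′∈ , eq = analytic-degree L L∈ in m , L′ , r-PNω⊆PNω L′∈ , eq )
  where
  em₀ : ExcludedMiddle 0ℓ
  em₀ = em 0ℓ
  open AnalyticToNet em₀ using (analytic-degree)
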